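{- The number $a_{1,0}(N)$ of lattice walks in $\mathbb{Z}^2$ of length $N$, with steps in $\{(1,0),(-1,0),(0,2),(0,-1)\}$, starting at $(0,0)$, ending at $(1,0)$, and never visiting a point $(-k,0)$ with $k\ge0$ after the starting point, equals $$a_{1,0}(N)=\binom{N}{\frac{N-1}2}+\sum_{n=1}^{\lfloor N/3\rfloor}\frac{3^{3n-1}}{n\,2^{2n}}\binom{N-1}{3n-1}\binom{N-3n}{\frac{N-3n}{2}}$$ $$\qquad+\sum_{n,m,k}\frac{3^{3m+2}}{nN\,2^{2m+2}}\binom{n}{k,\,2k+1,\,n-3k-1}\binom{N-n}{3m+2}\binom{N-3m-3k-3}{\frac{N-3m-3k-4}{2}},$$ where $\binom{A}{B+1/2}$ is interpreted as $0$ for all integers $A,B$, and the second sum ranges over all $n,m,k$ such that $1\le n\le N$, $0\le m\le\frac{N-n-2}{3}$ and $0\le k\le\frac{n-1}{3}$.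
   Context: $\binom{n}{a,b,c}=\frac{n!}{a!\,b!\,c!}$ (with $a+b+c=n$) is the multinomial coefficient. The length of a walk is its number of steps.
   Formalization: The printed formula fails at N=3 (one walk, but the right side is 21/4); proved here for N≥1 with leading term (1/N)·binom(N,(N-1)/2) and with the last binomial of the first sum equal to binom(N-3n,(N-3n-1)/2). -}

module Defs where

open import Data.Integer.Base as ℤ using (ℤ; +_; -[1+_]; -_; _⊖_)
import Data.Integer.Properties as ℤ
open import Data.List.Base
  using (List; []; _∷_; cartesianProductWith; filter; foldr; length; map; upTo)
open import Data.Nat.Base using (ℕ; zero; suc; NonZero; _!; _∸_; _^_; _≡ᵇ_)
import Data.Nat.Base as ℕ
open import Data.Nat.Combinatorics using (_C_)
open import Data.Nat.DivMod using () renaming (_/_ to _div_; _%_ to _mod_)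
open import Data.Nat.Properties using (_≤?_; _!≢0; m*n≢0; m^n≢0)
open import Data.Bool.Base using (if_then_else_)
open import Data.Product.Base using (_×_; _,_; ∃)
open import Data.Product.Properties using (≡-dec)
open import Data.Rational.Base using (ℚ; 0ℚ; _+_; _*_; _/_)
open import Data.Vec.Base using (Vec; []; _∷_)
open import Data.Vec.Relation.Unary.All using (All; all?)
open import Relation.Binary.PropositionalEquality using (_≡_; refl)
open import Relation.Nullary using (¬_; Dec; yes; no; ¬?; _×-dec_)

Point : Set
Point = ℤ × ℤ

_⊕_ : Point → Point → Point
(x , y) ⊕ (u , v) = (x ℤ.+ u , y ℤ.+ v)

steps : List Point
steps = (+ 1 , + 0) ∷ (- + 1 , + 0) ∷ (+ 0 , + 2) ∷ (+ 0 , - + 1) ∷ []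

-- A walk is encoded by its sequence of steps; since the four steps are
-- distinct, each walk of length N with a given start is listed exactly once.
stepSequences : (N : ℕ) → List (Vec Point N)
stepSequences zero    = [] ∷ []
stepSequences (suc N) = cartesianProductWith _∷_ steps (stepSequences N)

-- The points visited after the starting point p.
visited : ∀ {N} → Point → Vec Point N → Vec Point N
visited p []      = []
visited p (s ∷ w) = (p ⊕ s) ∷ visited (p ⊕ s) w

endpoint : ∀ {N} → Point → Vec Point N → Point
endpoint p []      = p
endpoint p (s ∷ w) = endpoint (p ⊕ s) w

OnSlit : Point → Set
OnSlit p = ∃ λ (k : ℕ) → p ≡ (- + k , + 0)

onSlit? : (p : Point) → Dec (OnSlit p)
onSlit? (+ zero    , + zero)    = yes (0 , refl)
onSlit? (-[1+ n ]  , + zero)    = yes (suc n , refl)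
onSlit? (+ (suc n) , + zero)    = no λ { (zero , ()) ; (suc k , ()) }
onSlit? (x         , + (suc n)) = no λ { (k , ()) }
onSlit? (x         , -[1+ n ])  = no λ { (k , ()) }

origin : Point
origin = (+ 0 , + 0)

IsSlitWalkTo : ∀ {N} → Point → Vec Point N → Set
IsSlitWalkTo q w = endpoint origin w ≡ q × All (λ p → ¬ OnSlit p) (visited origin w)

isSlitWalkTo? : ∀ {N} q (w : Vec Point N) → Dec (IsSlitWalkTo q w)
isSlitWalkTo? q w =
  ≡-dec ℤ._≟_ ℤ._≟_ (endpoint origin w) q
    ×-dec all? (λ p → ¬? (onSlit? p)) (visited origin w)

-- The number of slit walks of length N ending at the given point.
a[_] : Point → ℕ → ℕ
a[ q ] N = length (filter (isSlitWalkTo? q) (stepSequences N))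

fromℕ : ℕ → ℚ
fromℕ n = + n / 1

-- A C½ t is the binomial coefficient "A choose t/2", which is 0 when t is
-- odd.  The argument t is an integer because t = -1 does occur, and must
-- give 0; a truncated difference would turn it into A C 0 = 1.
infixl 6.5 _C½_
_C½_ : ℕ → ℤ → ℕ
A C½ (+ t)    = if t mod 2 ≡ᵇ 0 then A C (t div 2) else 0
A C½ -[1+ _ ] = 0

-- Meaningful when a + b + c = n.
multinomial : (n a b c : ℕ) → ℚ
multinomial n a b c = + (n !) / (a ! ℕ.* b ! ℕ.* c !)
  where instance
    _ = m*n≢0 (a ! ℕ.* b !) (c !)
          {{m*n≢0 (a !) (b !) {{a !≢0}} {{b !≢0}}}} {{c !≢0}}

∑ : List ℕ → (ℕ → ℚ) → ℚ
∑ is f = foldr _+_ 0ℚ (map f is)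

infix 5 ∑
syntax ∑ is (λ i → e) = ∑[ i ∈ is ] e

-- All differences written with _∸_ below are between naturals whose
-- difference is nonnegative for the indices summed over.

coeff₁ : (n : ℕ) .{{_ : NonZero n}} → ℚ
coeff₁ n {{n≢0}} = + (3 ^ (3 ℕ.* n ∸ 1)) / (n ℕ.* 2 ^ (2 ℕ.* n))
  where instance
    _ = m*n≢0 n (2 ^ (2 ℕ.* n)) {{n≢0}} {{m^n≢0 2 (2 ℕ.* n)}}

term₁ : (N n : ℕ) .{{_ : NonZero n}} → ℚ
term₁ N n =
  coeff₁ n
    * fromℕ ((N ∸ 1) C (3 ℕ.* n ∸ 1))
    * fromℕ ((N ∸ 3 ℕ.* n) C½ (N ⊖ (3 ℕ.* n ℕ.+ 1)))

coeff₂ : (N n m : ℕ) .{{_ : NonZero N}} .{{_ : NonZero n}} → ℚ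
coeff₂ N n m = + (3 ^ (3 ℕ.* m ℕ.+ 2)) / (n ℕ.* N ℕ.* 2 ^ (2 ℕ.* m ℕ.+ 2))
  where instance
    _ = m*n≢0 (n ℕ.* N) (2 ^ (2 ℕ.* m ℕ.+ 2))
          {{m*n≢0 n N}} {{m^n≢0 2 (2 ℕ.* m ℕ.+ 2)}}

term₂ : (N n m k : ℕ) .{{_ : NonZero N}} .{{_ : NonZero n}} → ℚ
term₂ N n m k =
  coeff₂ N n m
    * multinomial n k (2 ℕ.* k ℕ.+ 1) (n ∸ (3 ℕ.* k ℕ.+ 1))
    * fromℕ ((N ∸ n) C (3 ℕ.* m ℕ.+ 2))
    * fromℕ ((N ∸ (3 ℕ.* m ℕ.+ 3 ℕ.* k ℕ.+ 3)) C½ (N ⊖ (3 ℕ.* m ℕ.+ 3 ℕ.* k ℕ.+ 4)))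

-- 0 ≤ m ≤ (N - n - 2) / 3; there is no such m when N - n < 2.
mRange : (N n : ℕ) → List ℕ
mRange N n = filter (λ m → n ℕ.+ 3 ℕ.* m ℕ.+ 2 ≤? N) (upTo N)

-- 0 ≤ k ≤ (n - 1) / 3.
kRange : (n : ℕ) → List ℕ
kRange n = filter (λ k → 3 ℕ.* k ℕ.+ 1 ≤? n) (upTo n)

-- The index n runs over 1, …, ⌊N/3⌋, written as n = suc i.
sum₁ : (N : ℕ) → ℚ
sum₁ N = ∑[ i ∈ upTo (N div 3) ] term₁ N (suc i)

-- The index n runs over 1, …, N, written as n = suc i.
sum₂ : (N : ℕ) .{{_ : NonZero N}} → ℚ
sum₂ N =
  ∑[ i ∈ upTo N ] ∑[ m ∈ mRange N (suc i) ] ∑[ k ∈ kRange (suc i) ] term₂ N (suc i) m k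

-- The formula for walks ending at (1,0) is published with leading term
-- N C½ (N ⊖ 1), without the factor 1/N, and with lower index (N - 3n)/2
-- rather than (N - 3n - 1)/2 in the last binomial coefficient of term₁.
-- That version is already false for N = 3, where it gives 21/4 although
-- there is exactly one walk; see published-fails.
publishedTerm₁ : (N n : ℕ) .{{_ : NonZero n}} → ℚ
publishedTerm₁ N n =
  coeff₁ n
    * fromℕ ((N ∸ 1) C (3 ℕ.* n ∸ 1))
    * fromℕ ((N ∸ 3 ℕ.* n) C½ (N ⊖ 3 ℕ.* n))

publishedFormula : (N : ℕ) .{{_ : NonZero N}} → ℚ
publishedFormula N =
  fromℕ (N C½ (N ⊖ 1))
    + (∑[ i ∈ upTo (N div 3) ] publishedTerm₁ N (suc i))
    + sum₂ N

published-at-3 : publishedFormula 3 ≡ + 21 / 4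
published-at-3 = refl

published-fails :
  ¬ (∀ N .{{_ : NonZero N}} → fromℕ (a[ (+ 1 , + 0) ] N) ≡ publishedFormula N)
published-fails h with h 3
... | ()

{-# OPTIONS --safe #-}

-- Cut at its visits to the axis y = 0, a walk is a one-dimensional walk with
-- arbitrary jumps, and slit walks are the walks that stay positive.  Let S(x; t)
-- count the slit walks ending on the axis, H(x; t) the walks killed at their
-- first return to the slit and B(x; t) all walks ending on the axis.  Then
-- S = (1 - H) B, where S - 1 has only positive and H only nonpositive powers of
-- x, so that S is the positive Wiener–Hopf factor of B, and the coefficient of
-- x in t dS/dt, hence N a(N), is the coefficient of x t^N in
-- L = t d/dt log B.
--
-- With X = x + 1/x we have B = D(u³)/(1 - tX) for u = t/(1 - tX) and
-- D(z) = Σ C(3n,n) z^n, hence 1 + L = R(u³)/(1 - tX) with R D = D + 3z dD/dz.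
-- The Rothe–Hagen identity gives R(z) = (1 + (9/4) z T(z))/(1 - 27z/4), where
-- T = 1 + z T³.  The term 1 in the numerator yields the first sum of the formula
-- and the term with T yields the second.
module Submission where

open import Algebra.Bundles using (CommutativeRing; CommutativeSemiring)
open import Algebra.Definitions using (LeftCancellative)
import Algebra.Properties.CommutativeMonoid.Mult as CommutativeMonoidMult
import Algebra.Properties.CommutativeSemigroup as CommutativeSemigroupProperties
import Algebra.Properties.Group as GroupProperties
import Algebra.Properties.Semiring.Exp as Exp
import Algebra.Properties.Semiring.Mult as Mult
import Algebra.Solver.Ring.NaturalCoefficients.Default as NaturalSolver
open import Algebra.Structures using (IsCommutativeMonoid)
open import Algebra.Structures.Biased using (isCommutativeSemiringˡ)
open import Data.Bool.Base using (true; false)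
open import Data.Integer.Base as ℤ using (ℤ; +_; -[1+_]; -_; _⊖_)
import Data.Integer.Properties as ℤ
import Data.Integer.Tactic.RingSolver as ℤ-Solver
open import Data.List.Base using (List; []; _∷_; _++_; applyUpTo; cartesianProductWith; filter; length; map; upTo)
import Data.List.Properties as List
open import Data.Nat.Base as ℕ using (ℕ; zero; suc; NonZero; _!; _∸_; _≡ᵇ_)
open import Data.Nat.Combinatorics
  using (_C_; nC1≡n; k>n⇒nCk≡0; nCk+nC[k+1]≡[n+1]C[k+1]; nCk≡n!/k![n-k]!; k![n∸k]!∣n!)
open import Data.Nat.DivMod using (m/n*n≡m; m/n≡1+[m∸n]/n; m/n≤m; m≡m%n+[m/n]*n; m%n<n)
  renaming (_/_ to _div_; _%_ to _mod_)
open import Data.Nat.Induction using (<-rec)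
open import Data.Nat.ListAction using (sum)
import Data.Nat.Properties as ℕ
import Data.Nat.Tactic.RingSolver as ℕ-Solver
open import Data.Product.Base using (_,_; proj₁; proj₂) renaming (_×_ to _∧_)
open import Data.Product.Properties using (≡-dec)
open import Data.Rational.Base as ℚ using (ℚ; 0ℚ; 1ℚ; _/_; fromℚᵘ; toℚᵘ)
import Data.Rational.Properties as ℚ
import Data.Rational.Unnormalised.Base as ℚᵘ
import Data.Rational.Unnormalised.Properties as ℚᵘ
open import Data.Sum.Base using (inj₁; inj₂)
open import Data.Vec.Base using (Vec; []; _∷_)
open import Data.Vec.Relation.Unary.All using (All; all?; []; _∷_)
open import Defs
open import Function.Base using (_∘_; id)
open import Level using (0ℓ)
open import Relation.Binary.PropositionalEquality.Core as ≡ using (_≡_)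
import Relation.Binary.Reasoning.Setoid as SetoidReasoning
open import Relation.Binary.Structures using (IsEquivalence)
open import Relation.Nullary using (¬_; Dec; yes; no; ¬?; _×-dec_; contradiction)
open import Relation.Unary using (Pred; Decidable)

-- The tower ℚ, ℚ[[x]], ℚ[[x]][[t]] consists of commutative semirings, so the argument avoids
-- inverses, logarithms and negative powers. With ξ for the horizontal variable of the overview,
-- negative powers disappear when x stands for 1/ξ and t for tξ: the four steps weigh t, t x², t x
-- and t x, and 1 + x² takes the role of X. With θ = t d/dt, the equation (1 + L) B = (1 + θ) B
-- replaces θ log B. The operator 1 + θ is preferred to θ because it passes through f ↦ f(u)/(1 -
-- tX), u = tx/(1 - tX), at the cost of just one more factor 1/(1 - tX). Uniqueness of the splitting
-- into positive and nonpositive powers is an induction on the degree in t, carried out on θS = L₊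
-- S, where L₊ is the positive part of L. The closed form of R originates in D = T/(3 - 2T), which
-- gives R = T(4T - 3)/(3 - 2T)². As z = (T - 1)/T³, one has 1 - 27z/4 = (T + 3)(3 - 2T)²/(4T³): the
-- branch point 4/27 of T accounts for the denominator, and what remains is 1 + 9(T - 1)/(4T²) = 1 +
-- (9/4) z T. The proof checks this form coefficientwise.

-- Formal power series over a commutative semiring.

module PowerSeries (R : CommutativeSemiring 0ℓ 0ℓ) where

  open CommutativeSemiring R
  open Mult semiring using (_×_; ×-congʳ; ×-homo-+; ×-comm-*; ×-assoc-*)
  open CommutativeMonoidMult +-commutativeMonoid using (×-distrib-+)
  open CommutativeSemigroupProperties +-commutativeSemigroup using (interchange)
  open SetoidReasoning setoid

  Series : Set
  Series = ℕ → Carrier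

  infix 4 _≋_
  _≋_ : Series → Series → Set
  f ≋ g = ∀ n → f n ≈ g n

  tail : Series → Series
  tail f = f ∘ suc

  0ˢ 1ˢ : Series
  0ˢ _ = 0#
  1ˢ zero    = 1#
  1ˢ (suc _) = 0#

  infixl 6 _⊞_
  infixl 7 _⊛_ _∙_

  _⊞_ : Series → Series → Series
  (f ⊞ g) n = f n + g n

  _∙_ : Carrier → Series → Series
  (c ∙ f) n = c * f n

  -- The recursion strips the constant term off the left factor. It involves no index subtraction,
  -- so the semiring laws become structural inductions.
  _⊛_ : Series → Series → Series
  (f ⊛ g) zero    = f 0 * g 0
  (f ⊛ g) (suc n) = f 0 * g (suc n) + (tail f ⊛ g) n

  -- The mirror image of the defining recursion, which strips the right factor; commutativity is the
  -- agreement of the two.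
  ⊛-suc : ∀ f g n → (f ⊛ g) (suc n) ≈ (f ⊛ tail g) n + f (suc n) * g 0
  ⊛-suc f g zero    = refl
  ⊛-suc f g (suc n) = begin
    f 0 * g (2 ℕ.+ n) + (tail f ⊛ g) (suc n)                            ≈⟨ +-congˡ (⊛-suc (tail f) g n) ⟩
    f 0 * g (2 ℕ.+ n) + ((tail f ⊛ tail g) n + f (2 ℕ.+ n) * g 0)       ≈⟨ +-assoc _ _ _ ⟨
    (f ⊛ tail g) (suc n) + f (2 ℕ.+ n) * g 0                            ∎

  ⊛-comm : ∀ f g → f ⊛ g ≋ g ⊛ f
  ⊛-comm f g zero    = *-comm _ _
  ⊛-comm f g (suc n) = begin
    f 0 * g (suc n) + (tail f ⊛ g) n  ≈⟨ +-cong (*-comm _ _) (⊛-comm (tail f) g n) ⟩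
    g (suc n) * f 0 + (g ⊛ tail f) n  ≈⟨ +-comm _ _ ⟩
    (g ⊛ tail f) n + g (suc n) * f 0  ≈⟨ ⊛-suc g f n ⟨
    (g ⊛ f) (suc n)                   ∎

  ⊛-cong : ∀ {f f′ g g′} → f ≋ f′ → g ≋ g′ → f ⊛ g ≋ f′ ⊛ g′
  ⊛-cong p q zero    = *-cong (p 0) (q 0)
  ⊛-cong p q (suc n) = +-cong (*-cong (p 0) (q (suc n))) (⊛-cong (p ∘ suc) q n)

  ⊛-distribʳ-⊞ : ∀ h f g → (f ⊞ g) ⊛ h ≋ f ⊛ h ⊞ g ⊛ h
  ⊛-distribʳ-⊞ h f g zero    = distribʳ _ _ _
  ⊛-distribʳ-⊞ h f g (suc n) = begin
    (f 0 + g 0) * h (suc n) + ((tail f ⊞ tail g) ⊛ h) n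
      ≈⟨ +-cong (distribʳ _ _ _) (⊛-distribʳ-⊞ h (tail f) (tail g) n) ⟩
    (f 0 * h (suc n) + g 0 * h (suc n)) + ((tail f ⊛ h) n + (tail g ⊛ h) n)
      ≈⟨ interchange _ _ _ _ ⟩
    (f ⊛ h) (suc n) + (g ⊛ h) (suc n) ∎

  ⊛-distribˡ-⊞ : ∀ h f g → h ⊛ (f ⊞ g) ≋ h ⊛ f ⊞ h ⊛ g
  ⊛-distribˡ-⊞ h f g n = begin
    (h ⊛ (f ⊞ g)) n        ≈⟨ ⊛-comm h (f ⊞ g) n ⟩
    ((f ⊞ g) ⊛ h) n        ≈⟨ ⊛-distribʳ-⊞ h f g n ⟩
    (f ⊛ h) n + (g ⊛ h) n  ≈⟨ +-cong (⊛-comm f h n) (⊛-comm g h n) ⟩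
    (h ⊛ f) n + (h ⊛ g) n  ∎

  ∙-⊛ : ∀ c f g → (c ∙ f) ⊛ g ≋ c ∙ (f ⊛ g)
  ∙-⊛ c f g zero    = *-assoc _ _ _
  ∙-⊛ c f g (suc n) = begin
    c * f 0 * g (suc n) + (c ∙ tail f ⊛ g) n      ≈⟨ +-cong (*-assoc _ _ _) (∙-⊛ c (tail f) g n) ⟩
    c * (f 0 * g (suc n)) + c * (tail f ⊛ g) n    ≈⟨ distribˡ _ _ _ ⟨
    c * (f ⊛ g) (suc n)                           ∎

  ⊛-∙ : ∀ c f g → f ⊛ (c ∙ g) ≋ c ∙ (f ⊛ g)
  ⊛-∙ c f g n = begin
    (f ⊛ (c ∙ g)) n  ≈⟨ ⊛-comm f (c ∙ g) n ⟩
    ((c ∙ g) ⊛ f) n  ≈⟨ ∙-⊛ c g f n ⟩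
    c * (g ⊛ f) n    ≈⟨ *-congˡ (⊛-comm g f n) ⟩
    c * (f ⊛ g) n    ∎

  ⊛-assoc : ∀ f g h → (f ⊛ g) ⊛ h ≋ f ⊛ (g ⊛ h)
  ⊛-assoc f g h zero    = *-assoc _ _ _
  ⊛-assoc f g h (suc n) = begin
    f 0 * g 0 * h (suc n) + ((f 0 ∙ tail g ⊞ tail f ⊛ g) ⊛ h) n
      ≈⟨ +-cong (*-assoc _ _ _) (⊛-distribʳ-⊞ h (f 0 ∙ tail g) (tail f ⊛ g) n) ⟩
    f 0 * (g 0 * h (suc n)) + ((f 0 ∙ tail g ⊛ h) n + ((tail f ⊛ g) ⊛ h) n)
      ≈⟨ +-congˡ (+-cong (∙-⊛ (f 0) (tail g) h n) (⊛-assoc (tail f) g h n)) ⟩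
    f 0 * (g 0 * h (suc n)) + (f 0 * (tail g ⊛ h) n + (tail f ⊛ (g ⊛ h)) n)
      ≈⟨ +-assoc _ _ _ ⟨
    f 0 * (g 0 * h (suc n)) + f 0 * (tail g ⊛ h) n + (tail f ⊛ (g ⊛ h)) n
      ≈⟨ +-congʳ (distribˡ _ _ _) ⟨
    (f ⊛ (g ⊛ h)) (suc n) ∎

  -- Congruence at one coefficient only: degree arguments and inductions on the degree know the
  -- factors only under the constraint i + j = n.
  ⊛-cong-at : ∀ {f f′ g g′} n → (∀ i j → i ℕ.+ j ≡ n → f i * g j ≈ f′ i * g′ j) →
              (f ⊛ g) n ≈ (f′ ⊛ g′) n
  ⊛-cong-at zero    e = e 0 0 ≡.refl
  ⊛-cong-at (suc n) e =
    +-cong (e 0 (suc n) ≡.refl) (⊛-cong-at n λ i j p → e (suc i) j (≡.cong suc p))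

  0ˢ-⊛ : ∀ f → 0ˢ ⊛ f ≋ 0ˢ
  0ˢ-⊛ f zero    = zeroˡ _
  0ˢ-⊛ f (suc n) = trans (+-cong (zeroˡ _) (0ˢ-⊛ f n)) (+-identityˡ _)

  ⊛-vanishes : ∀ {f g} n → (∀ i j → i ℕ.+ j ≡ n → f i * g j ≈ 0#) → (f ⊛ g) n ≈ 0#
  ⊛-vanishes {g = g} n e =
    trans (⊛-cong-at n λ i j p → trans (e i j p) (sym (zeroˡ (g j)))) (0ˢ-⊛ g n)

  1ˢ-⊛ : ∀ f → 1ˢ ⊛ f ≋ f
  1ˢ-⊛ f zero    = *-identityˡ _
  1ˢ-⊛ f (suc n) = trans (+-cong (*-identityˡ _) (0ˢ-⊛ f n)) (+-identityʳ _)

  ≋-isEquivalence : IsEquivalence _≋_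
  ≋-isEquivalence = record
    { refl = λ _ → refl ; sym = λ p n → sym (p n) ; trans = λ p q n → trans (p n) (q n) }

  ⊞-isCommutativeMonoid : IsCommutativeMonoid _≋_ _⊞_ 0ˢ
  ⊞-isCommutativeMonoid = record
    { isMonoid = record
      { isSemigroup = record
        { isMagma = record
          { isEquivalence = ≋-isEquivalence
          ; ∙-cong        = λ p q n → +-cong (p n) (q n)
          }
        ; assoc = λ f g h n → +-assoc (f n) (g n) (h n)
        }
      ; identity = (λ f n → +-identityˡ (f n)) , (λ f n → +-identityʳ (f n))
      }
    ; comm = λ f g n → +-comm (f n) (g n)
    }

  ⊛-isCommutativeMonoid : IsCommutativeMonoid _≋_ _⊛_ 1ˢ
  ⊛-isCommutativeMonoid = record
    { isMonoid = record
      { isSemigroup = record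
        { isMagma = record { isEquivalence = ≋-isEquivalence ; ∙-cong = ⊛-cong }
        ; assoc   = ⊛-assoc
        }
      ; identity = 1ˢ-⊛ , λ f n → trans (⊛-comm f 1ˢ n) (1ˢ-⊛ f n)
      }
    ; comm = ⊛-comm
    }

  commutativeSemiring : CommutativeSemiring 0ℓ 0ℓ
  commutativeSemiring = record
    { isCommutativeSemiring = isCommutativeSemiringˡ record
      { +-isCommutativeMonoid = ⊞-isCommutativeMonoid
      ; *-isCommutativeMonoid = ⊛-isCommutativeMonoid
      ; distribʳ              = ⊛-distribʳ-⊞
      ; zeroˡ                 = 0ˢ-⊛
      }
    }

  θ : Series → Series
  θ f n = n × f n

  θ-cong : ∀ {f g} → f ≋ g → θ f ≋ θ g
  θ-cong p n = ×-congʳ n (p n)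

  θ-⊞ : ∀ f g → θ (f ⊞ g) ≋ θ f ⊞ θ g
  θ-⊞ f g n = ×-distrib-+ (f n) (g n) n

  private
    -- Passing to the tail raises every weight by one, so the Leibniz rule becomes inductive only
    -- with an arbitrary shift `c` of the weights.
    Θ : ℕ → Series → Series
    Θ c f n = (c ℕ.+ n) × f n

    Θ-tail : ∀ c f → tail (Θ c f) ≋ Θ (suc c) (tail f)
    Θ-tail c f n = reflexive (≡.cong (_× f (suc n)) (ℕ.+-suc c n))

    Θ-⊛ : ∀ c f g → Θ c (f ⊛ g) ≋ Θ c f ⊛ g ⊞ f ⊛ θ g
    Θ-⊛ c f g zero = begin
      (c ℕ.+ 0) × (f 0 * g 0)          ≈⟨ ×-assoc-* (c ℕ.+ 0) _ _ ⟨
      (c ℕ.+ 0) × f 0 * g 0            ≈⟨ +-identityʳ _ ⟨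
      (c ℕ.+ 0) × f 0 * g 0 + 0#       ≈⟨ +-congˡ (zeroʳ _) ⟨
      (c ℕ.+ 0) × f 0 * g 0 + f 0 * 0# ∎
    Θ-⊛ c f g (suc n) = begin
      (c ℕ.+ suc n) × (f 0 * g (suc n) + (tail f ⊛ g) n)
        ≈⟨ ×-distrib-+ _ _ (c ℕ.+ suc n) ⟩
      (c ℕ.+ suc n) × (f 0 * g (suc n)) + (c ℕ.+ suc n) × (tail f ⊛ g) n
        ≈⟨ +-cong (×-homo-+ _ c (suc n)) (Θ-tail′ n) ⟩
      c × (f 0 * g (suc n)) + suc n × (f 0 * g (suc n)) + Θ (suc c) (tail f ⊛ g) n
        ≈⟨ +-cong (+-cong (sym (×-assoc-* c _ _)) (sym (×-comm-* (suc n) _ _)))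
                  (Θ-⊛ (suc c) (tail f) g n) ⟩
      c × f 0 * g (suc n) + f 0 * (suc n × g (suc n)) + ((Θ (suc c) (tail f) ⊛ g) n + (tail f ⊛ θ g) n)
        ≈⟨ interchange _ _ _ _ ⟩
      (c × f 0 * g (suc n) + (Θ (suc c) (tail f) ⊛ g) n) + (f ⊛ θ g) (suc n)
        ≈⟨ +-congʳ (+-cong (*-congʳ (reflexive (≡.cong (_× f 0) (≡.sym (ℕ.+-identityʳ c)))))
                           (⊛-cong (λ m → sym (Θ-tail c f m)) (λ _ → refl) n)) ⟩
      (Θ c f ⊛ g) (suc n) + (f ⊛ θ g) (suc n) ∎
      where
      Θ-tail′ : ∀ m → (c ℕ.+ suc m) × (tail f ⊛ g) m ≈ Θ (suc c) (tail f ⊛ g) m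
      Θ-tail′ m = reflexive (≡.cong (_× (tail f ⊛ g) m) (ℕ.+-suc c m))

  θ-⊛ : ∀ f g → θ (f ⊛ g) ≋ θ f ⊛ g ⊞ f ⊛ θ g
  θ-⊛ = Θ-⊛ 0

-- The substitution z = tx/(1 - tX).

module Substitution (R : CommutativeSemiring 0ℓ 0ℓ) (X x : CommutativeSemiring.Carrier R) where

  open CommutativeSemiring R
  open PowerSeries R
  open Mult semiring using (_×_; ×-comm-*)
  open CommutativeMonoidMult +-commutativeMonoid using (×-distrib-+)
  open Exp semiring using (_^_)
  open CommutativeSemigroupProperties +-commutativeSemigroup using (interchange)
  open SetoidReasoning setoid
  open NaturalSolver R using (solve; _:=_; _:+_; _:*_)

  -- sub f is f(tx/(1 - tX))/(1 - tX) as a power series in t, and sub² f is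
  -- f(tx/(1 - tX))/(1 - tX)².
  sub : Series → Series
  sub f zero    = f 0
  sub f (suc n) = X * sub f n + x * sub (tail f) n

  sub² : Series → Series
  sub² f zero    = f 0
  sub² f (suc n) = sub f (suc n) + X * sub² f n

  sub-cong : ∀ {f g} → f ≋ g → sub f ≋ sub g
  sub-cong p zero    = p 0
  sub-cong p (suc n) = +-cong (*-congˡ (sub-cong p n)) (*-congˡ (sub-cong (p ∘ suc) n))

  sub²-cong : ∀ {f g} → f ≋ g → sub² f ≋ sub² g
  sub²-cong p zero    = p 0
  sub²-cong p (suc n) = +-cong (sub-cong p (suc n)) (*-congˡ (sub²-cong p n))

  sub-⊞ : ∀ f g → sub (f ⊞ g) ≋ sub f ⊞ sub g
  sub-⊞ f g zero    = refl
  sub-⊞ f g (suc n) = begin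
    X * sub (f ⊞ g) n + x * sub (tail f ⊞ tail g) n
      ≈⟨ +-cong (*-congˡ (sub-⊞ f g n)) (*-congˡ (sub-⊞ (tail f) (tail g) n)) ⟩
    X * (sub f n + sub g n) + x * (sub (tail f) n + sub (tail g) n)
      ≈⟨ +-cong (distribˡ _ _ _) (distribˡ _ _ _) ⟩
    (X * sub f n + X * sub g n) + (x * sub (tail f) n + x * sub (tail g) n)
      ≈⟨ interchange _ _ _ _ ⟩
    sub f (suc n) + sub g (suc n) ∎

  sub²-⊞ : ∀ f g → sub² (f ⊞ g) ≋ sub² f ⊞ sub² g
  sub²-⊞ f g zero    = refl
  sub²-⊞ f g (suc n) = begin
    sub (f ⊞ g) (suc n) + X * sub² (f ⊞ g) n
      ≈⟨ +-cong (sub-⊞ f g (suc n)) (trans (*-congˡ (sub²-⊞ f g n)) (distribˡ _ _ _)) ⟩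
    (sub f (suc n) + sub g (suc n)) + (X * sub² f n + X * sub² g n)
      ≈⟨ interchange _ _ _ _ ⟩
    sub² f (suc n) + sub² g (suc n) ∎

  sub-∙ : ∀ c f → sub (c ∙ f) ≋ c ∙ sub f
  sub-∙ c f zero    = refl
  sub-∙ c f (suc n) = begin
    X * sub (c ∙ f) n + x * sub (c ∙ tail f) n
      ≈⟨ +-cong (*-congˡ (sub-∙ c f n)) (*-congˡ (sub-∙ c (tail f) n)) ⟩
    X * (c * sub f n) + x * (c * sub (tail f) n)
      ≈⟨ solve 5 (λ X x c a b → X :* (c :* a) :+ x :* (c :* b) := c :* (X :* a :+ x :* b))
               refl X x c _ _ ⟩
    c * sub f (suc n) ∎

  sub²-∙ : ∀ c f → sub² (c ∙ f) ≋ c ∙ sub² f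
  sub²-∙ c f zero    = refl
  sub²-∙ c f (suc n) = begin
    sub (c ∙ f) (suc n) + X * sub² (c ∙ f) n
      ≈⟨ +-cong (sub-∙ c f (suc n)) (*-congˡ (sub²-∙ c f n)) ⟩
    c * sub f (suc n) + X * (c * sub² f n)
      ≈⟨ solve 4 (λ X c a b → c :* a :+ X :* (c :* b) := c :* (a :+ X :* b)) refl X c _ _ ⟩
    c * sub² f (suc n) ∎

  -- f(z) = f(0) + z (tail f)(z) at z = tx/(1 - tX).
  sub-suc : ∀ f n → sub f (suc n) ≈ f 0 * X ^ suc n + x * sub² (tail f) n
  sub-suc f zero    = +-congʳ (trans (*-comm _ _) (*-congˡ (sym (*-identityʳ X))))
  sub-suc f (suc n) = begin
    X * sub f (suc n) + x * sub (tail f) (suc n)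
      ≈⟨ +-congʳ (*-congˡ (sub-suc f n)) ⟩
    X * (f 0 * X ^ suc n + x * sub² (tail f) n) + x * sub (tail f) (suc n)
      ≈⟨ solve 6 (λ X x f p a b → X :* (f :* p :+ x :* a) :+ x :* b := f :* (X :* p) :+ x :* (b :+ X :* a))
               refl X x (f 0) (X ^ suc n) _ _ ⟩
    f 0 * X ^ (2 ℕ.+ n) + x * sub² (tail f) (suc n) ∎

  sub²-suc : ∀ f n → sub² f (suc n) ≈ f 0 * X ^ suc n + (X * sub² f n + x * sub² (tail f) n)
  sub²-suc f n = begin
    sub f (suc n) + X * sub² f n
      ≈⟨ +-congʳ (sub-suc f n) ⟩
    f 0 * X ^ suc n + x * sub² (tail f) n + X * sub² f n
      ≈⟨ solve 3 (λ a b c → a :+ b :+ c := a :+ (c :+ b)) refl _ _ _ ⟩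
    f 0 * X ^ suc n + (X * sub² f n + x * sub² (tail f) n) ∎

  -- Each factor carries one 1/(1 - tX), so the product carries two. This is the reason for having
  -- `sub²`.
  sub-⊛ : ∀ f g → sub f ⊛ sub g ≋ sub² (f ⊛ g)
  sub-⊛ f g zero    = refl
  sub-⊛ f g (suc n) = begin
    f 0 * sub g (suc n) + ((X ∙ sub f ⊞ x ∙ sub (tail f)) ⊛ sub g) n
      ≈⟨ +-cong (*-congˡ (sub-suc g n)) expand ⟩
    f 0 * (g 0 * X ^ suc n + x * sub² (tail g) n) + (X * sub² (f ⊛ g) n + x * sub² (tail f ⊛ g) n)
      ≈⟨ solve 8 (λ X x f g p a b c →
           f :* (g :* p :+ x :* a) :+ (X :* b :+ x :* c) := f :* g :* p :+ (X :* b :+ x :* (f :* a :+ c)))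
           refl X x (f 0) (g 0) (X ^ suc n) _ _ _ ⟩
    f 0 * g 0 * X ^ suc n + (X * sub² (f ⊛ g) n + x * (f 0 * sub² (tail g) n + sub² (tail f ⊛ g) n))
      ≈⟨ +-congˡ (+-congˡ (*-congˡ tail-⊛)) ⟨
    f 0 * g 0 * X ^ suc n + (X * sub² (f ⊛ g) n + x * sub² (tail (f ⊛ g)) n)
      ≈⟨ sub²-suc (f ⊛ g) n ⟨
    sub² (f ⊛ g) (suc n) ∎
    where
    expand : ((X ∙ sub f ⊞ x ∙ sub (tail f)) ⊛ sub g) n ≈ X * sub² (f ⊛ g) n + x * sub² (tail f ⊛ g) n
    expand = begin
      ((X ∙ sub f ⊞ x ∙ sub (tail f)) ⊛ sub g) n
        ≈⟨ ⊛-distribʳ-⊞ (sub g) (X ∙ sub f) (x ∙ sub (tail f)) n ⟩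
      (X ∙ sub f ⊛ sub g) n + (x ∙ sub (tail f) ⊛ sub g) n
        ≈⟨ +-cong (∙-⊛ X (sub f) (sub g) n) (∙-⊛ x (sub (tail f)) (sub g) n) ⟩
      X * (sub f ⊛ sub g) n + x * (sub (tail f) ⊛ sub g) n
        ≈⟨ +-cong (*-congˡ (sub-⊛ f g n)) (*-congˡ (sub-⊛ (tail f) g n)) ⟩
      X * sub² (f ⊛ g) n + x * sub² (tail f ⊛ g) n ∎
    tail-⊛ : sub² (tail (f ⊛ g)) n ≈ f 0 * sub² (tail g) n + sub² (tail f ⊛ g) n
    tail-⊛ = trans (sub²-⊞ (f 0 ∙ tail g) (tail f ⊛ g) n) (+-congʳ (sub²-∙ (f 0) (tail g) n))

  -- The operator 1 + t d/dt, that is f ↦ d(tf)/dt.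
  θ⁺ : Series → Series
  θ⁺ f n = suc n × f n

  -- For u = tx/(1 - tX) one has t du/dt = u/(1 - tX). Differentiating the prefactor yields tX
  -- f(u)/(1 - tX)², and together with the summand f(u)/(1 - tX) of 1 + θ this is exactly f(u)/(1 -
  -- tX)².
  θ⁺-sub : ∀ f → θ⁺ (sub f) ≋ sub² (θ⁺ f)
  θ⁺-sub f zero    = refl
  θ⁺-sub f (suc n) = begin
    sub f (suc n) + suc n × sub f (suc n)
      ≈⟨ +-cong (sub-suc f n) (×-distrib-+ _ _ (suc n)) ⟩
    f 0 * X ^ suc n + x * sub² (tail f) n + (suc n × (X * sub f n) + suc n × (x * sub (tail f) n))
      ≈⟨ +-congˡ (+-cong (×-sub X f) (×-sub x (tail f))) ⟩
    f 0 * X ^ suc n + x * sub² (tail f) n + (X * sub² (θ⁺ f) n + x * sub² (θ⁺ (tail f)) n)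
      ≈⟨ solve 6 (λ X x p a b c → p :+ x :* a :+ (X :* b :+ x :* c) := p :+ (X :* b :+ x :* (a :+ c)))
               refl X x (f 0 * X ^ suc n) _ _ _ ⟩
    f 0 * X ^ suc n + (X * sub² (θ⁺ f) n + x * (sub² (tail f) n + sub² (θ⁺ (tail f)) n))
      ≈⟨ +-cong (*-congʳ (+-identityʳ (f 0))) (+-congˡ (*-congˡ (sub²-⊞ (tail f) (θ⁺ (tail f)) n))) ⟨
    θ⁺ f 0 * X ^ suc n + (X * sub² (θ⁺ f) n + x * sub² (tail (θ⁺ f)) n)
      ≈⟨ sub²-suc (θ⁺ f) n ⟨
    sub² (θ⁺ f) (suc n) ∎
    where
    ×-sub : ∀ c g → suc n × (c * sub g n) ≈ c * sub² (θ⁺ g) n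
    ×-sub c g = trans (sym (×-comm-* (suc n) c _)) (*-congˡ (θ⁺-sub g n))

  -- The hypothesis says f = 1 + θ log g. Both sides of the conclusion are `sub²` of the sides of
  -- the hypothesis, so a logarithmic derivative in z is carried over to one in t.
  sub-logDerivative : ∀ {f g} → f ⊛ g ≋ θ⁺ g → sub f ⊛ sub g ≋ θ⁺ (sub g)
  sub-logDerivative {f} {g} e n =
    trans (sub-⊛ f g n) (trans (sub²-cong e n) (sym (θ⁺-sub g n)))

-- Finite sums and the binomial expansion of the substitution.

module FiniteSums (R : CommutativeSemiring 0ℓ 0ℓ) where

  open CommutativeSemiring R
  open CommutativeSemigroupProperties +-commutativeSemigroup using (interchange)
  open SetoidReasoning setoid

  Σ< : ℕ → (ℕ → Carrier) → Carrier
  Σ< zero    f = 0#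
  Σ< (suc n) f = f 0 + Σ< n (f ∘ suc)

  Σ<-cong : ∀ n {f g} → (∀ i → i ℕ.< n → f i ≈ g i) → Σ< n f ≈ Σ< n g
  Σ<-cong zero    e = refl
  Σ<-cong (suc n) e = +-cong (e 0 ℕ.z<s) (Σ<-cong n λ i i<n → e (suc i) (ℕ.s<s i<n))

  Σ<-zero : ∀ n {f} → (∀ i → i ℕ.< n → f i ≈ 0#) → Σ< n f ≈ 0#
  Σ<-zero zero    e = refl
  Σ<-zero (suc n) e =
    trans (+-cong (e 0 ℕ.z<s) (Σ<-zero n λ i i<n → e (suc i) (ℕ.s<s i<n))) (+-identityˡ 0#)

  Σ<-+ : ∀ n (f g : ℕ → Carrier) → Σ< n (λ i → f i + g i) ≈ Σ< n f + Σ< n g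
  Σ<-+ zero    f g = sym (+-identityˡ 0#)
  Σ<-+ (suc n) f g = trans (+-congˡ (Σ<-+ n (f ∘ suc) (g ∘ suc))) (interchange _ _ _ _)

  *-Σ< : ∀ n c f → c * Σ< n f ≈ Σ< n (λ i → c * f i)
  *-Σ< zero    c f = zeroʳ c
  *-Σ< (suc n) c f = trans (distribˡ c _ _) (+-congˡ (*-Σ< n c (f ∘ suc)))

  Σ<-swap : ∀ m n (f : ℕ → ℕ → Carrier) → Σ< m (λ i → Σ< n (f i)) ≈ Σ< n (λ j → Σ< m (λ i → f i j))
  Σ<-swap zero    n f = sym (Σ<-zero n λ _ _ → refl)
  Σ<-swap (suc m) n f = trans (+-congˡ (Σ<-swap m n (f ∘ suc))) (sym (Σ<-+ n (f 0) _))

  Σ<-extend : ∀ {m n} (f : ℕ → Carrier) → m ℕ.≤ n → (∀ i → m ℕ.≤ i → f i ≈ 0#) → Σ< m f ≈ Σ< n f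
  Σ<-extend {n = n} f ℕ.z≤n       e = sym (Σ<-zero n λ i _ → e i ℕ.z≤n)
  Σ<-extend         f (ℕ.s≤s m≤n) e = +-congˡ (Σ<-extend (f ∘ suc) m≤n λ i m≤i → e (suc i) (ℕ.s≤s m≤i))

module BinomialExpansion (R : CommutativeSemiring 0ℓ 0ℓ) (X x : CommutativeSemiring.Carrier R) where

  open CommutativeSemiring R
  open FiniteSums R
  open PowerSeries R using (Series; tail)
  open Substitution R X x using (sub)
  open Mult semiring using (_×_; ×-congʳ; ×-congˡ; ×-homo-+; ×-comm-*)
  open Exp semiring using (_^_)
  open SetoidReasoning setoid
  open NaturalSolver R using (solve; _:=_; _:*_)

  term : ℕ → Series → ℕ → Carrier
  term N f j = (N C j) × (f j * (x ^ j * X ^ (N ∸ j)))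

  -- The coefficient of t^(N - j) in (1 - tX)^(-j-1) is C(N,j) X^(N-j): of the N steps, j are chosen
  -- to carry x. Pascal's rule mirrors the recursion of `sub`.
  sub-binomial : ∀ f N → sub f N ≈ Σ< (suc N) (term N f)
  sub-binomial f zero    = sym (begin
    f 0 * (1# * 1#) + 0# + 0#  ≈⟨ trans (+-identityʳ _) (+-identityʳ _) ⟩
    f 0 * (1# * 1#)            ≈⟨ trans (*-congˡ (*-identityʳ 1#)) (*-identityʳ (f 0)) ⟩
    f 0                        ∎)
  sub-binomial f (suc N) = begin
    X * sub f N + x * sub (tail f) N
      ≈⟨ +-cong (*-congˡ (sub-binomial f N)) (*-congˡ (sub-binomial (tail f) N)) ⟩
    X * Σ< (suc N) (term N f) + x * Σ< (suc N) (term N (tail f))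
      ≈⟨ +-congʳ (*-congˡ (Σ<-extend (term N f) (ℕ.n≤1+n (suc N)) beyond)) ⟩
    X * Σ< (2 ℕ.+ N) (term N f) + x * Σ< (suc N) (term N (tail f))
      ≈⟨ +-cong (*-Σ< (2 ℕ.+ N) X (term N f)) (*-Σ< (suc N) x (term N (tail f))) ⟩
    (X * term N f 0 + Σ< (suc N) (λ j → X * term N f (suc j))) + Σ< (suc N) (λ j → x * term N (tail f) j)
      ≈⟨ +-assoc _ _ _ ⟩
    X * term N f 0 + (Σ< (suc N) (λ j → X * term N f (suc j)) + Σ< (suc N) (λ j → x * term N (tail f) j))
      ≈⟨ +-cong first (sym (Σ<-+ (suc N) (λ j → X * term N f (suc j)) (λ j → x * term N (tail f) j))) ⟩
    term (suc N) f 0 + Σ< (suc N) (λ j → X * term N f (suc j) + x * term N (tail f) j)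
      ≈⟨ +-congˡ (Σ<-cong (suc N) pascal) ⟩
    Σ< (2 ℕ.+ N) (term (suc N) f) ∎
    where
    beyond : ∀ j → N ℕ.< j → term N f j ≈ 0#
    beyond j N<j = ×-congˡ (k>n⇒nCk≡0 N<j)
    first : X * term N f 0 ≈ term (suc N) f 0
    first = begin
      X * (f 0 * (1# * X ^ N) + 0#)  ≈⟨ *-congˡ (+-identityʳ _) ⟩
      X * (f 0 * (1# * X ^ N))
        ≈⟨ solve 4 (λ X f e p → X :* (f :* (e :* p)) := f :* (e :* (X :* p))) refl X (f 0) 1# (X ^ N) ⟩
      f 0 * (1# * X ^ suc N)         ≈⟨ +-identityʳ _ ⟨
      f 0 * (1# * X ^ suc N) + 0#    ∎
    pascal : ∀ j → j ℕ.< suc N → X * term N f (suc j) + x * term N (tail f) j ≈ term (suc N) f (suc j)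
    pascal j (ℕ.s≤s j≤N) = begin
      X * term N f (suc j) + x * term N (tail f) j
        ≈⟨ +-cong left right ⟩
      (N C suc j) × c + (N C j) × c
        ≈⟨ ×-homo-+ c (N C suc j) (N C j) ⟨
      (N C suc j ℕ.+ N C j) × c
        ≈⟨ ×-congˡ (≡.trans (ℕ.+-comm (N C suc j) (N C j)) (nCk+nC[k+1]≡[n+1]C[k+1] N j)) ⟩
      (suc N C suc j) × c ∎
      where
      c : Carrier
      c = f (suc j) * (x ^ suc j * X ^ (N ∸ j))
      left : X * term N f (suc j) ≈ (N C suc j) × c
      -- At j = N the truncated exponent `N ∸ suc j` would be off by one, but there the binomial
      -- coefficient C(N, N+1) is zero.
      left with ℕ.≤∧≢⇒< j≤N | j ℕ.≟ N
      ... | _ | yes ≡.refl = trans (trans (*-congˡ (×-congˡ (k>n⇒nCk≡0 (ℕ.n<1+n N)))) (zeroʳ X))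
                                   (sym (×-congˡ (k>n⇒nCk≡0 (ℕ.n<1+n N))))

      ... | lt | no j≢N = begin
        X * (N C suc j) × (f (suc j) * (x ^ suc j * X ^ (N ∸ suc j)))
          ≈⟨ ×-comm-* (N C suc j) X _ ⟩
        (N C suc j) × (X * (f (suc j) * (x ^ suc j * X ^ (N ∸ suc j))))
          ≈⟨ ×-congʳ (N C suc j) (solve 4 (λ X f p q → X :* (f :* (p :* q)) := f :* (p :* (X :* q)))
               refl X (f (suc j)) (x ^ suc j) _) ⟩
        (N C suc j) × (f (suc j) * (x ^ suc j * X ^ suc (N ∸ suc j)))
          ≈⟨ ×-congʳ (N C suc j) (*-congˡ (*-congˡ (reflexive (≡.cong (X ^_) (≡.sym (ℕ.+-∸-assoc 1 (lt j≢N))))))) ⟩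
        (N C suc j) × c ∎
      right : x * term N (tail f) j ≈ (N C j) × c
      right = trans (×-comm-* (N C j) x _) (×-congʳ (N C j)
        (solve 4 (λ x f p q → x :* (f :* (p :* q)) := f :* ((x :* p) :* q)) refl x (f (suc j)) (x ^ j) _))

C½-pascal : ∀ M b → suc M C½ (+ suc (suc b)) ≡ M C½ (+ suc (suc b)) ℕ.+ M C½ (+ b)
C½-pascal M b rewrite m/n≡1+[m∸n]/n {suc (suc b)} {2} (ℕ.s≤s (ℕ.s≤s ℕ.z≤n)) with b mod 2 ≡ᵇ 0
... | true  = ≡.trans (≡.sym (nCk+nC[k+1]≡[n+1]C[k+1] M (b div 2))) (ℕ.+-comm (M C (b div 2)) _)
... | false = ≡.refl

-- Extraction of coefficients in x.

module Coefficients (R : CommutativeSemiring 0ℓ 0ℓ) where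

  open CommutativeSemiring R
  open PowerSeries R
  open Mult semiring using (_×_; ×-congʳ; ×-congˡ; ×-homo-+)
  open SetoidReasoning setoid
  private
    module KS = CommutativeSemiring commutativeSemiring
  open Mult KS.semiring using () renaming (_×_ to _×ˢ_)
  open Exp KS.semiring using (_^_)

  const : Carrier → Series
  const c zero    = c
  const c (suc _) = 0#

  const-⊛ : ∀ c f → const c ⊛ f ≋ c ∙ f
  const-⊛ c f zero    = refl
  const-⊛ c f (suc n) = trans (+-congˡ (0ˢ-⊛ f n)) (+-identityʳ _)

  var : Series
  var zero    = 0#
  var (suc a) = 1ˢ a

  var-⊛-zero : ∀ f → (var ⊛ f) 0 ≈ 0#
  var-⊛-zero f = zeroˡ (f 0)

  var-⊛-suc : ∀ f a → (var ⊛ f) (suc a) ≈ f a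
  var-⊛-suc f a = trans (+-cong (zeroˡ _) (1ˢ-⊛ f a)) (+-identityˡ _)

  1+var² : Series
  1+var² = 1ˢ ⊞ var ⊛ var

  1+var²-⊛ : ∀ f → 1+var² ⊛ f ≋ f ⊞ var ⊛ (var ⊛ f)
  1+var²-⊛ f = KS.trans (⊛-distribʳ-⊞ f 1ˢ (var ⊛ var)) (KS.+-cong (1ˢ-⊛ f) (⊛-assoc var var f))

  1+var²-⊛-suc : ∀ f a → (1+var² ⊛ f) (2 ℕ.+ a) ≈ f (2 ℕ.+ a) + f a
  1+var²-⊛-suc f a = trans (1+var²-⊛ f (2 ℕ.+ a))
    (+-congˡ (trans (var-⊛-suc (var ⊛ f) (suc a)) (var-⊛-suc f a)))

  1+var²-⊛-zero : ∀ f → (1+var² ⊛ f) 0 ≈ f 0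
  1+var²-⊛-zero f = trans (1+var²-⊛ f 0) (trans (+-congˡ (var-⊛-zero (var ⊛ f))) (+-identityʳ _))

  1+var²-⊛-one : ∀ f → (1+var² ⊛ f) 1 ≈ f 1
  1+var²-⊛-one f = trans (1+var²-⊛ f 1)
    (trans (+-congˡ (trans (var-⊛-suc (var ⊛ f) 0) (var-⊛-zero f))) (+-identityʳ _))

  [1+var²]^ : ∀ M b → (1+var² ^ M) b ≈ (M C½ (+ b)) × 1#
  [1+var²]^ zero    zero          = sym (+-identityʳ 1#)
  [1+var²]^ zero    (suc zero)    = refl
  [1+var²]^ zero    (suc (suc b)) = reflexive (≡.cong (_× 1#) (≡.sym vanishes))
    where
    vanishes : 0 C½ (+ suc (suc b)) ≡ 0
    vanishes rewrite m/n≡1+[m∸n]/n {suc (suc b)} {2} (ℕ.s≤s (ℕ.s≤s ℕ.z≤n)) with b mod 2 ≡ᵇ 0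
    ... | true  = ≡.refl
    ... | false = ≡.refl
  [1+var²]^ (suc M) zero          = trans (1+var²-⊛-zero (1+var² ^ M)) ([1+var²]^ M 0)
  [1+var²]^ (suc M) (suc zero)    = trans (1+var²-⊛-one (1+var² ^ M)) ([1+var²]^ M 1)
  [1+var²]^ (suc M) (suc (suc b)) = begin
    (1+var² ^ suc M) (2 ℕ.+ b)                               ≈⟨ 1+var²-⊛-suc (1+var² ^ M) b ⟩
    (1+var² ^ M) (2 ℕ.+ b) + (1+var² ^ M) b                  ≈⟨ +-cong ([1+var²]^ M (2 ℕ.+ b)) ([1+var²]^ M b) ⟩
    (M C½ (+ (2 ℕ.+ b))) × 1# + (M C½ (+ b)) × 1#            ≈⟨ ×-homo-+ 1# (M C½ (+ (2 ℕ.+ b))) (M C½ (+ b)) ⟨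
    (M C½ (+ (2 ℕ.+ b)) ℕ.+ M C½ (+ b)) × 1#                 ≈⟨ ×-congˡ (C½-pascal M b) ⟨
    (suc M C½ (+ (2 ℕ.+ b))) × 1#                            ∎

  var^-⊛ : ∀ j f b → (var ^ j ⊛ f) (j ℕ.+ b) ≈ f b
  var^-⊛ zero    f b = 1ˢ-⊛ f b
  var^-⊛ (suc j) f b = trans (⊛-assoc var (var ^ j) f (suc j ℕ.+ b))
    (trans (var-⊛-suc (var ^ j ⊛ f) (j ℕ.+ b)) (var^-⊛ j f b))

  var^-⊛-vanishes : ∀ j f a → a ℕ.< j → (var ^ j ⊛ f) a ≈ 0#
  var^-⊛-vanishes (suc j) f zero    _           = trans (⊛-assoc var (var ^ j) f 0) (var-⊛-zero (var ^ j ⊛ f))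
  var^-⊛-vanishes (suc j) f (suc a) (ℕ.s<s a<j) = trans (⊛-assoc var (var ^ j) f (suc a))
    (trans (var-⊛-suc (var ^ j ⊛ f) a) (var^-⊛-vanishes j f a a<j))

  private
    module KΣ = FiniteSums commutativeSemiring
  open FiniteSums R
  open Substitution commutativeSemiring 1+var² var using (sub)
  open BinomialExpansion commutativeSemiring 1+var² var using (term; sub-binomial)

  Σ<-at : ∀ n (f : ℕ → Series) a → KΣ.Σ< n f a ≈ Σ< n (λ i → f i a)
  Σ<-at zero    f a = refl
  Σ<-at (suc n) f a = +-congˡ (Σ<-at n (f ∘ suc) a)

  ×ˢ-at : ∀ n f a → (n ×ˢ f) a ≈ n × f a
  ×ˢ-at zero    f a = refl
  ×ˢ-at (suc n) f a = +-congˡ (×ˢ-at n f a)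

  -- The monomial x^n at t^(n+1) is the first power of ξ. At j = n + 1 the factor x^j already
  -- exceeds the degree n; the integer argument of `_C½_` is then -1 and yields the required 0.
  sub-coefficient : ∀ r n → sub (const ∘ r) (suc n) n ≈
    Σ< (2 ℕ.+ n) (λ j → (suc n C j) × (r j * ((suc n ∸ j) C½ (suc n ⊖ suc j)) × 1#))
  sub-coefficient r n = begin
    sub (const ∘ r) (suc n) n                        ≈⟨ sub-binomial (const ∘ r) (suc n) n ⟩
    KΣ.Σ< (2 ℕ.+ n) (term (suc n) (const ∘ r)) n     ≈⟨ Σ<-at (2 ℕ.+ n) (term (suc n) (const ∘ r)) n ⟩
    Σ< (2 ℕ.+ n) (λ j → term (suc n) (const ∘ r) j n) ≈⟨ Σ<-cong (2 ℕ.+ n) at-n ⟩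
    Σ< (2 ℕ.+ n) (λ j → (suc n C j) × (r j * ((suc n ∸ j) C½ (suc n ⊖ suc j)) × 1#)) ∎
    where
    n⊖[1+n]≡-1 : suc n ⊖ (2 ℕ.+ n) ≡ -[1+ 0 ]
    n⊖[1+n]≡-1 = ≡.trans (ℤ.⊖-< (ℕ.n<1+n (suc n))) (≡.cong (λ k → - + k) (ℕ.m+n∸n≡m 1 n))
    monomial : ∀ j → j ℕ.< 2 ℕ.+ n →
      (var ^ j ⊛ 1+var² ^ (suc n ∸ j)) n ≈ ((suc n ∸ j) C½ (suc n ⊖ suc j)) × 1#
    monomial j j<2+n with ℕ.<-≤-connex n j
    ... | inj₁ n<j with ≡.refl ← ℕ.≤-antisym n<j (ℕ.s≤s⁻¹ j<2+n) = trans
      (var^-⊛-vanishes (suc n) _ n (ℕ.n<1+n n))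
      (reflexive (≡.cong (λ t → ((suc n ∸ suc n) C½ t) × 1#) (≡.sym n⊖[1+n]≡-1)))
    ... | inj₂ j≤n = begin
      (var ^ j ⊛ p) n                         ≈⟨ reflexive (≡.cong (var ^ j ⊛ p) (≡.sym (ℕ.m+[n∸m]≡n j≤n))) ⟩
      (var ^ j ⊛ p) (j ℕ.+ (n ∸ j))           ≈⟨ var^-⊛ j p (n ∸ j) ⟩
      p (n ∸ j)                               ≈⟨ [1+var²]^ (suc n ∸ j) (n ∸ j) ⟩
      ((suc n ∸ j) C½ (+ (n ∸ j))) × 1#
        ≈⟨ ×-congˡ (≡.cong ((suc n ∸ j) C½_) (≡.sym (≡.trans (ℤ.[1+m]⊖[1+n]≡m⊖n n j) (ℤ.⊖-≥ j≤n)))) ⟩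
      ((suc n ∸ j) C½ (suc n ⊖ suc j)) × 1#   ∎
      where
      p : Series
      p = 1+var² ^ (suc n ∸ j)
    at-n : ∀ j → j ℕ.< 2 ℕ.+ n → term (suc n) (const ∘ r) j n ≈
           (suc n C j) × (r j * ((suc n ∸ j) C½ (suc n ⊖ suc j)) × 1#)
    at-n j j<2+n = trans (×ˢ-at (suc n C j) _ n) (×-congʳ (suc n C j)
      (trans (const-⊛ (r j) _ n) (*-congˡ (monomial j j<2+n))))

-- Cauchy products as finite sums.

module Convolution (R : CommutativeSemiring 0ℓ 0ℓ) where

  open CommutativeSemiring R
  open PowerSeries R using (Series; tail; _⊛_)
  open FiniteSums R
  open SetoidReasoning setoid

  ⊛-as-Σ< : ∀ f g n → (f ⊛ g) n ≈ Σ< (suc n) (λ i → f i * g (n ∸ i))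
  ⊛-as-Σ< f g zero    = sym (+-identityʳ _)
  ⊛-as-Σ< f g (suc n) = +-congˡ (⊛-as-Σ< (tail f) g n)

  -- The left side runs over the triangle i + j < n and the right side over the whole square; `h`
  -- vanishes on the difference.
  Σ<-⊛ : ∀ n (f g h : Series) → (∀ i → n ℕ.≤ i → h i ≈ 0#) →
         Σ< n (λ i → (f ⊛ g) i * h i) ≈ Σ< n (λ i → Σ< n (λ j → f i * g j * h (i ℕ.+ j)))
  Σ<-⊛ zero    f g h h≈0 = refl
  Σ<-⊛ (suc n) f g h h≈0 = begin
    f 0 * g 0 * h 0 + Σ< n (λ i → (f 0 * g (suc i) + (tail f ⊛ g) i) * h (suc i))
      ≈⟨ +-congˡ (trans (Σ<-cong n λ i _ → distribʳ (h (suc i)) _ _) (Σ<-+ n _ _)) ⟩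
    f 0 * g 0 * h 0 + (Σ< n (λ i → f 0 * g (suc i) * h (suc i)) + Σ< n (λ i → (tail f ⊛ g) i * h (suc i)))
      ≈⟨ +-assoc _ _ _ ⟨
    Σ< (suc n) (λ j → f 0 * g j * h j) + Σ< n (λ i → (tail f ⊛ g) i * h (suc i))
      ≈⟨ +-congˡ (Σ<-⊛ n (tail f) g (tail h) λ i n≤i → h≈0 (suc i) (ℕ.s≤s n≤i)) ⟩
    Σ< (suc n) (λ j → f 0 * g j * h j) + Σ< n (λ i → Σ< n (λ j → f (suc i) * g j * h (suc i ℕ.+ j)))
      ≈⟨ +-congˡ (Σ<-cong n λ i _ → Σ<-extend (λ j → f (suc i) * g j * h (suc i ℕ.+ j)) (ℕ.n≤1+n n) λ j n≤j →
           trans (*-congˡ (h≈0 (suc i ℕ.+ j) (ℕ.s≤s (ℕ.≤-trans n≤j (ℕ.m≤n+m j i))))) (zeroʳ _)) ⟩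
    Σ< (suc n) (λ i → Σ< (suc n) (λ j → f i * g j * h (i ℕ.+ j))) ∎

-- Wiener-Hopf factorisation.

-- The coefficient of t^N x^a in f is f N a.  It stands for the monomial
-- t^N ξ^(N - a): exponents of ξ are positive for a < N, negative for a > N.
module WienerHopf (R : CommutativeSemiring 0ℓ 0ℓ)
  (+-cancelˡ : LeftCancellative (CommutativeSemiring._≈_ R) (CommutativeSemiring._+_ R)) where

  open CommutativeSemiring R using (_≈_; _+_; _*_; 0#)
  private
    module R = CommutativeSemiring R
    module K = PowerSeries R
    module A = PowerSeries K.commutativeSemiring
    module AS = CommutativeSemiring A.commutativeSemiring
  open A using (_⊛_; _⊞_; 1ˢ; θ; _≋_)
  open Mult R.semiring using (×-congʳ) renaming (_×_ to _×ᴿ_)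
  open Mult (CommutativeSemiring.semiring K.commutativeSemiring) using () renaming (_×_ to _×ᴷ_)

  ×-at : ∀ n f a → (n ×ᴷ f) a ≈ n ×ᴿ f a
  ×-at zero    f a = R.refl
  ×-at (suc n) f a = R.+-congˡ (×-at n f a)

  ×-zeroʳ : ∀ n {c} → c ≈ 0# → n ×ᴿ c ≈ 0#
  ×-zeroʳ zero    c≈0 = R.refl
  ×-zeroʳ (suc n) c≈0 = R.trans (R.+-cong c≈0 (×-zeroʳ n c≈0)) (R.+-identityˡ 0#)

  Positive Nonnegative Nonpositive : A.Series → Set
  Positive    f = ∀ N a → N ℕ.≤ a → f N a ≈ 0#
  Nonnegative f = ∀ N a → N ℕ.< a → f N a ≈ 0#
  Nonpositive f = ∀ N a → a ℕ.< N → f N a ≈ 0#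

  ⊛-vanishes-at : ∀ {f g} N a →
    (∀ i j b c → i ℕ.+ j ≡ N → b ℕ.+ c ≡ a → f i b * g j c ≈ 0#) → (f ⊛ g) N a ≈ 0#
  ⊛-vanishes-at zero    a e = K.⊛-vanishes a λ b c → e 0 0 b c ≡.refl
  ⊛-vanishes-at (suc N) a e = R.trans
    (R.+-cong (K.⊛-vanishes a λ b c → e 0 (suc N) b c ≡.refl)
              (⊛-vanishes-at N a λ i j b c p → e (suc i) j b c (≡.cong suc p)))
    (R.+-identityˡ 0#)

  private
    zeroˡ : ∀ {c} d → c ≈ 0# → c * d ≈ 0#
    zeroˡ d c≈0 = R.trans (R.*-congʳ c≈0) (R.zeroˡ d)
    zeroʳ : ∀ c {d} → d ≈ 0# → c * d ≈ 0#
    zeroʳ c d≈0 = R.trans (R.*-congˡ d≈0) (R.zeroʳ c)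

  positive-⊛ : ∀ {f g} → Positive f → Nonnegative g → Positive (f ⊛ g)
  positive-⊛ {f} {g} pos nonneg N a N≤a = ⊛-vanishes-at N a vanish
    where
    vanish : ∀ i j b c → i ℕ.+ j ≡ N → b ℕ.+ c ≡ a → f i b * g j c ≈ 0#
    vanish i j b c ≡.refl ≡.refl with i ℕ.≤? b | j ℕ.<? c
    ... | yes i≤b | _       = zeroˡ (g j c) (pos i b i≤b)
    ... | no  _   | yes j<c = zeroʳ (f i b) (nonneg j c j<c)
    ... | no  i≰b | no  j≮c =
      contradiction N≤a (ℕ.<⇒≱ (ℕ.+-mono-<-≤ (ℕ.≰⇒> i≰b) (ℕ.≮⇒≥ j≮c)))

  nonpositive-⊛ : ∀ {f g} → Nonpositive f → Nonpositive g → Nonpositive (f ⊛ g)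
  nonpositive-⊛ {f} {g} fₙ gₙ N a a<N = ⊛-vanishes-at N a vanish
    where
    vanish : ∀ i j b c → i ℕ.+ j ≡ N → b ℕ.+ c ≡ a → f i b * g j c ≈ 0#
    vanish i j b c ≡.refl ≡.refl with b ℕ.<? i | c ℕ.<? j
    ... | yes b<i | _       = zeroˡ (g j c) (fₙ i b b<i)
    ... | no  _   | yes c<j = zeroʳ (f i b) (gₙ j c c<j)
    ... | no  b≮i | no  c≮j =
      contradiction a<N (ℕ.≤⇒≯ (ℕ.+-mono-≤ (ℕ.≮⇒≥ b≮i) (ℕ.≮⇒≥ c≮j)))

  -- The exponent of ξ is at least 2 in every term of a product of two
  -- positive series.
  positive-⊛-positive : ∀ {f g} → Positive f → Positive g → ∀ n → (f ⊛ g) (suc n) n ≈ 0#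
  positive-⊛-positive {f} {g} fₚ gₚ n = ⊛-vanishes-at (suc n) n vanish
    where
    vanish : ∀ i j b c → i ℕ.+ j ≡ suc n → b ℕ.+ c ≡ n → f i b * g j c ≈ 0#
    vanish i j b c p ≡.refl with i ℕ.≤? b | j ℕ.≤? c
    ... | yes i≤b | _       = zeroˡ (g j c) (fₚ i b i≤b)
    ... | no  _   | yes j≤c = zeroʳ (f i b) (gₚ j c j≤c)
    ... | no  i≰b | no  j≰c = contradiction
      (ℕ.≤-trans (ℕ.≤-reflexive (≡.cong suc (≡.sym (ℕ.+-suc b c))))
        (ℕ.≤-trans (ℕ.+-mono-≤ (ℕ.≰⇒> i≰b) (ℕ.≰⇒> j≰c)) (ℕ.≤-reflexive p)))
      ℕ.1+n≰n

  A-cancelˡ : LeftCancellative _≋_ _⊞_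
  A-cancelˡ f g h e N a = +-cancelˡ (f N a) (g N a) (h N a) (e N a)

  θ-nonpositive : ∀ {f} → Nonpositive f → Nonpositive (θ f)
  θ-nonpositive {f} fₙ N a a<N = R.trans (×-at N (f N) a) (×-zeroʳ N (fₙ N a a<N))

  module Factorisation
    {A H B L₊ L₋ : A.Series}
    (A-positive : Positive A) (A-zero : A 0 K.≋ K.0ˢ)
    (H-nonpositive : Nonpositive H) (H-zero : H 0 K.≋ K.0ˢ)
    (L₊-positive : Positive L₊) (L₋-nonpositive : Nonpositive L₋)
    (factor : (1ˢ ⊞ A) ⊞ H ⊛ B ≋ B)
    (logDerivative : (L₊ ⊞ L₋) ⊛ B ≋ θ B)
    where

    private
      S L : A.Series
      S = 1ˢ ⊞ A
      L = L₊ ⊞ L₋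

      open SetoidReasoning AS.setoid
      open NaturalSolver A.commutativeSemiring using (solve; _:=_; _:+_; _:*_; con)

      -- Apply θ to S + H B = B and replace θB by L B throughout; the common term H L B cancels.
      θS-formula : θ S ⊞ θ H ⊛ B ≋ L ⊛ S
      θS-formula = A-cancelˡ (H ⊛ (L ⊛ B)) _ _ (begin
        H ⊛ (L ⊛ B) ⊞ (θ S ⊞ θ H ⊛ B)       ≈⟨ AS.+-congʳ (AS.*-congˡ {H} logDerivative) ⟩
        H ⊛ θ B ⊞ (θ S ⊞ θ H ⊛ B)
          ≈⟨ solve 3 (λ a b c → a :+ (b :+ c) := b :+ (c :+ a)) AS.refl (H ⊛ θ B) (θ S) (θ H ⊛ B) ⟩
        θ S ⊞ (θ H ⊛ B ⊞ H ⊛ θ B)           ≈⟨ AS.+-congˡ {θ S} (A.θ-⊛ H B) ⟨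
        θ S ⊞ θ (H ⊛ B)                     ≈⟨ A.θ-⊞ S (H ⊛ B) ⟨
        θ (S ⊞ H ⊛ B)                       ≈⟨ A.θ-cong factor ⟩
        θ B                                 ≈⟨ logDerivative ⟨
        L ⊛ B                               ≈⟨ AS.*-congˡ {L} factor ⟨
        L ⊛ (S ⊞ H ⊛ B)
          ≈⟨ solve 4 (λ l s h b → l :* (s :+ h :* b) := h :* (l :* b) :+ l :* s) AS.refl L S H B ⟩
        H ⊛ (L ⊛ B) ⊞ L ⊛ S                 ∎)

      P P′ Q Q′ : A.Series
      P  = L₊ ⊛ S
      P′ = θ S
      Q  = L₋
      Q′ = θ H ⊞ L₋ ⊛ H

      -- With P = P′ + D and Q = Q′ + E this reads D(1 - H) + E(1 + A) = 0,
      -- where D is positive and E is nonpositive, so that D = E = 0.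
      balance : (P ⊞ Q) ⊞ (Q ⊛ A ⊞ P′ ⊛ H) ≋ (P′ ⊞ Q′) ⊞ (Q′ ⊛ A ⊞ P ⊛ H)
      balance = A-cancelˡ (θ H ⊛ B ⊛ H) _ _ (begin
        θ H ⊛ B ⊛ H ⊞ ((P ⊞ Q) ⊞ (Q ⊛ A ⊞ P′ ⊛ H))
          ≈⟨ solve 7 (λ th b h l₊ l₋ a ts →
               th :* b :* h :+ ((l₊ :* (con 1 :+ a) :+ l₋) :+ (l₋ :* a :+ ts :* h))
               := (ts :+ th :* b) :* h :+ (l₊ :+ l₋) :* (con 1 :+ a)) AS.refl (θ H) B H L₊ L₋ A (θ S) ⟩
        (θ S ⊞ θ H ⊛ B) ⊛ H ⊞ L ⊛ S
          -- `θS-formula` is used forwards with the factor H and backwards without it, which amounts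
          -- to multiplying it by 1 - H. Expanding B as S + H B then leaves B only in the cancelling
          -- term θH B H.
          ≈⟨ AS.+-congʳ (AS.*-congʳ {H} θS-formula) ⟩
        L ⊛ S ⊛ H ⊞ L ⊛ S
          ≈⟨ AS.+-congˡ {L ⊛ S ⊛ H} θS-formula ⟨
        L ⊛ S ⊛ H ⊞ (θ S ⊞ θ H ⊛ B)
          ≈⟨ AS.+-congˡ {L ⊛ S ⊛ H} (AS.+-congˡ {θ S} (AS.*-congˡ {θ H} factor)) ⟨
        L ⊛ S ⊛ H ⊞ (θ S ⊞ θ H ⊛ (S ⊞ H ⊛ B))
          ≈⟨ solve 7 (λ th b h l₊ l₋ a ts →
               (l₊ :+ l₋) :* (con 1 :+ a) :* h :+ (ts :+ th :* ((con 1 :+ a) :+ h :* b))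
               := th :* b :* h :+ ((ts :+ (th :+ l₋ :* h)) :+ ((th :+ l₋ :* h) :* a :+ (l₊ :* (con 1 :+ a)) :* h)))
               AS.refl (θ H) B H L₊ L₋ A (θ S) ⟩
        θ H ⊛ B ⊛ H ⊞ ((P′ ⊞ Q′) ⊞ (Q′ ⊛ A ⊞ P ⊛ H)) ∎)

      A-nonnegative : Nonnegative A
      A-nonnegative N a N<a = A-positive N a (ℕ.<⇒≤ N<a)

      S-nonnegative : Nonnegative S
      S-nonnegative zero    (suc a) _   = R.trans (R.+-identityˡ _) (A-zero (suc a))
      S-nonnegative (suc N) a       N<a = R.trans (R.+-identityˡ _) (A-nonnegative (suc N) a N<a)

      P-positive : Positive P
      P-positive = positive-⊛ {L₊} {S} L₊-positive S-nonnegative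

      P′-positive : Positive P′
      P′-positive zero    a _   = R.refl
      P′-positive (suc N) a N≤a = R.trans (×-at (suc N) (S (suc N)) a)
        (×-zeroʳ (suc N) (R.trans (R.+-identityˡ _) (A-positive (suc N) a N≤a)))

      Q′-nonpositive : Nonpositive Q′
      Q′-nonpositive N a a<N = R.trans
        (R.+-cong (θ-nonpositive {H} H-nonpositive N a a<N)
                  (nonpositive-⊛ {L₋} {H} L₋-nonpositive H-nonpositive N a a<N))
        (R.+-identityˡ 0#)

      AgreeAt : ℕ → Set
      AgreeAt N = P N K.≋ P′ N ∧ Q N K.≋ Q′ N

      ⊛-determined : ∀ {f f′ g} N → g 0 K.≋ K.0ˢ → (∀ {n} → n ℕ.< N → f n K.≋ f′ n) →
                     (f ⊛ g) N K.≋ (f′ ⊛ g) N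
      ⊛-determined {f} {f′} {g} N g₀ e = A.⊛-cong-at N same
        where
        module KS = CommutativeSemiring K.commutativeSemiring
        same : ∀ i j → i ℕ.+ j ≡ N → f i K.⊛ g j K.≋ f′ i K.⊛ g j
        same i zero    _      = KS.trans (vanish (f i)) (KS.sym (vanish (f′ i)))
          where
          vanish : ∀ c → c K.⊛ g 0 K.≋ K.0ˢ
          vanish c = KS.trans (KS.*-congˡ {c} g₀) (KS.zeroʳ c)
        same i (suc j) ≡.refl = K.⊛-cong (e (ℕ.m<m+n i ℕ.z<s)) λ _ → R.refl

      -- Since A and H have no constant term in t, the products in `balance` at degree N involve D
      -- and E only at smaller degrees, where they vanish. What is left is D + E = 0 at degree N,
      -- and the two have disjoint supports in ξ.
      agree : ∀ N → AgreeAt N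
      agree = <-rec AgreeAt step
        where
        step : ∀ N → (∀ {n} → n ℕ.< N → AgreeAt n) → AgreeAt N
        step N earlier = P≋P′ , Q≋Q′
          where
          sums : ∀ a → P N a + Q N a ≈ P′ N a + Q′ N a
          sums a = +-cancelˡ ((Q ⊛ A) N a + (P′ ⊛ H) N a) _ _ (R.trans (R.+-comm _ _)
            (R.trans (balance N a) (R.trans (R.+-comm _ _) (R.+-congʳ (R.sym (R.+-cong
              (⊛-determined {Q} {Q′} N A-zero (λ n<N → proj₂ (earlier n<N)) a)
              (⊛-determined {P′} {P} N H-zero (λ n<N → K-sym (proj₁ (earlier n<N))) a)))))))
            where K-sym = CommutativeSemiring.sym K.commutativeSemiring
          drop : ∀ {b c} d → c ≈ 0# → d + c ≈ b → d ≈ b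
          drop d c≈0 e = R.trans (R.sym (R.trans (R.+-congˡ c≈0) (R.+-identityʳ d))) e
          P≋P′ : P N K.≋ P′ N
          P≋P′ a with ℕ.<-≤-connex a N
          ... | inj₂ N≤a = R.trans (P-positive N a N≤a) (R.sym (P′-positive N a N≤a))
          ... | inj₁ a<N = drop (P N a) (L₋-nonpositive N a a<N)
            (R.sym (drop (P′ N a) (Q′-nonpositive N a a<N) (R.sym (sums a))))
          Q≋Q′ : Q N K.≋ Q′ N
          Q≋Q′ a with ℕ.<-≤-connex a N
          ... | inj₁ a<N = R.trans (L₋-nonpositive N a a<N) (R.sym (Q′-nonpositive N a a<N))
          ... | inj₂ N≤a = drop (Q N a) (P-positive N a N≤a) (R.trans (R.+-comm _ _)
            (R.sym (drop (Q′ N a) (P′-positive N a N≤a) (R.trans (R.+-comm _ _) (R.sym (sums a))))))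

    -- In θS = L₊ S = L₊ + L₊ A the product L₊ A starts at ξ², so the first power of ξ sees only L₊.
    -- For higher powers of ξ the relation would no longer be linear.
    ξ¹-coefficient : ∀ n → L₊ (suc n) n ≈ suc n ×ᴿ A (suc n) n
    ξ¹-coefficient n = R.trans (R.sym P≈L₊) (R.trans (proj₁ (agree (suc n)) n)
      (R.trans (×-at (suc n) (S (suc n)) n) (×-congʳ (suc n) (R.+-identityˡ _))))
      where
      P≈L₊ : P (suc n) n ≈ L₊ (suc n) n
      P≈L₊ = R.trans (AS.distribˡ L₊ 1ˢ A (suc n) n) (R.trans
        (R.+-cong (AS.*-identityʳ L₊ (suc n) n) (positive-⊛-positive {L₊} {A} L₊-positive A-positive n))
        (R.+-identityʳ _))

open import Relation.Binary.PropositionalEquality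
  using (_≢_; _≗_; refl; sym; trans; cong; cong₂; subst; module ≡-Reasoning)

module ℕˢ = PowerSeries ℕ.+-*-commutativeSemiring

-- Binomial identities

[1+k]*[1+n]C[1+k]≡[1+n]*nCk : ∀ n k → suc k ℕ.* (suc n C suc k) ≡ suc n ℕ.* (n C k)
[1+k]*[1+n]C[1+k]≡[1+n]*nCk zero    zero    = refl
[1+k]*[1+n]C[1+k]≡[1+n]*nCk zero    (suc k) = ℕ.*-zeroʳ (2 ℕ.+ k)
[1+k]*[1+n]C[1+k]≡[1+n]*nCk (suc n) zero    =
  trans (ℕ.*-identityˡ _) (trans (nC1≡n (2 ℕ.+ n)) (sym (ℕ.*-identityʳ (2 ℕ.+ n))))
[1+k]*[1+n]C[1+k]≡[1+n]*nCk (suc n) (suc k) = begin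
  (2 ℕ.+ k) ℕ.* (suc (suc n) C suc (suc k))
    ≡⟨ cong ((2 ℕ.+ k) ℕ.*_) (sym (nCk+nC[k+1]≡[n+1]C[k+1] (suc n) (suc k))) ⟩
  (2 ℕ.+ k) ℕ.* (c ℕ.+ (suc n C suc (suc k)))
    ≡⟨ split k c (suc n C suc (suc k)) ⟩
  c ℕ.+ (suc k ℕ.* c ℕ.+ (2 ℕ.+ k) ℕ.* (suc n C suc (suc k)))
    ≡⟨ cong (c ℕ.+_) (cong₂ ℕ._+_ ([1+k]*[1+n]C[1+k]≡[1+n]*nCk n k) ([1+k]*[1+n]C[1+k]≡[1+n]*nCk n (suc k))) ⟩
  c ℕ.+ (suc n ℕ.* (n C k) ℕ.+ suc n ℕ.* (n C suc k))
    ≡⟨ cong (c ℕ.+_) (ℕ.*-distribˡ-+ (suc n) (n C k) (n C suc k)) ⟨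
  c ℕ.+ suc n ℕ.* (n C k ℕ.+ n C suc k)
    ≡⟨ cong (λ d → c ℕ.+ suc n ℕ.* d) (nCk+nC[k+1]≡[n+1]C[k+1] n k) ⟩
  (2 ℕ.+ n) ℕ.* c ∎
  where
  open ≡-Reasoning
  c = suc n C suc k
  split : ∀ k c d → (2 ℕ.+ k) ℕ.* (c ℕ.+ d) ≡ c ℕ.+ (suc k ℕ.* c ℕ.+ (2 ℕ.+ k) ℕ.* d)
  split = ℕ-Solver.solve-∀

[1+k]*[k+d]C[1+k]≡d*[k+d]Ck : ∀ k d → suc k ℕ.* ((k ℕ.+ d) C suc k) ≡ d ℕ.* ((k ℕ.+ d) C k)
[1+k]*[k+d]C[1+k]≡d*[k+d]Ck k d = ℕ.+-cancelˡ-≡ (suc k ℕ.* c) _ _ (begin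
  suc k ℕ.* c ℕ.+ suc k ℕ.* ((k ℕ.+ d) C suc k)  ≡⟨ ℕ.*-distribˡ-+ (suc k) c _ ⟨
  suc k ℕ.* (c ℕ.+ ((k ℕ.+ d) C suc k))          ≡⟨ cong (suc k ℕ.*_) (nCk+nC[k+1]≡[n+1]C[k+1] (k ℕ.+ d) k) ⟩
  suc k ℕ.* (suc (k ℕ.+ d) C suc k)              ≡⟨ [1+k]*[1+n]C[1+k]≡[1+n]*nCk (k ℕ.+ d) k ⟩
  (suc k ℕ.+ d) ℕ.* c                            ≡⟨ ℕ.*-distribʳ-+ c (suc k) d ⟩
  suc k ℕ.* c ℕ.+ d ℕ.* c                        ∎)
  where
  open ≡-Reasoning
  c = (k ℕ.+ d) C k

[1+d]*[1+k+d]Ck≡[1+k+d]*[k+d]Ck : ∀ k d →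
  suc d ℕ.* (suc (k ℕ.+ d) C k) ≡ suc (k ℕ.+ d) ℕ.* ((k ℕ.+ d) C k)
[1+d]*[1+k+d]Ck≡[1+k+d]*[k+d]Ck k d = begin
  suc d ℕ.* (suc (k ℕ.+ d) C k)       ≡⟨ cong (λ n → suc d ℕ.* (n C k)) (ℕ.+-suc k d) ⟨
  suc d ℕ.* ((k ℕ.+ suc d) C k)       ≡⟨ [1+k]*[k+d]C[1+k]≡d*[k+d]Ck k (suc d) ⟨
  suc k ℕ.* ((k ℕ.+ suc d) C suc k)   ≡⟨ cong (λ n → suc k ℕ.* (n C suc k)) (ℕ.+-suc k d) ⟩
  suc k ℕ.* (suc (k ℕ.+ d) C suc k)   ≡⟨ [1+k]*[1+n]C[1+k]≡[1+n]*nCk (k ℕ.+ d) k ⟩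
  suc (k ℕ.+ d) ℕ.* ((k ℕ.+ d) C k)   ∎
  where open ≡-Reasoning

-- raney k a = a/(a + 3k) * C(a + 3k, k), the coefficient of z^k in T^a where
-- T = 1 + z T³.
raney : ℕ → ℕ → ℕ
raney zero    a       = 1
raney (suc k) zero    = 0
raney (suc k) (suc a) = raney (suc k) a ℕ.+ raney k (3 ℕ.+ a)

-- This is T^a · T^b D = T^(a+b) D, where T^b D has the coefficients C(b + 3j, j). The recursion
-- T^(a+1) = T^a + z T^(a+3) of `raney` corresponds to Pascal's rule on the right; the call that
-- raises `a` by 3 lowers `n`.
rothe-hagen : ∀ n a b → ((λ k → raney k a) ℕˢ.⊛ (λ j → (b ℕ.+ 3 ℕ.* j) C j)) n ≡ (a ℕ.+ b ℕ.+ 3 ℕ.* n) C n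
rothe-hagen zero    a       b = refl
rothe-hagen (suc n) zero    b = trans
  (ℕˢ.⊛-cong {g = g} raney-zero (λ _ → refl) (suc n)) (ℕˢ.1ˢ-⊛ g (suc n))
  where
  g : ℕ → ℕ
  g j = (b ℕ.+ 3 ℕ.* j) C j
  raney-zero : ∀ k → raney k 0 ≡ ℕˢ.1ˢ k
  raney-zero zero    = refl
  raney-zero (suc k) = refl
rothe-hagen (suc n) (suc a) b = begin
  1 ℕ.* g (suc n) ℕ.+ ((λ k → raney (suc k) a ℕ.+ raney k (3 ℕ.+ a)) ℕˢ.⊛ g) n
    ≡⟨ cong (1 ℕ.* g (suc n) ℕ.+_) (ℕˢ.⊛-distribʳ-⊞ g (λ k → raney (suc k) a) (λ k → raney k (3 ℕ.+ a)) n) ⟩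
  1 ℕ.* g (suc n) ℕ.+ (((λ k → raney (suc k) a) ℕˢ.⊛ g) n ℕ.+ ((λ k → raney k (3 ℕ.+ a)) ℕˢ.⊛ g) n)
    ≡⟨ ℕ.+-assoc (1 ℕ.* g (suc n)) _ _ ⟨
  ((λ k → raney k a) ℕˢ.⊛ g) (suc n) ℕ.+ ((λ k → raney k (3 ℕ.+ a)) ℕˢ.⊛ g) n
    ≡⟨ cong₂ ℕ._+_ (rothe-hagen (suc n) a b) (rothe-hagen n (3 ℕ.+ a) b) ⟩
  (m C suc n) ℕ.+ ((3 ℕ.+ a ℕ.+ b ℕ.+ 3 ℕ.* n) C n)
    ≡⟨ cong (λ i → (m C suc n) ℕ.+ (i C n)) (shift a b n) ⟩
  (m C suc n) ℕ.+ (m C n)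
    ≡⟨ ℕ.+-comm (m C suc n) (m C n) ⟩
  (m C n) ℕ.+ (m C suc n)
    ≡⟨ nCk+nC[k+1]≡[n+1]C[k+1] m n ⟩
  suc m C suc n ∎
  where
  open ≡-Reasoning
  g : ℕ → ℕ
  g j = (b ℕ.+ 3 ℕ.* j) C j
  m = a ℕ.+ b ℕ.+ 3 ℕ.* suc n
  shift : ∀ a b n → 3 ℕ.+ a ℕ.+ b ℕ.+ 3 ℕ.* n ≡ a ℕ.+ b ℕ.+ 3 ℕ.* suc n
  shift = ℕ-Solver.solve-∀

-- The closed form a/(a + 3k) · C(a + 3k, k), taken at k + 1 and cleared of its denominator by
-- absorption.
[1+k]*raney : ∀ k a → suc k ℕ.* raney (suc k) a ≡ a ℕ.* ((a ℕ.+ 3 ℕ.* k ℕ.+ 2) C k)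
[1+k]*raney k       zero    = ℕ.*-zeroʳ (suc k)
[1+k]*raney zero    (suc a) = begin
  1 ℕ.* (raney 1 a ℕ.+ 1)     ≡⟨ ℕ.*-distribˡ-+ 1 (raney 1 a) 1 ⟩
  1 ℕ.* raney 1 a ℕ.+ 1       ≡⟨ cong (ℕ._+ 1) ([1+k]*raney zero a) ⟩
  a ℕ.* 1 ℕ.+ 1               ≡⟨ ℕ.+-comm (a ℕ.* 1) 1 ⟩
  suc a ℕ.* 1                 ∎
  where open ≡-Reasoning
-- The additional factor k + 1 makes the ratio (k + 1) c₁ = (2k + a + 5) c₀ of neighbouring
-- binomials available without division.
[1+k]*raney (suc k) (suc a) = ℕ.*-cancelˡ-≡ _ _ (suc k) (begin
  suc k ℕ.* ((2 ℕ.+ k) ℕ.* (raney (2 ℕ.+ k) a ℕ.+ raney (suc k) (3 ℕ.+ a)))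
    ≡⟨ expand k (raney (2 ℕ.+ k) a) (raney (suc k) (3 ℕ.+ a)) ⟩
  suc k ℕ.* ((2 ℕ.+ k) ℕ.* raney (2 ℕ.+ k) a) ℕ.+ (2 ℕ.+ k) ℕ.* (suc k ℕ.* raney (suc k) (3 ℕ.+ a))
    ≡⟨ cong₂ (λ s t → suc k ℕ.* s ℕ.+ (2 ℕ.+ k) ℕ.* t) ([1+k]*raney (suc k) a) ([1+k]*raney k (3 ℕ.+ a)) ⟩
  suc k ℕ.* (a ℕ.* ((a ℕ.+ 3 ℕ.* suc k ℕ.+ 2) C suc k)) ℕ.+
    (2 ℕ.+ k) ℕ.* ((3 ℕ.+ a) ℕ.* ((3 ℕ.+ a ℕ.+ 3 ℕ.* k ℕ.+ 2) C k))
    ≡⟨ cong₂ (λ s t → suc k ℕ.* (a ℕ.* (s C suc k)) ℕ.+ (2 ℕ.+ k) ℕ.* ((3 ℕ.+ a) ℕ.* (t C k)))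
             (shift₁ a k) (shift₂ a k) ⟩
  suc k ℕ.* (a ℕ.* c₁) ℕ.+ (2 ℕ.+ k) ℕ.* ((3 ℕ.+ a) ℕ.* c₀)
    ≡⟨ collect a k c₀ c₁ ⟩
  a ℕ.* (suc k ℕ.* c₁) ℕ.+ ((5 ℕ.+ (2 ℕ.* k ℕ.+ a)) ℕ.* c₀ ℕ.+ suc k ℕ.* (suc a ℕ.* c₀))
    ≡⟨ cong (λ s → a ℕ.* (suc k ℕ.* c₁) ℕ.+ (s ℕ.+ suc k ℕ.* (suc a ℕ.* c₀))) ([1+k]*[k+d]C[1+k]≡d*[k+d]Ck k _) ⟨
  a ℕ.* (suc k ℕ.* c₁) ℕ.+ (suc k ℕ.* c₁ ℕ.+ suc k ℕ.* (suc a ℕ.* c₀))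
    ≡⟨ factor a k c₀ c₁ ⟩
  suc k ℕ.* (suc a ℕ.* (c₀ ℕ.+ c₁))
    ≡⟨ cong (λ s → suc k ℕ.* (suc a ℕ.* s)) (nCk+nC[k+1]≡[n+1]C[k+1] (k ℕ.+ (5 ℕ.+ (2 ℕ.* k ℕ.+ a))) k) ⟩
  suc k ℕ.* (suc a ℕ.* (suc (k ℕ.+ (5 ℕ.+ (2 ℕ.* k ℕ.+ a))) C suc k))
    ≡⟨ cong (λ s → suc k ℕ.* (suc a ℕ.* (suc s C suc k))) (shift₁ a k) ⟨
  suc k ℕ.* (suc a ℕ.* ((suc a ℕ.+ 3 ℕ.* suc k ℕ.+ 2) C suc k)) ∎)
  where
  open ≡-Reasoning
  c₀ = (k ℕ.+ (5 ℕ.+ (2 ℕ.* k ℕ.+ a))) C k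
  c₁ = (k ℕ.+ (5 ℕ.+ (2 ℕ.* k ℕ.+ a))) C suc k
  expand : ∀ k r s → suc k ℕ.* ((2 ℕ.+ k) ℕ.* (r ℕ.+ s)) ≡ suc k ℕ.* ((2 ℕ.+ k) ℕ.* r) ℕ.+ (2 ℕ.+ k) ℕ.* (suc k ℕ.* s)
  expand = ℕ-Solver.solve-∀
  shift₁ : ∀ a k → a ℕ.+ 3 ℕ.* suc k ℕ.+ 2 ≡ k ℕ.+ (5 ℕ.+ (2 ℕ.* k ℕ.+ a))
  shift₁ = ℕ-Solver.solve-∀
  shift₂ : ∀ a k → 3 ℕ.+ a ℕ.+ 3 ℕ.* k ℕ.+ 2 ≡ k ℕ.+ (5 ℕ.+ (2 ℕ.* k ℕ.+ a))
  shift₂ = ℕ-Solver.solve-∀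
  collect : ∀ a k c d → suc k ℕ.* (a ℕ.* d) ℕ.+ (2 ℕ.+ k) ℕ.* ((3 ℕ.+ a) ℕ.* c) ≡
    a ℕ.* (suc k ℕ.* d) ℕ.+ ((5 ℕ.+ (2 ℕ.* k ℕ.+ a)) ℕ.* c ℕ.+ suc k ℕ.* (suc a ℕ.* c))
  collect = ℕ-Solver.solve-∀
  factor : ∀ a k c d → a ℕ.* (suc k ℕ.* d) ℕ.+ (suc k ℕ.* d ℕ.+ suc k ℕ.* (suc a ℕ.* c)) ≡ suc k ℕ.* (suc a ℕ.* (c ℕ.+ d))
  factor = ℕ-Solver.solve-∀

ternaryTrees : ℕ → ℕ
ternaryTrees k = raney k 1

[3k+1]*ternary : ∀ k → (3 ℕ.* k ℕ.+ 1) ℕ.* ternaryTrees k ≡ (3 ℕ.* k ℕ.+ 1) C k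
[3k+1]*ternary zero    = refl
[3k+1]*ternary (suc k) = ℕ.*-cancelˡ-≡ _ _ (suc k) (begin
  suc k ℕ.* (m ℕ.* ternaryTrees (suc k))            ≡⟨ swap k m (ternaryTrees (suc k)) ⟩
  m ℕ.* (suc k ℕ.* ternaryTrees (suc k))            ≡⟨ cong (m ℕ.*_) ([1+k]*raney k 1) ⟩
  m ℕ.* (1 ℕ.* ((1 ℕ.+ 3 ℕ.* k ℕ.+ 2) C k))    ≡⟨ cong (m ℕ.*_) (ℕ.*-identityˡ _) ⟩
  m ℕ.* ((1 ℕ.+ 3 ℕ.* k ℕ.+ 2) C k)            ≡⟨ cong (ℕ._* ((1 ℕ.+ 3 ℕ.* k ℕ.+ 2) C k)) (shift k) ⟩
  suc (1 ℕ.+ 3 ℕ.* k ℕ.+ 2) ℕ.* ((1 ℕ.+ 3 ℕ.* k ℕ.+ 2) C k) ≡⟨ [1+k]*[1+n]C[1+k]≡[1+n]*nCk (1 ℕ.+ 3 ℕ.* k ℕ.+ 2) k ⟨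
  suc k ℕ.* (suc (1 ℕ.+ 3 ℕ.* k ℕ.+ 2) C suc k) ≡⟨ cong (λ i → suc k ℕ.* (i C suc k)) (shift k) ⟨
  suc k ℕ.* (m C suc k)                        ∎)
  where
  open ≡-Reasoning
  m = 3 ℕ.* suc k ℕ.+ 1
  swap : ∀ k m t → suc k ℕ.* (m ℕ.* t) ≡ m ℕ.* (suc k ℕ.* t)
  swap = ℕ-Solver.solve-∀
  shift : ∀ k → 3 ℕ.* suc k ℕ.+ 1 ≡ suc (1 ℕ.+ 3 ℕ.* k ℕ.+ 2)
  shift = ℕ-Solver.solve-∀

central : ℕ → ℕ
central n = (3 ℕ.* n) C n

ternary-⊛-central : ∀ n → (ternaryTrees ℕˢ.⊛ central) n ≡ suc (3 ℕ.* n) C n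
ternary-⊛-central n = rothe-hagen n 1 0

-- Three ratios lead from C(3n+3, n+1) down to C(3n, n). At C(3n+1, n), the coefficient of T D, the
-- factor is 6(3n + 2) = 3 + 9(2n + 1), and only the second part descends further. Multiplied by
-- 3/4, this is the coefficient form of (1 - 27z/4)(D + 3θD) = D + (9/4) z T D.
central-recurrence : ∀ n →
  4 ℕ.* (suc n ℕ.* central (suc n)) ≡ 3 ℕ.* (suc (3 ℕ.* n) C n) ℕ.+ 9 ℕ.* (suc (3 ℕ.* n) ℕ.* central n)
central-recurrence n = begin
  4 ℕ.* (suc n ℕ.* ((3 ℕ.* suc n) C suc n))      ≡⟨ cong (λ i → 4 ℕ.* (suc n ℕ.* (i C suc n))) (shift₃ n) ⟩
  4 ℕ.* (suc n ℕ.* (suc (2 ℕ.+ m) C suc n))      ≡⟨ cong (4 ℕ.*_) ([1+k]*[1+n]C[1+k]≡[1+n]*nCk (2 ℕ.+ m) n) ⟩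
  4 ℕ.* ((3 ℕ.+ m) ℕ.* ((2 ℕ.+ m) C n))          ≡⟨ half n ((2 ℕ.+ m) C n) ⟩
  6 ℕ.* (suc (suc (2 ℕ.* n)) ℕ.* ((2 ℕ.+ m) C n))
    ≡⟨ cong (λ i → 6 ℕ.* (suc (suc (2 ℕ.* n)) ℕ.* (suc i C n))) (ℕ.+-suc n (2 ℕ.* n)) ⟨
  6 ℕ.* (suc (suc (2 ℕ.* n)) ℕ.* (suc (n ℕ.+ suc (2 ℕ.* n)) C n))
    ≡⟨ cong (6 ℕ.*_) ([1+d]*[1+k+d]Ck≡[1+k+d]*[k+d]Ck n (suc (2 ℕ.* n))) ⟩
  6 ℕ.* (suc (n ℕ.+ suc (2 ℕ.* n)) ℕ.* ((n ℕ.+ suc (2 ℕ.* n)) C n))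
    ≡⟨ cong (λ i → 6 ℕ.* (suc i ℕ.* (i C n))) (ℕ.+-suc n (2 ℕ.* n)) ⟩
  6 ℕ.* ((2 ℕ.+ m) ℕ.* (suc m C n))              ≡⟨ split n (suc m C n) ⟩
  3 ℕ.* (suc m C n) ℕ.+ 9 ℕ.* (suc (2 ℕ.* n) ℕ.* (suc m C n))
    ≡⟨ cong (λ s → 3 ℕ.* (suc m C n) ℕ.+ 9 ℕ.* s) ([1+d]*[1+k+d]Ck≡[1+k+d]*[k+d]Ck n (2 ℕ.* n)) ⟩
  3 ℕ.* (suc m C n) ℕ.+ 9 ℕ.* (suc m ℕ.* (m C n)) ∎
  where
  open ≡-Reasoning
  m = 3 ℕ.* n
  shift₃ : ∀ n → 3 ℕ.* suc n ≡ 3 ℕ.+ 3 ℕ.* n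
  shift₃ = ℕ-Solver.solve-∀
  half : ∀ n c → 4 ℕ.* ((3 ℕ.+ 3 ℕ.* n) ℕ.* c) ≡ 6 ℕ.* (suc (suc (2 ℕ.* n)) ℕ.* c)
  half = ℕ-Solver.solve-∀
  split : ∀ n c → 6 ℕ.* ((2 ℕ.+ 3 ℕ.* n) ℕ.* c) ≡ 3 ℕ.* c ℕ.+ 9 ℕ.* (suc (2 ℕ.* n) ℕ.* c)
  split = ℕ-Solver.solve-∀

-- Rational power series

fromℚᵘ-homo-* : ∀ p q → fromℚᵘ (p ℚᵘ.* q) ≡ fromℚᵘ p ℚ.* fromℚᵘ q
fromℚᵘ-homo-* p q = ℚ.toℚᵘ-injective (begin
  toℚᵘ (fromℚᵘ (p ℚᵘ.* q))                ≈⟨ ℚ.toℚᵘ-fromℚᵘ (p ℚᵘ.* q) ⟩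
  p ℚᵘ.* q                                ≈⟨ ℚᵘ.*-cong (ℚ.toℚᵘ-fromℚᵘ p) (ℚ.toℚᵘ-fromℚᵘ q) ⟨
  toℚᵘ (fromℚᵘ p) ℚᵘ.* toℚᵘ (fromℚᵘ q)    ≈⟨ ℚ.toℚᵘ-homo-* (fromℚᵘ p) (fromℚᵘ q) ⟨
  toℚᵘ (fromℚᵘ p ℚ.* fromℚᵘ q)            ∎)
  where open ℚᵘ.≃-Reasoning

fromℚᵘ-homo-+ : ∀ p q → fromℚᵘ (p ℚᵘ.+ q) ≡ fromℚᵘ p ℚ.+ fromℚᵘ q
fromℚᵘ-homo-+ p q = ℚ.toℚᵘ-injective (begin
  toℚᵘ (fromℚᵘ (p ℚᵘ.+ q))                ≈⟨ ℚ.toℚᵘ-fromℚᵘ (p ℚᵘ.+ q) ⟩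
  p ℚᵘ.+ q                                ≈⟨ ℚᵘ.+-cong (ℚ.toℚᵘ-fromℚᵘ p) (ℚ.toℚᵘ-fromℚᵘ q) ⟨
  toℚᵘ (fromℚᵘ p) ℚᵘ.+ toℚᵘ (fromℚᵘ q)    ≈⟨ ℚ.toℚᵘ-homo-+ (fromℚᵘ p) (fromℚᵘ q) ⟨
  toℚᵘ (fromℚᵘ p ℚ.+ fromℚᵘ q)            ∎)
  where open ℚᵘ.≃-Reasoning

fromℕ-+ : ∀ m n → fromℕ (m ℕ.+ n) ≡ fromℕ m ℚ.+ fromℕ n
fromℕ-+ m n = trans
  (cong (λ i → fromℚᵘ (ℚᵘ.mkℚᵘ i 0)) (trans (ℤ.pos-+ m n) (sym (cong₂ ℤ._+_ (ℤ.*-identityʳ (+ m)) (ℤ.*-identityʳ (+ n))))))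
  (fromℚᵘ-homo-+ (ℚᵘ.mkℚᵘ (+ m) 0) (ℚᵘ.mkℚᵘ (+ n) 0))

fromℕ-* : ∀ m n → fromℕ (m ℕ.* n) ≡ fromℕ m ℚ.* fromℕ n
fromℕ-* m n = trans
  (cong (λ i → fromℚᵘ (ℚᵘ.mkℚᵘ i 0)) (ℤ.pos-* m n))
  (fromℚᵘ-homo-* (ℚᵘ.mkℚᵘ (+ m) 0) (ℚᵘ.mkℚᵘ (+ n) 0))

/-*-fromℕ : ∀ p q .{{_ : NonZero q}} → (+ p / q) ℚ.* fromℕ q ≡ fromℕ p
/-*-fromℕ p (suc q) = trans (sym (fromℚᵘ-homo-* (ℚᵘ.mkℚᵘ (+ p) q) (ℚᵘ.mkℚᵘ (+ suc q) 0)))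
  (ℚ.fromℚᵘ-cong {ℚᵘ.mkℚᵘ (+ p) q ℚᵘ.* ℚᵘ.mkℚᵘ (+ suc q) 0} {ℚᵘ.mkℚᵘ (+ p) 0} (ℚᵘ.*≡* (ℤ.*-assoc (+ p) (+ suc q) (+ 1))))

ℚ-commutativeSemiring : CommutativeSemiring 0ℓ 0ℓ
ℚ-commutativeSemiring = CommutativeRing.commutativeSemiring ℚ.+-*-commutativeRing

module ℚˢ = PowerSeries ℚ-commutativeSemiring
open ℚˢ using (_⊛_; _∙_; _⊞_; _≋_; 0ˢ; 1ˢ)
open Mult (CommutativeSemiring.semiring ℚ-commutativeSemiring) using (_×_; ×-congʳ)

×≡fromℕ* : ∀ n c → n × c ≡ fromℕ n ℚ.* c
×≡fromℕ* zero    c = sym (ℚ.*-zeroˡ c)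
×≡fromℕ* (suc n) c = begin
  c ℚ.+ n × c                       ≡⟨ cong₂ ℚ._+_ (sym (ℚ.*-identityˡ c)) (×≡fromℕ* n c) ⟩
  1ℚ ℚ.* c ℚ.+ fromℕ n ℚ.* c        ≡⟨ ℚ.*-distribʳ-+ c 1ℚ (fromℕ n) ⟨
  (1ℚ ℚ.+ fromℕ n) ℚ.* c            ≡⟨ cong (ℚ._* c) (fromℕ-+ 1 n) ⟨
  fromℕ (suc n) ℚ.* c               ∎
  where open ≡-Reasoning

fromℕ-⊛ : ∀ f g n → fromℕ ((f ℕˢ.⊛ g) n) ≡ ((fromℕ ∘ f) ⊛ (fromℕ ∘ g)) n
fromℕ-⊛ f g zero    = fromℕ-* (f 0) (g 0)
fromℕ-⊛ f g (suc n) = trans (fromℕ-+ (f 0 ℕ.* g (suc n)) _)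
  (cong₂ ℚ._+_ (fromℕ-* (f 0) (g (suc n))) (fromℕ-⊛ (f ∘ suc) g n))

-- The series R and its product with D.

9/4 27/4 : ℚ
9/4  = + 9 / 4
27/4 = + 27 / 4

geometric : ℕ → ℚ
geometric zero    = 1ℚ
geometric (suc n) = 27/4 ℚ.* geometric n

numerator : ℕ → ℚ
numerator zero    = 1ℚ
numerator (suc n) = 9/4 ℚ.* fromℕ (ternaryTrees n)

-- levels n is the total number of heights visited by the bridges with n steps
-- +2 and 2n steps -1.
levels : ℕ → ℚ
levels = geometric ⊛ numerator

levels-suc : ∀ n → levels (suc n) ≡ 9/4 ℚ.* (geometric ⊛ (fromℕ ∘ ternaryTrees)) n ℚ.+ geometric (suc n)
levels-suc n = trans (ℚˢ.⊛-suc geometric numerator n)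
  (cong₂ ℚ._+_ (ℚˢ.⊛-∙ 9/4 geometric (fromℕ ∘ ternaryTrees) n) (ℚ.*-identityʳ (geometric (suc n))))

central-recurrence-ℚ : ∀ n → fromℕ (suc (3 ℕ.* suc n)) ℚ.* fromℕ (central (suc n)) ≡
  fromℕ (central (suc n)) ℚ.+ 9/4 ℚ.* fromℕ (suc (3 ℕ.* n) C n) ℚ.+
    27/4 ℚ.* (fromℕ (suc (3 ℕ.* n)) ℚ.* fromℕ (central n))
central-recurrence-ℚ n = begin
  fromℕ (suc (3 ℕ.* suc n)) ℚ.* d′
    ≡⟨ cong (ℚ._* d′) (trans (fromℕ-+ 1 (3 ℕ.* suc n)) (cong (1ℚ ℚ.+_) (fromℕ-* 3 (suc n)))) ⟩
  (1ℚ ℚ.+ fromℕ 3 ℚ.* fromℕ (suc n)) ℚ.* d′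
    ≡⟨ expand (fromℕ (suc n)) d′ ⟩
  d′ ℚ.+ (+ 3 / 4) ℚ.* (fromℕ 4 ℚ.* (fromℕ (suc n) ℚ.* d′))
    ≡⟨ cong (λ s → d′ ℚ.+ (+ 3 / 4) ℚ.* s) recurrence ⟩
  d′ ℚ.+ (+ 3 / 4) ℚ.* (fromℕ 3 ℚ.* c ℚ.+ fromℕ 9 ℚ.* (fromℕ (suc (3 ℕ.* n)) ℚ.* d))
    ≡⟨ collect d′ c (fromℕ (suc (3 ℕ.* n)) ℚ.* d) ⟩
  d′ ℚ.+ 9/4 ℚ.* c ℚ.+ 27/4 ℚ.* (fromℕ (suc (3 ℕ.* n)) ℚ.* d) ∎
  where
  open ≡-Reasoning
  d  = fromℕ (central n)
  d′ = fromℕ (central (suc n))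
  c  = fromℕ (suc (3 ℕ.* n) C n)
  expand : ∀ s d → (1ℚ ℚ.+ fromℕ 3 ℚ.* s) ℚ.* d ≡ d ℚ.+ (+ 3 / 4) ℚ.* (fromℕ 4 ℚ.* (s ℚ.* d))
  expand s d = begin
    (1ℚ ℚ.+ fromℕ 3 ℚ.* s) ℚ.* d                       ≡⟨ ℚ.*-distribʳ-+ d 1ℚ (fromℕ 3 ℚ.* s) ⟩
    1ℚ ℚ.* d ℚ.+ fromℕ 3 ℚ.* s ℚ.* d                    ≡⟨ cong₂ ℚ._+_ (ℚ.*-identityˡ d) (ℚ.*-assoc (fromℕ 3) s d) ⟩
    d ℚ.+ (+ 3 / 4) ℚ.* fromℕ 4 ℚ.* (s ℚ.* d)           ≡⟨ cong (d ℚ.+_) (ℚ.*-assoc (+ 3 / 4) (fromℕ 4) (s ℚ.* d)) ⟩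
    d ℚ.+ (+ 3 / 4) ℚ.* (fromℕ 4 ℚ.* (s ℚ.* d))         ∎
  collect : ∀ d c e → d ℚ.+ (+ 3 / 4) ℚ.* (fromℕ 3 ℚ.* c ℚ.+ fromℕ 9 ℚ.* e) ≡ d ℚ.+ 9/4 ℚ.* c ℚ.+ 27/4 ℚ.* e
  collect d c e = begin
    d ℚ.+ (+ 3 / 4) ℚ.* (fromℕ 3 ℚ.* c ℚ.+ fromℕ 9 ℚ.* e)
      ≡⟨ cong (d ℚ.+_) (ℚ.*-distribˡ-+ (+ 3 / 4) (fromℕ 3 ℚ.* c) (fromℕ 9 ℚ.* e)) ⟩
    d ℚ.+ ((+ 3 / 4) ℚ.* (fromℕ 3 ℚ.* c) ℚ.+ (+ 3 / 4) ℚ.* (fromℕ 9 ℚ.* e))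
      ≡⟨ cong (d ℚ.+_) (cong₂ ℚ._+_ (ℚ.*-assoc (+ 3 / 4) (fromℕ 3) c) (ℚ.*-assoc (+ 3 / 4) (fromℕ 9) e)) ⟨
    d ℚ.+ (9/4 ℚ.* c ℚ.+ 27/4 ℚ.* e)
      ≡⟨ ℚ.+-assoc d (9/4 ℚ.* c) (27/4 ℚ.* e) ⟨
    d ℚ.+ 9/4 ℚ.* c ℚ.+ 27/4 ℚ.* e ∎
  recurrence : fromℕ 4 ℚ.* (fromℕ (suc n) ℚ.* d′) ≡ fromℕ 3 ℚ.* c ℚ.+ fromℕ 9 ℚ.* (fromℕ (suc (3 ℕ.* n)) ℚ.* d)
  recurrence = begin
    fromℕ 4 ℚ.* (fromℕ (suc n) ℚ.* d′)
      ≡⟨ cong (fromℕ 4 ℚ.*_) (fromℕ-* (suc n) (central (suc n))) ⟨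
    fromℕ 4 ℚ.* fromℕ (suc n ℕ.* central (suc n))
      ≡⟨ fromℕ-* 4 (suc n ℕ.* central (suc n)) ⟨
    fromℕ (4 ℕ.* (suc n ℕ.* central (suc n)))
      ≡⟨ cong fromℕ (central-recurrence n) ⟩
    fromℕ (3 ℕ.* (suc (3 ℕ.* n) C n) ℕ.+ 9 ℕ.* (suc (3 ℕ.* n) ℕ.* central n))
      ≡⟨ fromℕ-+ (3 ℕ.* (suc (3 ℕ.* n) C n)) _ ⟩
    fromℕ (3 ℕ.* (suc (3 ℕ.* n) C n)) ℚ.+ fromℕ (9 ℕ.* (suc (3 ℕ.* n) ℕ.* central n))
      ≡⟨ cong₂ ℚ._+_ (fromℕ-* 3 (suc (3 ℕ.* n) C n))
           (trans (fromℕ-* 9 (suc (3 ℕ.* n) ℕ.* central n)) (cong (fromℕ 9 ℚ.*_) (fromℕ-* (suc (3 ℕ.* n)) (central n)))) ⟩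
    fromℕ 3 ℚ.* c ℚ.+ fromℕ 9 ℚ.* (fromℕ (suc (3 ℕ.* n)) ℚ.* d) ∎

-- Stripping the geometric series multiplies by 1 - 27z/4, which turns the claim into the recurrence
-- for the central coefficients; Rothe-Hagen supplies the product T D inside `numerator-⊛`.
levels-⊛-central : ∀ n → (levels ⊛ (fromℕ ∘ central)) n ≡ suc (3 ℕ.* n) × fromℕ (central n)
levels-⊛-central n = trans (ℚˢ.⊛-assoc geometric numerator D n) (trans (claim n) (sym (×≡fromℕ* (suc (3 ℕ.* n)) (D n))))
  where
  open ≡-Reasoning
  D : ℕ → ℚ
  D = fromℕ ∘ central
  claim : ∀ n → (geometric ⊛ (numerator ⊛ D)) n ≡ fromℕ (suc (3 ℕ.* n)) ℚ.* D n
  claim zero    = refl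
  claim (suc n) = begin
    1ℚ ℚ.* (numerator ⊛ D) (suc n) ℚ.+ ((27/4 ∙ geometric) ⊛ (numerator ⊛ D)) n
      ≡⟨ cong₂ ℚ._+_ (ℚ.*-identityˡ ((numerator ⊛ D) (suc n))) (ℚˢ.∙-⊛ 27/4 geometric (numerator ⊛ D) n) ⟩
    (numerator ⊛ D) (suc n) ℚ.+ 27/4 ℚ.* (geometric ⊛ (numerator ⊛ D)) n
      ≡⟨ cong₂ ℚ._+_ numerator-⊛ (cong (27/4 ℚ.*_) (claim n)) ⟩
    D (suc n) ℚ.+ 9/4 ℚ.* fromℕ (suc (3 ℕ.* n) C n) ℚ.+ 27/4 ℚ.* (fromℕ (suc (3 ℕ.* n)) ℚ.* D n)
      ≡⟨ central-recurrence-ℚ n ⟨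
    fromℕ (suc (3 ℕ.* suc n)) ℚ.* D (suc n) ∎
    where
    numerator-⊛ : (numerator ⊛ D) (suc n) ≡ D (suc n) ℚ.+ 9/4 ℚ.* fromℕ (suc (3 ℕ.* n) C n)
    numerator-⊛ = cong₂ ℚ._+_ (ℚ.*-identityˡ (D (suc n)))
      (trans (ℚˢ.∙-⊛ 9/4 (fromℕ ∘ ternaryTrees) D n)
        (cong (9/4 ℚ.*_) (trans (sym (fromℕ-⊛ ternaryTrees central n)) (cong fromℕ (ternary-⊛-central n)))))

-- stretch f is f(z³).
stretch : (ℕ → ℚ) → ℕ → ℚ
stretch f 0                   = f 0
stretch f 1                   = 0ℚ
stretch f 2                   = 0ℚ
stretch f (suc (suc (suc n))) = stretch (f ∘ suc) n

stretch-cong : ∀ {f g} → f ≋ g → stretch f ≋ stretch g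
stretch-cong p 0                   = p 0
stretch-cong p 1                   = refl
stretch-cong p 2                   = refl
stretch-cong p (suc (suc (suc n))) = stretch-cong (p ∘ suc) n

stretch-⊞ : ∀ f g → stretch (f ⊞ g) ≋ stretch f ⊞ stretch g
stretch-⊞ f g 0                   = refl
stretch-⊞ f g 1                   = refl
stretch-⊞ f g 2                   = refl
stretch-⊞ f g (suc (suc (suc n))) = stretch-⊞ (f ∘ suc) (g ∘ suc) n

stretch-∙ : ∀ c f → stretch (c ∙ f) ≋ c ∙ stretch f
stretch-∙ c f 0                   = refl
stretch-∙ c f 1                   = sym (ℚ.*-zeroʳ c)
stretch-∙ c f 2                   = sym (ℚ.*-zeroʳ c)
stretch-∙ c f (suc (suc (suc n))) = stretch-∙ c (f ∘ suc) n

-- Under `stretch` only the degrees n = 3k survive, so n and 3k are interchangeable there. The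
-- offset `c` absorbs the threes released by the induction.
stretch-diagonal : ∀ (f : ℕ → ℕ → ℚ) c n → stretch (λ k → f k (c ℕ.+ n)) n ≡ stretch (λ k → f k (c ℕ.+ 3 ℕ.* k)) n
stretch-diagonal f c 0                   = refl
stretch-diagonal f c 1                   = refl
stretch-diagonal f c 2                   = refl
stretch-diagonal f c (suc (suc (suc n))) = begin
  stretch (λ k → f (suc k) (c ℕ.+ (3 ℕ.+ n))) n     ≡⟨ stretch-cong (λ k → cong (f (suc k)) (ℕ.+-assoc c 3 n)) n ⟨
  stretch (λ k → f (suc k) (c ℕ.+ 3 ℕ.+ n)) n       ≡⟨ stretch-diagonal (f ∘ suc) (c ℕ.+ 3) n ⟩
  stretch (λ k → f (suc k) (c ℕ.+ 3 ℕ.+ 3 ℕ.* k)) n ≡⟨ stretch-cong (λ k → cong (f (suc k)) (shift c k)) n ⟩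
  stretch (λ k → f (suc k) (c ℕ.+ 3 ℕ.* suc k)) n   ∎
  where
  open ≡-Reasoning
  shift : ∀ c k → c ℕ.+ 3 ℕ.+ 3 ℕ.* k ≡ c ℕ.+ 3 ℕ.* suc k
  shift = ℕ-Solver.solve-∀

stretch-× : ∀ k f n → stretch (λ i → k × f i) n ≡ k × stretch f n
stretch-× zero    f n = stretch-0 n
  where
  stretch-0 : ∀ n → stretch (λ _ → 0ℚ) n ≡ 0ℚ
  stretch-0 0                   = refl
  stretch-0 1                   = refl
  stretch-0 2                   = refl
  stretch-0 (suc (suc (suc n))) = stretch-0 n
stretch-× (suc k) f n = trans (stretch-⊞ f (λ i → k × f i) n) (cong (stretch f n ℚ.+_) (stretch-× k f n))

stretch-⊛ : ∀ f g → stretch f ⊛ stretch g ≋ stretch (f ⊛ g)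
stretch-⊛ f g 0 = refl
stretch-⊛ f g 1 = trans (cong₂ ℚ._+_ (ℚ.*-zeroʳ (f 0)) (ℚ.*-zeroˡ (g 0))) refl
stretch-⊛ f g 2 = cong₂ ℚ._+_ (ℚ.*-zeroʳ (f 0)) (cong₂ ℚ._+_ (ℚ.*-zeroˡ 0ℚ) (ℚ.*-zeroˡ (g 0)))
stretch-⊛ f g (suc (suc (suc n))) = begin
  f 0 ℚ.* stretch (g ∘ suc) n ℚ.+ (0ℚ ℚ.* g₂ ℚ.+ (0ℚ ℚ.* g₁ ℚ.+ (stretch (f ∘ suc) ⊛ stretch g) n))
    ≡⟨ cong (f 0 ℚ.* stretch (g ∘ suc) n ℚ.+_) (trans (drop g₂ _) (drop g₁ _)) ⟩
  f 0 ℚ.* stretch (g ∘ suc) n ℚ.+ (stretch (f ∘ suc) ⊛ stretch g) n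
    ≡⟨ cong₂ ℚ._+_ (sym (stretch-∙ (f 0) (g ∘ suc) n)) (stretch-⊛ (f ∘ suc) g n) ⟩
  stretch (f 0 ∙ (g ∘ suc)) n ℚ.+ stretch ((f ∘ suc) ⊛ g) n
    ≡⟨ stretch-⊞ (f 0 ∙ (g ∘ suc)) ((f ∘ suc) ⊛ g) n ⟨
  stretch (f 0 ∙ (g ∘ suc) ⊞ (f ∘ suc) ⊛ g) n ∎
  where
  open ≡-Reasoning
  g₁ g₂ : ℚ
  g₁ = stretch g (suc n)
  g₂ = stretch g (suc (suc n))
  drop : ∀ p q → 0ℚ ℚ.* p ℚ.+ q ≡ q
  drop p q = trans (cong (ℚ._+ q) (ℚ.*-zeroˡ p)) (ℚ.+-identityˡ q)

stretch-levels-⊛-central : ∀ n →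
  (stretch levels ⊛ stretch (fromℕ ∘ central)) n ≡ suc n × stretch (fromℕ ∘ central) n
stretch-levels-⊛-central n = begin
  (stretch levels ⊛ stretch D) n             ≡⟨ stretch-⊛ levels D n ⟩
  stretch (levels ⊛ D) n                     ≡⟨ stretch-cong levels-⊛-central n ⟩
  stretch (λ k → suc (3 ℕ.* k) × D k) n      ≡⟨ stretch-diagonal (λ k m → m × D k) 1 n ⟨
  stretch (λ k → suc n × D k) n              ≡⟨ stretch-× (suc n) D n ⟩
  suc n × stretch D n                        ∎
  where
  open ≡-Reasoning
  D : ℕ → ℚ
  D = fromℕ ∘ central

-- vertical y j is the number of sequences of j steps +2 and -1 from 0 to y:
-- after k steps +2 the height is 3k - j.
stretchᶻ : (ℕ → ℚ) → ℤ → ℚ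
stretchᶻ f (+ n)    = stretch f n
stretchᶻ f -[1+ _ ] = 0ℚ

vertical : ℤ → ℕ → ℚ
vertical y j = stretchᶻ (λ k → fromℕ (j C k)) (y ℤ.+ + j)

-- With 3k = y + j, removing a step +2 lowers 3k by 3 and removing a step -1 leaves it unchanged, so
-- this is Pascal's rule for k.
vertical-suc : ∀ y j → vertical y (suc j) ≡ vertical (y ℤ.+ -[1+ 1 ]) j ℚ.+ vertical (y ℤ.+ + 1) j
vertical-suc y j = begin
  stretchᶻ (row (suc j)) (y ℤ.+ + suc j)
    ≡⟨ pascal (y ℤ.+ + suc j) ⟩
  stretchᶻ (row j) (y ℤ.+ + suc j ℤ.+ -[1+ 2 ]) ℚ.+ stretchᶻ (row j) (y ℤ.+ + suc j)
    ≡⟨ cong₂ (λ s t → stretchᶻ (row j) s ℚ.+ stretchᶻ (row j) t) up down ⟩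
  vertical (y ℤ.+ -[1+ 1 ]) j ℚ.+ vertical (y ℤ.+ + 1) j ∎
  where
  open ≡-Reasoning
  row : ℕ → ℕ → ℚ
  row j k = fromℕ (j C k)
  pascal : ∀ t → stretchᶻ (row (suc j)) t ≡ stretchᶻ (row j) (t ℤ.+ -[1+ 2 ]) ℚ.+ stretchᶻ (row j) t
  pascal -[1+ n ] = refl
  pascal (+ 0)    = refl
  pascal (+ 1)    = refl
  pascal (+ 2)    = refl
  pascal (+ suc (suc (suc n))) = trans
    (stretch-cong (λ k → trans (cong fromℕ (sym (nCk+nC[k+1]≡[n+1]C[k+1] j k))) (fromℕ-+ (j C k) (j C suc k))) n)
    (stretch-⊞ (row j) (row j ∘ suc) n)
  up : y ℤ.+ + suc j ℤ.+ -[1+ 2 ] ≡ y ℤ.+ -[1+ 1 ] ℤ.+ + j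
  up = shift y (+ j)
    where
    shift : ∀ y j → y ℤ.+ (+ 1 ℤ.+ j) ℤ.+ -[1+ 2 ] ≡ y ℤ.+ -[1+ 1 ] ℤ.+ j
    shift = ℤ-Solver.solve-∀
  down : y ℤ.+ + suc j ≡ y ℤ.+ + 1 ℤ.+ + j
  down = sym (ℤ.+-assoc y (+ 1) (+ j))

vertical-0 : ∀ j → vertical (+ 0) j ≡ stretch (fromℕ ∘ central) j
vertical-0 j = stretch-diagonal (λ k m → fromℕ (m C k)) 0 j

-- Counting walks by their last step

open CommutativeSemigroupProperties ℕ.+-commutativeSemigroup using () renaming (interchange to ℕ-+-interchange)

IsWalk : ∀ {N} → Point → Point → Vec Point N → Set
IsWalk p q w = endpoint p w ≡ q ∧ All (λ r → ¬ OnSlit r) (visited p w)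

isWalk? : ∀ {N} p q (w : Vec Point N) → Dec (IsWalk p q w)
isWalk? p q w = ≡-dec ℤ._≟_ ℤ._≟_ (endpoint p w) q ×-dec all? (λ r → ¬? (onSlit? r)) (visited p w)

-- An arbitrary start allows walks to be shortened at the front. The start itself is never tested
-- against the slit.
walks : ℕ → Point → Point → ℕ
walks N p q = length (filter (isWalk? p q) (stepSequences N))

walks-0-same : ∀ p → walks 0 p p ≡ 1
walks-0-same p = cong length (List.filter-accept (isWalk? p p) {[]} {[]} (refl , []))

walks-0-distinct : ∀ p q → p ≢ q → walks 0 p q ≡ 0
walks-0-distinct p q p≢q = cong length (List.filter-reject (isWalk? p q) {[]} {[]} (p≢q ∘ proj₁))

free : Point → ℕ
free p with onSlit? p
... | yes _ = 0
... | no  _ = 1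

length-filter-map : ∀ {A B : Set} {P : Pred B 0ℓ} {Q : Pred A 0ℓ} (P? : Decidable P) (Q? : Decidable Q) (f : A → B) →
  (∀ x → P (f x) → Q x) → (∀ x → Q x → P (f x)) →
  ∀ xs → length (filter P? (map f xs)) ≡ length (filter Q? xs)
length-filter-map P? Q? f to from []       = refl
length-filter-map P? Q? f to from (x ∷ xs) with P? (f x) | Q? x
... | yes _  | yes _  = cong suc (length-filter-map P? Q? f to from xs)
... | yes p  | no  ¬q = contradiction (to x p) ¬q
... | no  ¬p | yes q  = contradiction (from x q) ¬p
... | no  _  | no  _  = length-filter-map P? Q? f to from xs

length-filter-none : ∀ {A B : Set} {P : Pred B 0ℓ} (P? : Decidable P) (f : A → B) →
  (∀ x → ¬ P (f x)) → ∀ xs → length (filter P? (map f xs)) ≡ 0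
length-filter-none P? f none []       = refl
length-filter-none P? f none (x ∷ xs) with P? (f x)
... | yes p = contradiction p (none x)
... | no  _ = length-filter-none P? f none xs

walks-∷ : ∀ {N} p q s (ws : List (Vec Point N)) →
  length (filter (isWalk? p q) (map (s ∷_) ws)) ≡ free (p ⊕ s) ℕ.* length (filter (isWalk? (p ⊕ s) q) ws)
walks-∷ p q s ws with onSlit? (p ⊕ s)
... | yes h = length-filter-none (isWalk? p q) (s ∷_) (λ { w (_ , ¬h ∷ _) → ¬h h }) ws
... | no ¬h = trans
  (length-filter-map (isWalk? p q) (isWalk? (p ⊕ s) q) (s ∷_)
       (λ { w (e , _ ∷ a) → e , a }) (λ { w (e , a) → e , ¬h ∷ a }) ws)
  (sym (ℕ.*-identityˡ _))

Σ∈ : List Point → (Point → ℕ) → ℕ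
Σ∈ ss f = sum (map f ss)

Σ∈-cong : ∀ ss {f g} → f ≗ g → Σ∈ ss f ≡ Σ∈ ss g
Σ∈-cong ss e = cong sum (List.map-cong e ss)

*-Σ∈ : ∀ c ss f → c ℕ.* Σ∈ ss f ≡ Σ∈ ss (λ s → c ℕ.* f s)
*-Σ∈ c []       f = ℕ.*-zeroʳ c
*-Σ∈ c (s ∷ ss) f = trans (ℕ.*-distribˡ-+ c (f s) _) (cong (λ m → c ℕ.* f s ℕ.+ m) (*-Σ∈ c ss f))

Σ∈-+ : ∀ ss f g → Σ∈ ss (λ s → f s ℕ.+ g s) ≡ Σ∈ ss f ℕ.+ Σ∈ ss g
Σ∈-+ []       f g = refl
Σ∈-+ (s ∷ ss) f g = trans (cong ((f s ℕ.+ g s) ℕ.+_) (Σ∈-+ ss f g)) (ℕ-+-interchange (f s) (g s) _ _)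

Σ∈-swap : ∀ ss ts (f : Point → Point → ℕ) → Σ∈ ss (λ s → Σ∈ ts (f s)) ≡ Σ∈ ts (λ t → Σ∈ ss (λ s → f s t))
Σ∈-swap []       ts f = sym (trans (sym (*-Σ∈ 0 ts (λ _ → 0))) refl)
Σ∈-swap (s ∷ ss) ts f = trans (cong ((Σ∈ ts (f s)) ℕ.+_) (Σ∈-swap ss ts f)) (sym (Σ∈-+ ts (f s) _))

walks-first : ∀ N p q → walks (suc N) p q ≡ Σ∈ steps (λ s → free (p ⊕ s) ℕ.* walks N (p ⊕ s) q)
walks-first N p q = go steps
  where
  open ≡-Reasoning
  go : ∀ ss → length (filter (isWalk? p q) (cartesianProductWith _∷_ ss (stepSequences N))) ≡
              Σ∈ ss (λ s → free (p ⊕ s) ℕ.* walks N (p ⊕ s) q)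
  go []       = refl
  go (s ∷ ss) = begin
    length (filter (isWalk? p q) (map (s ∷_) ws ++ rest))
      ≡⟨ cong length (List.filter-++ (isWalk? p q) (map (s ∷_) ws) rest) ⟩
    length (filter (isWalk? p q) (map (s ∷_) ws) ++ filter (isWalk? p q) rest)
      ≡⟨ List.length-++ (filter (isWalk? p q) (map (s ∷_) ws)) ⟩
    length (filter (isWalk? p q) (map (s ∷_) ws)) ℕ.+ length (filter (isWalk? p q) rest)
      ≡⟨ cong₂ ℕ._+_ (walks-∷ p q s ws) (go ss) ⟩
    free (p ⊕ s) ℕ.* walks N (p ⊕ s) q ℕ.+ Σ∈ ss (λ s → free (p ⊕ s) ℕ.* walks N (p ⊕ s) q) ∎
    where
    ws = stepSequences N
    rest = cartesianProductWith _∷_ ss ws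

infixl 6 _⊝_
_⊝_ : Point → Point → Point
(x , y) ⊝ (u , v) = (x ℤ.- u , y ℤ.- v)

⊕-⊝ : ∀ p s → p ⊕ s ⊝ s ≡ p
⊕-⊝ (x , y) (u , v) = cong₂ _,_ (cancel x u) (cancel y v)
  where
  cancel : ∀ x u → x ℤ.+ u ℤ.- u ≡ x
  cancel x u = trans (ℤ.+-assoc x u (- u)) (trans (cong (λ z → x ℤ.+ z) (ℤ.+-inverseʳ u)) (ℤ.+-identityʳ x))

⊝-⊕ : ∀ p s → (p ⊝ s) ⊕ s ≡ p
⊝-⊕ (x , y) (u , v) = cong₂ _,_ (cancel x u) (cancel y v)
  where
  cancel : ∀ x u → x ℤ.- u ℤ.+ u ≡ x
  cancel x u = trans (ℤ.+-assoc x (- u) u) (trans (cong (λ z → x ℤ.+ z) (ℤ.+-inverseˡ u)) (ℤ.+-identityʳ x))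

-- Step sequences grow at the front, whereas the generating functions need the start to stay at the
-- origin. The recursion by the last step follows by exchanging the sums over first and last steps;
-- in the one-step case the two factors `free` agree wherever p ⊕ s = q.
walks-last : ∀ N p q → walks (suc N) p q ≡ free q ℕ.* Σ∈ steps (λ s → walks N p (q ⊝ s))
walks-last zero p q = begin
  walks 1 p q                                          ≡⟨ walks-first 0 p q ⟩
  Σ∈ steps (λ s → free (p ⊕ s) ℕ.* walks 0 (p ⊕ s) q)    ≡⟨ Σ∈-cong steps move ⟩
  Σ∈ steps (λ s → free q ℕ.* walks 0 p (q ⊝ s))          ≡⟨ *-Σ∈ (free q) steps (λ s → walks 0 p (q ⊝ s)) ⟨
  free q ℕ.* Σ∈ steps (λ s → walks 0 p (q ⊝ s))          ∎
  where
  open ≡-Reasoning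
  move : ∀ s → free (p ⊕ s) ℕ.* walks 0 (p ⊕ s) q ≡ free q ℕ.* walks 0 p (q ⊝ s)
  move s = decide (≡-dec ℤ._≟_ ℤ._≟_ (p ⊕ s) q)
    where
    decide : Dec (p ⊕ s ≡ q) → free (p ⊕ s) ℕ.* walks 0 (p ⊕ s) q ≡ free q ℕ.* walks 0 p (q ⊝ s)
    decide (yes refl) = cong (free q ℕ.*_) (begin
      walks 0 q q           ≡⟨ walks-0-same q ⟩
      1                     ≡⟨ walks-0-same p ⟨
      walks 0 p p           ≡⟨ cong (walks 0 p) (⊕-⊝ p s) ⟨
      walks 0 p (q ⊝ s)     ∎)
    decide (no p⊕s≢q) = begin
      free (p ⊕ s) ℕ.* walks 0 (p ⊕ s) q  ≡⟨ cong (free (p ⊕ s) ℕ.*_) (walks-0-distinct (p ⊕ s) q p⊕s≢q) ⟩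
      free (p ⊕ s) ℕ.* 0                  ≡⟨ ℕ.*-zeroʳ (free (p ⊕ s)) ⟩
      0                                   ≡⟨ ℕ.*-zeroʳ (free q) ⟨
      free q ℕ.* 0
        ≡⟨ cong (free q ℕ.*_) (walks-0-distinct p (q ⊝ s) λ p≡q⊝s → p⊕s≢q (trans (cong (_⊕ s) p≡q⊝s) (⊝-⊕ q s))) ⟨
      free q ℕ.* walks 0 p (q ⊝ s)        ∎
walks-last (suc N) p q = begin
  walks (2 ℕ.+ N) p q
    ≡⟨ walks-first (suc N) p q ⟩
  Σ∈ steps (λ s → free (p ⊕ s) ℕ.* walks (suc N) (p ⊕ s) q)
    ≡⟨ Σ∈-cong steps (λ s → cong (free (p ⊕ s) ℕ.*_) (walks-last N (p ⊕ s) q)) ⟩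
  Σ∈ steps (λ s → free (p ⊕ s) ℕ.* (free q ℕ.* Σ∈ steps (λ t → walks N (p ⊕ s) (q ⊝ t))))
    ≡⟨ Σ∈-cong steps (λ s → trans (swap (free (p ⊕ s)) (free q) (Σ∈ steps (λ t → walks N (p ⊕ s) (q ⊝ t))))
         (cong (free q ℕ.*_) (*-Σ∈ (free (p ⊕ s)) steps (λ t → walks N (p ⊕ s) (q ⊝ t))))) ⟩
  Σ∈ steps (λ s → free q ℕ.* Σ∈ steps (λ t → free (p ⊕ s) ℕ.* walks N (p ⊕ s) (q ⊝ t)))
    ≡⟨ *-Σ∈ (free q) steps (λ s → Σ∈ steps (λ t → free (p ⊕ s) ℕ.* walks N (p ⊕ s) (q ⊝ t))) ⟨
  free q ℕ.* Σ∈ steps (λ s → Σ∈ steps (λ t → free (p ⊕ s) ℕ.* walks N (p ⊕ s) (q ⊝ t)))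
    ≡⟨ cong (free q ℕ.*_) (Σ∈-swap steps steps (λ s t → free (p ⊕ s) ℕ.* walks N (p ⊕ s) (q ⊝ t))) ⟩
  free q ℕ.* Σ∈ steps (λ t → Σ∈ steps (λ s → free (p ⊕ s) ℕ.* walks N (p ⊕ s) (q ⊝ t)))
    ≡⟨ cong (free q ℕ.*_) (Σ∈-cong steps (λ t → walks-first N p (q ⊝ t))) ⟨
  free q ℕ.* Σ∈ steps (λ t → walks (suc N) p (q ⊝ t)) ∎
  where
  open ≡-Reasoning
  swap : ∀ a b c → a ℕ.* (b ℕ.* c) ≡ b ℕ.* (a ℕ.* c)
  swap a b c = trans (sym (ℕ.*-assoc a b c)) (trans (cong (ℕ._* c) (ℕ.*-comm a b)) (ℕ.*-assoc b a c))

-- Walks from the origin that meet the slit after their start, for the first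
-- time, at their last step.
killed : ℕ → Point → ℕ
killed zero    q = 0
killed (suc N) q = (1 ℕ.∸ free q) ℕ.* Σ∈ steps (λ s → walks N origin (q ⊝ s))

extensions : ℕ → ℤ → ℤ → ℕ
extensions N x y =
  (walks N origin (x ℤ.- + 1 , y) ℕ.+ walks N origin (x ℤ.+ + 1 , y)) ℕ.+
  (walks N origin (x , y ℤ.- + 2) ℕ.+ walks N origin (x , y ℤ.+ + 1))

-- One more step turns a slit walk into a slit walk or into a killed one, according to whether
-- `free q` is 1 or 0, so the sum of both counts obeys an unrestricted recursion.
walks+killed : ∀ N x y → walks (suc N) origin (x , y) ℕ.+ killed (suc N) (x , y) ≡ extensions N x y
walks+killed N x y = begin
  walks (suc N) origin q ℕ.+ killed (suc N) q    ≡⟨ cong (ℕ._+ killed (suc N) q) (walks-last N origin q) ⟩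
  free q ℕ.* c ℕ.+ (1 ℕ.∸ free q) ℕ.* c              ≡⟨ ℕ.*-distribʳ-+ c (free q) (1 ℕ.∸ free q) ⟨
  (free q ℕ.+ (1 ℕ.∸ free q)) ℕ.* c                ≡⟨ cong (ℕ._* c) (ℕ.m+[n∸m]≡n (free≤1 q)) ⟩
  1 ℕ.* c                                        ≡⟨ ℕ.*-identityˡ c ⟩
  c                                            ≡⟨ cong₂ ℕ._+_ (at refl (ℤ.+-identityʳ y)) (cong₂ ℕ._+_ (at refl (ℤ.+-identityʳ y))
                                                   (cong₂ ℕ._+_ (at (ℤ.+-identityʳ x) refl) (cong (ℕ._+ 0) (at (ℤ.+-identityʳ x) refl)))) ⟩
  e₁ ℕ.+ (e₂ ℕ.+ (e₃ ℕ.+ (e₄ ℕ.+ 0)))                  ≡⟨ cong (λ e → e₁ ℕ.+ (e₂ ℕ.+ (e₃ ℕ.+ e))) (ℕ.+-identityʳ e₄) ⟩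
  e₁ ℕ.+ (e₂ ℕ.+ (e₃ ℕ.+ e₄))                        ≡⟨ ℕ.+-assoc e₁ e₂ (e₃ ℕ.+ e₄) ⟨
  extensions N x y                             ∎
  where
  open ≡-Reasoning
  q = x , y
  c = Σ∈ steps (λ s → walks N origin (q ⊝ s))
  e₁ = walks N origin (x ℤ.- + 1 , y)
  e₂ = walks N origin (x ℤ.+ + 1 , y)
  e₃ = walks N origin (x , y ℤ.- + 2)
  e₄ = walks N origin (x , y ℤ.+ + 1)
  at : ∀ {u u′ v v′} → u ≡ u′ → v ≡ v′ → walks N origin (u , v) ≡ walks N origin (u′ , v′)
  at p q = cong₂ (λ u v → walks N origin (u , v)) p q
  free≤1 : ∀ p → free p ℕ.≤ 1
  free≤1 p with onSlit? p
  ... | yes _ = ℕ.z≤n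
  ... | no  _ = ℕ.≤-refl

walks-slit : ∀ N {q} → OnSlit q → walks (suc N) origin q ≡ 0
walks-slit N {q} h = trans (walks-last N origin q) (cong (ℕ._* Σ∈ steps (λ s → walks N origin (q ⊝ s))) free≡0)
  where
  free≡0 : free q ≡ 0
  free≡0 with onSlit? q
  ... | yes _ = refl
  ... | no ¬h = contradiction h ¬h

killed-off-slit : ∀ N {q} → ¬ OnSlit q → killed N q ≡ 0
killed-off-slit zero    ¬h = refl
killed-off-slit (suc N) {q} ¬h = cong (λ f → (1 ℕ.∸ f) ℕ.* Σ∈ steps (λ s → walks N origin (q ⊝ s))) free≡1
  where
  free≡1 : free q ≡ 1
  free≡1 with onSlit? q
  ... | yes h = contradiction h ¬h
  ... | no _  = refl

-- Monomials t^N x^a with a natural number a represent only endpoints with abscissa at most N, and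
-- this shows that nothing is lost. The excess `k` varies because the neighbour on the right raises
-- it by 2.
walks-far : ∀ N k y → walks N origin (+ suc (N ℕ.+ k) , y) ≡ 0
walks-far zero    k y = walks-0-distinct origin (+ suc k , y) λ ()
walks-far (suc N) k y = ℕ.m+n≡0⇒m≡0 _ (trans (walks+killed N (+ suc (suc N ℕ.+ k)) y)
  (cong₂ ℕ._+_ (cong₂ ℕ._+_ (walks-far N k y) (at 2 right)) (cong₂ ℕ._+_ (at 1 stay) (at 1 stay))))
  where
  at : ∀ j {x v} → x ≡ + suc (N ℕ.+ (k ℕ.+ j)) → walks N origin (x , v) ≡ 0
  at j {v = v} refl = walks-far N (k ℕ.+ j) v
  right : + suc (suc N ℕ.+ k) ℤ.+ + 1 ≡ + suc (N ℕ.+ (k ℕ.+ 2))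
  right = cong +_ (trans (cong (λ m → suc (suc m)) (ℕ.+-assoc N k 1)) (cong suc
    (trans (sym (ℕ.+-suc N (k ℕ.+ 1))) (cong (λ m → N ℕ.+ m) (sym (ℕ.+-suc k 1))))))
  stay : + suc (suc N ℕ.+ k) ≡ + suc (N ℕ.+ (k ℕ.+ 1))
  stay = cong (λ m → + suc m) (trans (sym (ℕ.+-suc N k)) (cong (λ m → N ℕ.+ m) (ℕ.+-comm 1 k)))

-- Generating functions of walks

private
  module K = CommutativeSemiring ℚˢ.commutativeSemiring
  module 𝔸 = PowerSeries ℚˢ.commutativeSemiring
  module 𝔸S = CommutativeSemiring 𝔸.commutativeSemiring
open Coefficients ℚ-commutativeSemiring
open Substitution ℚˢ.commutativeSemiring 1+var² var
open Mult (CommutativeSemiring.semiring ℚˢ.commutativeSemiring) using () renaming (_×_ to _×ᴷ_)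
open 𝔸 using (θ) renaming (_⊛_ to _⊛ᵗ_; _⊞_ to _⊞ᵗ_; _≋_ to _≋ᵗ_; _∙_ to _∙ᵗ_; 1ˢ to 1ᵗ)

-- Between and around j vertical steps there are j + 1 runs of horizontal steps, which gives
-- (tx)^j/(1 - tX)^(j+1); this is what `sub` produces. The height `y` is arbitrary because the
-- recursion by the last step leaves the axis.
slitSeries killedSeries allSeries : ℤ → 𝔸.Series
slitSeries   y N a = fromℕ (walks N origin (N ⊖ a , y))
killedSeries y N a = fromℕ (killed N (N ⊖ a , y))
allSeries    y     = sub (const ∘ vertical y)

slit+killed : ∀ y N → slitSeries y (suc N) ⊞ killedSeries y (suc N) ≋
  1+var² ⊛ slitSeries y N ⊞ var ⊛ (slitSeries (y ℤ.- + 2) N ⊞ slitSeries (y ℤ.+ + 1) N)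
slit+killed y N a = begin
  slitSeries y (suc N) a ℚ.+ killedSeries y (suc N) a
    ≡⟨ fromℕ-+ (walks (suc N) origin (suc N ⊖ a , y)) (killed (suc N) (suc N ⊖ a , y)) ⟨
  fromℕ (walks (suc N) origin (suc N ⊖ a , y) ℕ.+ killed (suc N) (suc N ⊖ a , y))
    ≡⟨ cong fromℕ (walks+killed N (suc N ⊖ a) y) ⟩
  fromℕ (extensions N (suc N ⊖ a) y)
    ≡⟨ fromℕ-+ (w₁ ℕ.+ w₂) (w₃ ℕ.+ w₄) ⟩
  fromℕ (w₁ ℕ.+ w₂) ℚ.+ fromℕ (w₃ ℕ.+ w₄)
    ≡⟨ cong₂ ℚ._+_ (trans (fromℕ-+ w₁ w₂) (horizontal a)) (trans (fromℕ-+ w₃ w₄) (upDown a)) ⟩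
  (1+var² ⊛ slitSeries y N) a ℚ.+ (var ⊛ (slitSeries (y ℤ.- + 2) N ⊞ slitSeries (y ℤ.+ + 1) N)) a ∎
  where
  open ≡-Reasoning
  at : ℤ → ℤ → ℕ
  at x v = walks N origin (x , v)
  w₁ = at (suc N ⊖ a ℤ.- + 1) y
  w₂ = at (suc N ⊖ a ℤ.+ + 1) y
  w₃ = at (suc N ⊖ a) (y ℤ.- + 2)
  w₄ = at (suc N ⊖ a) (y ℤ.+ + 1)
  far : ∀ k v → fromℕ (at (+ suc (N ℕ.+ k)) v) ≡ 0ℚ
  far k v = cong fromℕ (walks-far N k v)
  left : ∀ b → suc N ⊖ b ℤ.- + 1 ≡ N ⊖ b
  left b = trans (ℤ.+-comm (suc N ⊖ b) -[1+ 0 ]) (trans (ℤ.distribʳ-⊖-+-neg 0 (suc N) b) (ℤ.[1+m]⊖[1+n]≡m⊖n N b))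
  right : ∀ b → suc N ⊖ suc (suc b) ℤ.+ + 1 ≡ N ⊖ b
  right b = trans (ℤ.distribˡ-⊖-+-pos 1 (suc N) (suc (suc b)))
    (trans (cong (_⊖ suc (suc b)) (ℕ.+-comm (suc N) 1))
      (trans (ℤ.[1+m]⊖[1+n]≡m⊖n (suc N) (suc b)) (ℤ.[1+m]⊖[1+n]≡m⊖n N b)))
  horizontal : ∀ a → fromℕ (at (suc N ⊖ a ℤ.- + 1) y) ℚ.+ fromℕ (at (suc N ⊖ a ℤ.+ + 1) y) ≡ (1+var² ⊛ slitSeries y N) a
  -- For a = 0 and a = 1 the product with x² contributes nothing, and correspondingly the neighbour
  -- on the right is out of reach after N steps.
  horizontal 0 = begin
    fromℕ (at (suc N ⊖ 0 ℤ.- + 1) y) ℚ.+ fromℕ (at (+ suc (N ℕ.+ 1)) y)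
      ≡⟨ cong₂ ℚ._+_ (cong (λ x → fromℕ (at x y)) (left 0)) (far 1 y) ⟩
    slitSeries y N 0 ℚ.+ 0ℚ
      ≡⟨ ℚ.+-identityʳ _ ⟩
    slitSeries y N 0
      ≡⟨ 1+var²-⊛-zero (slitSeries y N) ⟨
    (1+var² ⊛ slitSeries y N) 0 ∎
  horizontal 1 = begin
    fromℕ (at (suc N ⊖ 1 ℤ.- + 1) y) ℚ.+ fromℕ (at (suc N ⊖ 1 ℤ.+ + 1) y)
      ≡⟨ cong₂ ℚ._+_ (cong (λ x → fromℕ (at x y)) (left 1))
           (trans (cong (λ x → fromℕ (at x y)) edge) (far 0 y)) ⟩
    slitSeries y N 1 ℚ.+ 0ℚ
      ≡⟨ ℚ.+-identityʳ _ ⟩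
    slitSeries y N 1
      ≡⟨ 1+var²-⊛-one (slitSeries y N) ⟨
    (1+var² ⊛ slitSeries y N) 1 ∎
    where
    edge : suc N ⊖ 1 ℤ.+ + 1 ≡ + suc (N ℕ.+ 0)
    edge = trans (cong (ℤ._+ + 1) (trans (ℤ.[1+m]⊖[1+n]≡m⊖n N 0) (ℤ.⊖-≥ ℕ.z≤n)))
      (cong +_ (trans (ℕ.+-comm N 1) (cong suc (sym (ℕ.+-identityʳ N)))))
  horizontal (suc (suc b)) = begin
    fromℕ (at (suc N ⊖ suc (suc b) ℤ.- + 1) y) ℚ.+ fromℕ (at (suc N ⊖ suc (suc b) ℤ.+ + 1) y)
      ≡⟨ cong₂ (λ s t → fromℕ (at s y) ℚ.+ fromℕ (at t y)) (left (suc (suc b))) (right b) ⟩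
    slitSeries y N (suc (suc b)) ℚ.+ slitSeries y N b
      ≡⟨ 1+var²-⊛-suc (slitSeries y N) b ⟨
    (1+var² ⊛ slitSeries y N) (suc (suc b)) ∎
  upDown : ∀ a → fromℕ (at (suc N ⊖ a) (y ℤ.- + 2)) ℚ.+ fromℕ (at (suc N ⊖ a) (y ℤ.+ + 1)) ≡
    (var ⊛ (slitSeries (y ℤ.- + 2) N ⊞ slitSeries (y ℤ.+ + 1) N)) a
  upDown 0 = trans
    (cong₂ ℚ._+_ (trans (cong (λ k → fromℕ (at (+ suc k) (y ℤ.- + 2))) (sym (ℕ.+-identityʳ N))) (far 0 (y ℤ.- + 2)))
                 (trans (cong (λ k → fromℕ (at (+ suc k) (y ℤ.+ + 1))) (sym (ℕ.+-identityʳ N))) (far 0 (y ℤ.+ + 1))))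
    (sym (var-⊛-zero (slitSeries (y ℤ.- + 2) N ⊞ slitSeries (y ℤ.+ + 1) N)))
  upDown (suc a) = trans
    (cong (λ x → fromℕ (at x (y ℤ.- + 2)) ℚ.+ fromℕ (at x (y ℤ.+ + 1))) (ℤ.[1+m]⊖[1+n]≡m⊖n N a))
    (sym (var-⊛-suc (slitSeries (y ℤ.- + 2) N ⊞ slitSeries (y ℤ.+ + 1) N) a))

const-cong : ∀ {c d} → c ≡ d → const c ≋ const d
const-cong refl n = refl

const-⊞ : ∀ c d → const (c ℚ.+ d) ≋ const c ⊞ const d
const-⊞ c d zero    = refl
const-⊞ c d (suc n) = refl

allSeries-suc : ∀ y N → allSeries y (suc N) ≋
  1+var² ⊛ allSeries y N ⊞ var ⊛ (allSeries (y ℤ.- + 2) N ⊞ allSeries (y ℤ.+ + 1) N)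
allSeries-suc y N = K.+-congˡ {1+var² ⊛ allSeries y N} (K.*-congˡ {var} (K.trans
  (sub-cong (λ j → K.trans (const-cong (vertical-suc y j)) (const-⊞ (vertical (y ℤ.- + 2) j) (vertical (y ℤ.+ + 1) j))) N)
  (sub-⊞ (const ∘ vertical (y ℤ.- + 2)) (const ∘ vertical (y ℤ.+ + 1)) N)))

stretch-row-0 : ∀ n → stretch (λ k → fromℕ (0 C suc k)) n ≡ 0ℚ
stretch-row-0 0 = refl
stretch-row-0 1 = refl
stretch-row-0 2 = refl
stretch-row-0 (suc (suc (suc n))) = trans (stretch-cong (λ k → refl) n) (stretch-row-0 n)

vertical-at-0 : ∀ y → y ≢ + 0 → vertical y 0 ≡ 0ℚ
vertical-at-0 y y≢0 = trans (cong (stretchᶻ (λ k → fromℕ (0 C k))) (ℤ.+-identityʳ y)) (nonzero y y≢0)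
  where
  nonzero : ∀ y → y ≢ + 0 → stretchᶻ (λ k → fromℕ (0 C k)) y ≡ 0ℚ
  nonzero (+ 0)                   y≢0 = contradiction refl y≢0
  nonzero (+ 1)                   _   = refl
  nonzero (+ 2)                   _   = refl
  nonzero (+ suc (suc (suc n)))   _   = stretch-row-0 n
  nonzero -[1+ n ]                _   = refl

slit-start : ∀ y → slitSeries y 0 ≋ const (vertical y 0)
slit-start y zero with y ℤ.≟ + 0
... | yes refl = cong fromℕ (walks-0-same origin)
... | no  y≢0  = trans (cong fromℕ (walks-0-distinct origin (+ 0 , y) λ { refl → y≢0 refl })) (sym (vertical-at-0 y y≢0))
slit-start y (suc a) = cong fromℕ (walks-0-distinct origin (-[1+ a ] , y) λ ())

off-axis : ∀ {y} → y ≢ + 0 → ∀ x → ¬ OnSlit (x , y)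
off-axis y≢0 x (k , refl) = y≢0 refl

slitHits : 𝔸.Series
slitHits = killedSeries (+ 0)

slitHits-zero : slitHits 0 ≋ 0ˢ
slitHits-zero a = refl

-- `vertical y 0` is the indicator of y = 0, and killed walks end on the axis.
killed-start : ∀ y N → slitHits N ⊛ const (vertical y 0) ≋ killedSeries y N
killed-start y N with y ℤ.≟ + 0
... | yes refl = λ a → trans (K.*-comm (slitHits N) (const 1ℚ) a)
     (trans (const-⊛ 1ℚ (slitHits N) a) (ℚ.*-identityˡ (slitHits N a)))
... | no  y≢0  = λ a → trans (K.*-comm (slitHits N) (const (vertical y 0)) a) (trans (const-⊛ (vertical y 0) (slitHits N) a)
  (trans (cong (ℚ._* slitHits N a) (vertical-at-0 y y≢0)) (trans (ℚ.*-zeroˡ (slitHits N a))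
    (cong fromℕ (sym (killed-off-slit N (off-axis y≢0 (N ⊖ a))))))))

-- First passage: a walk that meets the slit is a killed walk followed by an arbitrary one. The
-- induction needs all heights together. Both sides obey the recursion `allSeries-suc`: the killed
-- walks missing from the recursion of the slit walks return as the last term of the Cauchy product
-- in t.
slit-decomposition : ∀ N y → (slitSeries y ⊞ᵗ slitHits ⊛ᵗ allSeries y) N ≋ allSeries y N
slit-decomposition zero y = begin
  slitSeries y 0 ⊞ slitHits 0 ⊛ allSeries y 0
    ≈⟨ K.+-cong (slit-start y) (K.trans (K.*-congʳ {allSeries y 0} slitHits-zero) (K.zeroˡ (allSeries y 0))) ⟩
  const (vertical y 0) ⊞ 0ˢ             ≈⟨ K.+-identityʳ (const (vertical y 0)) ⟩
  allSeries y 0                         ∎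
  where open SetoidReasoning K.setoid
slit-decomposition (suc N) y = begin
  slitSeries y (suc N) ⊞ (slitHits ⊛ᵗ all) (suc N)
    ≈⟨ K.+-congˡ {slitSeries y (suc N)} (𝔸.⊛-suc slitHits all N) ⟩
  slitSeries y (suc N) ⊞ ((slitHits ⊛ᵗ 𝔸.tail all) N ⊞ slitHits (suc N) ⊛ all 0)
    ≈⟨ K.+-congˡ {slitSeries y (suc N)} (K.+-cong expand (killed-start y (suc N))) ⟩
  slitSeries y (suc N) ⊞ (1+var² ⊛ (slitHits ⊛ᵗ all) N ⊞
    var ⊛ ((slitHits ⊛ᵗ all₋) N ⊞ (slitHits ⊛ᵗ all₊) N) ⊞ killedSeries y (suc N))
    ≈⟨ solve 3 (λ s e k → s :+ (e :+ k) := (s :+ k) :+ e) K.refl (slitSeries y (suc N)) _ (killedSeries y (suc N)) ⟩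
  (slitSeries y (suc N) ⊞ killedSeries y (suc N)) ⊞ (1+var² ⊛ (slitHits ⊛ᵗ all) N ⊞
    var ⊛ ((slitHits ⊛ᵗ all₋) N ⊞ (slitHits ⊛ᵗ all₊) N))
    ≈⟨ K.+-congʳ (slit+killed y N) ⟩
  (1+var² ⊛ slitSeries y N ⊞ var ⊛ (slitSeries (y ℤ.- + 2) N ⊞ slitSeries (y ℤ.+ + 1) N)) ⊞
    (1+var² ⊛ (slitHits ⊛ᵗ all) N ⊞ var ⊛ ((slitHits ⊛ᵗ all₋) N ⊞ (slitHits ⊛ᵗ all₊) N))
    ≈⟨ solve 8 (λ X x s u v e f g → (X :* s :+ x :* (u :+ v)) :+ (X :* e :+ x :* (f :+ g)) :=
                                     X :* (s :+ e) :+ x :* ((u :+ f) :+ (v :+ g)))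
         K.refl 1+var² var (slitSeries y N) (slitSeries (y ℤ.- + 2) N) (slitSeries (y ℤ.+ + 1) N)
         ((slitHits ⊛ᵗ all) N) ((slitHits ⊛ᵗ all₋) N) ((slitHits ⊛ᵗ all₊) N) ⟩
  1+var² ⊛ (slitSeries y ⊞ᵗ slitHits ⊛ᵗ all) N ⊞
    var ⊛ ((slitSeries (y ℤ.- + 2) ⊞ᵗ slitHits ⊛ᵗ all₋) N ⊞ (slitSeries (y ℤ.+ + 1) ⊞ᵗ slitHits ⊛ᵗ all₊) N)
    ≈⟨ K.+-cong (K.*-congˡ {1+var²} (slit-decomposition N y))
         (K.*-congˡ {var} (K.+-cong (slit-decomposition N (y ℤ.- + 2)) (slit-decomposition N (y ℤ.+ + 1)))) ⟩
  1+var² ⊛ all N ⊞ var ⊛ (all₋ N ⊞ all₊ N)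
    ≈⟨ allSeries-suc y N ⟨
  all (suc N) ∎
  where
  open SetoidReasoning K.setoid
  open NaturalSolver ℚˢ.commutativeSemiring using (solve; _:=_; _:+_; _:*_)
  all all₋ all₊ : 𝔸.Series
  all  = allSeries y
  all₋ = allSeries (y ℤ.- + 2)
  all₊ = allSeries (y ℤ.+ + 1)
  expand : (slitHits ⊛ᵗ 𝔸.tail all) N ≋ 1+var² ⊛ (slitHits ⊛ᵗ all) N ⊞ var ⊛ ((slitHits ⊛ᵗ all₋) N ⊞ (slitHits ⊛ᵗ all₊) N)
  expand = begin
    (slitHits ⊛ᵗ 𝔸.tail all) N
      ≈⟨ 𝔸.⊛-cong {slitHits} (λ _ → K.refl) (allSeries-suc y) N ⟩
    (slitHits ⊛ᵗ (1+var² ∙ᵗ all ⊞ᵗ var ∙ᵗ (all₋ ⊞ᵗ all₊))) N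
      ≈⟨ 𝔸.⊛-distribˡ-⊞ slitHits (1+var² ∙ᵗ all) (var ∙ᵗ (all₋ ⊞ᵗ all₊)) N ⟩
    (slitHits ⊛ᵗ (1+var² ∙ᵗ all)) N ⊞ (slitHits ⊛ᵗ (var ∙ᵗ (all₋ ⊞ᵗ all₊))) N
      ≈⟨ K.+-cong (𝔸.⊛-∙ 1+var² slitHits all N) (𝔸.⊛-∙ var slitHits (all₋ ⊞ᵗ all₊) N) ⟩
    1+var² ⊛ (slitHits ⊛ᵗ all) N ⊞ var ⊛ (slitHits ⊛ᵗ (all₋ ⊞ᵗ all₊)) N
      ≈⟨ K.+-congˡ {1+var² ⊛ (slitHits ⊛ᵗ all) N} (K.*-congˡ {var} (𝔸.⊛-distribˡ-⊞ slitHits all₋ all₊ N)) ⟩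
    1+var² ⊛ (slitHits ⊛ᵗ all) N ⊞ var ⊛ ((slitHits ⊛ᵗ all₋) N ⊞ (slitHits ⊛ᵗ all₊) N) ∎

ℚ-+-cancelˡ : ∀ p q r → p ℚ.+ q ≡ p ℚ.+ r → q ≡ r
ℚ-+-cancelˡ = GroupProperties.∙-cancelˡ ℚ.+-0-group

-- The factorisation applied to slit walks.

open WienerHopf ℚ-commutativeSemiring ℚ-+-cancelˡ

-- The series 1 + L.
levelSeries : 𝔸.Series
levelSeries = sub (const ∘ stretch levels)

const-*-⊛ : ∀ c d → const (c ℚ.* d) ≋ const c ⊛ const d
const-*-⊛ c d zero    = refl
const-*-⊛ c d (suc n) = sym (trans (const-⊛ c (const d) (suc n)) (ℚ.*-zeroʳ c))

const-⊛ᵗ : ∀ f g → (const ∘ f) ⊛ᵗ (const ∘ g) ≋ᵗ const ∘ (f ⊛ g)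
const-⊛ᵗ f g zero    = K.sym (const-*-⊛ (f 0) (g 0))
const-⊛ᵗ f g (suc n) = K.trans (K.+-cong (K.sym (const-*-⊛ (f 0) (g (suc n)))) (const-⊛ᵗ (f ∘ suc) g n))
  (K.sym (const-⊞ (f 0 ℚ.* g (suc n)) (((f ∘ suc) ⊛ g) n)))

const-× : ∀ n c → const (n × c) ≋ n ×ᴷ const c
const-× zero    c zero    = refl
const-× zero    c (suc a) = refl
const-× (suc n) c = K.trans (const-⊞ c (n × c)) (K.+-congˡ {const c} (const-× n c))

levelSeries-⊛ : levelSeries ⊛ᵗ allSeries (+ 0) ≋ᵗ θ⁺ (allSeries (+ 0))
levelSeries-⊛ = sub-logDerivative λ n → begin
  ((const ∘ stretch levels) ⊛ᵗ (const ∘ vertical (+ 0))) n  ≈⟨ const-⊛ᵗ (stretch levels) (vertical (+ 0)) n ⟩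
  const ((stretch levels ⊛ vertical (+ 0)) n)               ≈⟨ const-cong (count n) ⟩
  const (suc n × vertical (+ 0) n)                          ≈⟨ const-× (suc n) (vertical (+ 0) n) ⟩
  suc n ×ᴷ const (vertical (+ 0) n)                         ∎
  where
  open SetoidReasoning K.setoid
  count : ∀ n → (stretch levels ⊛ vertical (+ 0)) n ≡ suc n × vertical (+ 0) n
  count n = trans (ℚˢ.⊛-cong {stretch levels} (λ _ → refl) vertical-0 n)
    (trans (stretch-levels-⊛-central n) (×-congʳ (suc n) (sym (vertical-0 n))))

-- The terms of positive, respectively nonpositive, degree in ξ and of
-- positive degree in t.
positivePart nonpositivePart : 𝔸.Series → 𝔸.Series
positivePart f zero    a = 0ℚ
positivePart f (suc N) a with a ℕ.<? suc N
... | yes _ = f (suc N) a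
... | no  _ = 0ℚ
nonpositivePart f zero    a = 0ℚ
nonpositivePart f (suc N) a with a ℕ.<? suc N
... | yes _ = 0ℚ
... | no  _ = f (suc N) a

positivePart-positive : ∀ f → Positive (positivePart f)
positivePart-positive f zero    a _   = refl
positivePart-positive f (suc N) a N≤a with a ℕ.<? suc N
... | yes a<N = contradiction N≤a (ℕ.<⇒≱ a<N)
... | no  _   = refl

nonpositivePart-nonpositive : ∀ f → Nonpositive (nonpositivePart f)
nonpositivePart-nonpositive f (suc N) a a<N with a ℕ.<? suc N
... | yes _   = refl
... | no  a≮N = contradiction a<N a≮N

positivePart-below : ∀ f n → positivePart f (suc n) n ≡ f (suc n) n
positivePart-below f n with n ℕ.<? suc n
... | yes _   = refl
... | no  n≮N = contradiction (ℕ.n<1+n n) n≮N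

parts : ∀ {f} → f 0 ≋ 1ˢ → f ≋ᵗ 1ᵗ ⊞ᵗ (positivePart f ⊞ᵗ nonpositivePart f)
parts f₀ zero    a = trans (f₀ a) (sym (ℚ.+-identityʳ (1ˢ a)))
parts {f} f₀ (suc N) a with a ℕ.<? suc N
... | yes _ = sym (trans (ℚ.+-identityˡ _) (ℚ.+-identityʳ (f (suc N) a)))
... | no  _ = sym (trans (ℚ.+-identityˡ _) (ℚ.+-identityˡ (f (suc N) a)))

slitTail : 𝔸.Series
slitTail zero    a = 0ℚ
slitTail (suc N) a = slitSeries (+ 0) (suc N) a

slitTail-positive : Positive slitTail
slitTail-positive zero    a _   = refl
slitTail-positive (suc N) a N≤a = cong fromℕ (walks-slit N (a ℕ.∸ suc N , cong (_, + 0) (ℤ.⊖-≤ N≤a)))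

slitHits-nonpositive : Nonpositive slitHits
slitHits-nonpositive N a a<N = cong fromℕ (killed-off-slit N
     (subst (λ x → ¬ OnSlit (x , + 0)) (sym (ℤ.⊖-≥ (ℕ.<⇒≤ a<N))) (right (ℕ.m<n⇒0<n∸m a<N))))
  where
  right : ∀ {d} → 0 ℕ.< d → ¬ OnSlit (+ d , + 0)
  right {suc d} _ (zero  , ())
  right {suc d} _ (suc k , ())

factor : (1ᵗ ⊞ᵗ slitTail) ⊞ᵗ slitHits ⊛ᵗ allSeries (+ 0) ≋ᵗ allSeries (+ 0)
factor N = K.trans (K.+-congʳ {(slitHits ⊛ᵗ allSeries (+ 0)) N} (split N)) (slit-decomposition N (+ 0))
  where
  split : ∀ N → (1ᵗ ⊞ᵗ slitTail) N ≋ slitSeries (+ 0) N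
  split zero    zero    = refl
  split zero    (suc a) = sym (slit-start (+ 0) (suc a))
  split (suc N) a       = ℚ.+-identityˡ _

-- The equation for `levelSeries` involves 1 + θ; its constant term 1 accounts for the extra summand
-- B, which cancels.
logDerivative : (positivePart levelSeries ⊞ᵗ nonpositivePart levelSeries) ⊛ᵗ allSeries (+ 0) ≋ᵗ θ (allSeries (+ 0))
logDerivative = A-cancelˡ B _ _ (begin
  B ⊞ᵗ L ⊛ᵗ B             ≈⟨ 𝔸S.+-congʳ (𝔸S.*-identityˡ B) ⟨
  1ᵗ ⊛ᵗ B ⊞ᵗ L ⊛ᵗ B       ≈⟨ 𝔸S.distribʳ B 1ᵗ L ⟨
  (1ᵗ ⊞ᵗ L) ⊛ᵗ B          ≈⟨ 𝔸S.*-congʳ {B} (parts levelSeries-0) ⟨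
  levelSeries ⊛ᵗ B        ≈⟨ levelSeries-⊛ ⟩
  B ⊞ᵗ θ B                ∎)
  where
  open SetoidReasoning 𝔸S.setoid
  B L : 𝔸.Series
  B = allSeries (+ 0)
  L = positivePart levelSeries ⊞ᵗ nonpositivePart levelSeries
  levelSeries-0 : levelSeries 0 ≋ 1ˢ
  levelSeries-0 zero    = refl
  levelSeries-0 (suc a) = refl

-- `a[_]` unfolds to `walks` from `origin`, and the endpoint (1,0) is the first power of ξ, so the
-- linear relation between θS and L₊ applies directly.
N*slitWalks : ∀ n → fromℕ (suc n) ℚ.* fromℕ (a[ (+ 1 , + 0) ] (suc n)) ≡ levelSeries (suc n) n
N*slitWalks n = begin
  fromℕ (suc n) ℚ.* fromℕ (walks (suc n) origin (+ 1 , + 0))  ≡⟨ ×≡fromℕ* (suc n) _ ⟨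
  suc n × fromℕ (walks (suc n) origin (+ 1 , + 0))
    ≡⟨ cong (λ x → suc n × fromℕ (walks (suc n) origin (x , + 0))) [1+n]⊖n≡1 ⟨
  suc n × slitTail (suc n) n                                  ≡⟨ ξ¹-coefficient n ⟨
  positivePart levelSeries (suc n) n                          ≡⟨ positivePart-below levelSeries n ⟩
  levelSeries (suc n) n                                       ∎
  where
  open ≡-Reasoning
  open Factorisation slitTail-positive (λ _ → refl) slitHits-nonpositive slitHits-zero
    (positivePart-positive levelSeries) (nonpositivePart-nonpositive levelSeries) factor logDerivative
  [1+n]⊖n≡1 : suc n ⊖ n ≡ + 1
  [1+n]⊖n≡1 = trans (ℤ.⊖-≥ (ℕ.n≤1+n n)) (cong +_ (ℕ.m+n∸n≡m 1 n))

-- Evaluation of the sums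

open FiniteSums ℚ-commutativeSemiring
open Convolution ℚ-commutativeSemiring
open NaturalSolver ℚ-commutativeSemiring using (solve; _:=_; _:+_; _:*_)

∑-upTo : ∀ n f → ∑ (upTo n) f ≡ Σ< n f
∑-upTo n f = go n id
  where
  go : ∀ n (g : ℕ → ℕ) → ∑ (applyUpTo g n) f ≡ Σ< n (f ∘ g)
  go zero    g = refl
  go (suc n) g = cong (λ t → f (g 0) ℚ.+ t) (go n (g ∘ suc))

∑-filter : ∀ {P : Pred ℕ 0ℓ} (P? : Decidable P) {f g} → (∀ i → P i → f i ≡ g i) → (∀ i → ¬ P i → g i ≡ 0ℚ) →
           ∀ is → ∑ (filter P? is) f ≡ ∑ is g
∑-filter P? in-P out-P []       = refl
∑-filter P? {g = g} in-P out-P (i ∷ is) with P? i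
... | yes p = cong₂ ℚ._+_ (in-P i p) (∑-filter P? in-P out-P is)
... | no ¬p = trans (∑-filter P? in-P out-P is)
  (sym (trans (cong (ℚ._+ ∑ is g) (out-P i ¬p)) (ℚ.+-identityˡ (∑ is g))))

Σ<-stretch : ∀ n (f h : ℕ → ℚ) → Σ< (n ℕ.* 3) (λ j → stretch f j ℚ.* h j) ≡ Σ< n (λ k → f k ℚ.* h (k ℕ.* 3))
Σ<-stretch zero    f h = refl
Σ<-stretch (suc n) f h = cong (λ t → f 0 ℚ.* h 0 ℚ.+ t)
  (trans (drop (h 1) _) (trans (drop (h 2) _) (Σ<-stretch n (f ∘ suc) (λ j → h (3 ℕ.+ j)))))
  where
  drop : ∀ p q → 0ℚ ℚ.* p ℚ.+ q ≡ q
  drop p q = trans (cong (ℚ._+ q) (ℚ.*-zeroˡ p)) (ℚ.+-identityˡ q)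

fromℕ-cancelˡ : ∀ n .{{_ : NonZero n}} {p q} → fromℕ n ℚ.* p ≡ fromℕ n ℚ.* q → p ≡ q
fromℕ-cancelˡ n {p} {q} e = trans (sym (unit p)) (trans (cong ((+ 1 / n) ℚ.*_) e) (unit q))
  where
  unit : ∀ r → (+ 1 / n) ℚ.* (fromℕ n ℚ.* r) ≡ r
  unit r = trans (sym (ℚ.*-assoc (+ 1 / n) (fromℕ n) r)) (trans (cong (ℚ._* r) (/-*-fromℕ 1 n)) (ℚ.*-identityˡ r))

*-∑ : ∀ c is f → c ℚ.* ∑ is f ≡ ∑ is (λ i → c ℚ.* f i)
*-∑ c []       f = ℚ.*-zeroʳ c
*-∑ c (i ∷ is) f = trans (ℚ.*-distribˡ-+ c (f i) (∑ is f)) (cong (λ t → c ℚ.* f i ℚ.+ t) (*-∑ c is f))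

-- `horizontals N k` counts the ways in which N - 3k horizontal steps lead from abscissa 0 to 1;
-- `weight N k` also distributes the 3k vertical steps among all N steps.
horizontals weight : ℕ → ℕ → ℚ
horizontals N k = fromℕ ((N ∸ 3 ℕ.* k) C½ (N ⊖ (3 ℕ.* k ℕ.+ 1)))
weight      N k = fromℕ (N C (3 ℕ.* k)) ℚ.* horizontals N k

weight-vanishes : ∀ {N} k → N ℕ.< 3 ℕ.* k → weight N k ≡ 0ℚ
weight-vanishes {N} k N<3k = trans (cong (ℚ._* b) (cong fromℕ (k>n⇒nCk≡0 N<3k))) (ℚ.*-zeroˡ b)
  where b = horizontals N k

i<3*[1+i] : ∀ i → i ℕ.< 3 ℕ.* suc i
i<3*[1+i] i = ℕ.m≤m+n (suc i) (2 ℕ.* suc i)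

slitWalks-by-levels : ∀ n → fromℕ (suc n) ℚ.* fromℕ (a[ (+ 1 , + 0) ] (suc n)) ≡
  fromℕ (suc n C½ (suc n ⊖ 1)) ℚ.+ Σ< (suc n) (λ i → levels (suc i) ℚ.* weight (suc n) (suc i))
slitWalks-by-levels n = begin
  fromℕ N ℚ.* fromℕ (a[ (+ 1 , + 0) ] N)
    ≡⟨ N*slitWalks n ⟩
  levelSeries N n
    ≡⟨ sub-coefficient (stretch levels) n ⟩
  Σ< (suc N) (λ j → (N C j) × (stretch levels j ℚ.* ((N ∸ j) C½ (N ⊖ suc j)) × 1ℚ))
    ≡⟨ Σ<-cong (suc N) (λ j _ → reorder j) ⟩
  Σ< (suc N) (λ j → stretch levels j ℚ.* h j)
    -- A range divisible by 3 can be summed in blocks of three, each with a single term that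
    -- survives `stretch`; the added terms contain C(N,j) with j > N.
    ≡⟨ Σ<-extend (λ j → stretch levels j ℚ.* h j) (ℕ.m≤m*n (suc N) 3) (λ j N<j →
         trans (cong (stretch levels j ℚ.*_) (h-vanishes j N<j)) (ℚ.*-zeroʳ (stretch levels j))) ⟩
  Σ< (suc N ℕ.* 3) (λ j → stretch levels j ℚ.* h j)
    ≡⟨ Σ<-stretch (suc N) levels h ⟩
  1ℚ ℚ.* h 0 ℚ.+ Σ< N (λ i → levels (suc i) ℚ.* h (suc i ℕ.* 3))
    ≡⟨ cong₂ ℚ._+_ (trans (ℚ.*-identityˡ (h 0)) (ℚ.*-identityˡ (fromℕ (N C½ (N ⊖ 1)))))
         (Σ<-cong N λ i _ → cong (levels (suc i) ℚ.*_) (as-weight (suc i))) ⟩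
  fromℕ (N C½ (N ⊖ 1)) ℚ.+ Σ< N (λ i → levels (suc i) ℚ.* weight N (suc i)) ∎
  where
  open ≡-Reasoning
  N : ℕ
  N = suc n
  h : ℕ → ℚ
  h j = fromℕ (N C j) ℚ.* fromℕ ((N ∸ j) C½ (N ⊖ suc j))
  h-vanishes : ∀ j → suc N ℕ.≤ j → h j ≡ 0ℚ
  h-vanishes j N<j = trans (cong (λ c → fromℕ c ℚ.* b) (k>n⇒nCk≡0 N<j)) (ℚ.*-zeroˡ b)
    where b = fromℕ ((N ∸ j) C½ (N ⊖ suc j))
  reorder : ∀ j → (N C j) × (stretch levels j ℚ.* ((N ∸ j) C½ (N ⊖ suc j)) × 1ℚ) ≡ stretch levels j ℚ.* h j
  reorder j = begin
    (N C j) × (stretch levels j ℚ.* b × 1ℚ)                  ≡⟨ ×≡fromℕ* (N C j) (stretch levels j ℚ.* b × 1ℚ) ⟩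
    fromℕ (N C j) ℚ.* (stretch levels j ℚ.* b × 1ℚ)
      ≡⟨ cong (λ t → fromℕ (N C j) ℚ.* (stretch levels j ℚ.* t)) (trans (×≡fromℕ* b 1ℚ) (ℚ.*-identityʳ (fromℕ b))) ⟩
    fromℕ (N C j) ℚ.* (stretch levels j ℚ.* fromℕ b)
      ≡⟨ solve 3 (λ c s b → c :* (s :* b) := s :* (c :* b)) refl (fromℕ (N C j)) (stretch levels j) (fromℕ b) ⟩
    stretch levels j ℚ.* h j                                 ∎
    where b = (N ∸ j) C½ (N ⊖ suc j)
  as-weight : ∀ k → h (k ℕ.* 3) ≡ weight N k
  as-weight k = trans (cong h (ℕ.*-comm k 3))
    (cong (λ t → fromℕ (N C (3 ℕ.* k)) ℚ.* fromℕ ((N ∸ 3 ℕ.* k) C½ (N ⊖ t))) (ℕ.+-comm 1 (3 ℕ.* k)))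

-- The first sum.

geometric-* : ∀ k → geometric k ℚ.* fromℕ (2 ℕ.^ (2 ℕ.* k)) ≡ fromℕ (3 ℕ.^ (3 ℕ.* k))
geometric-* k = trans (cong (λ t → geometric k ℚ.* fromℕ t) (sym (ℕ.^-*-assoc 2 2 k)))
  (trans (go k) (cong fromℕ (ℕ.^-*-assoc 3 3 k)))
  where
  open ≡-Reasoning
  go : ∀ k → geometric k ℚ.* fromℕ (4 ℕ.^ k) ≡ fromℕ (27 ℕ.^ k)
  go zero    = refl
  go (suc k) = begin
    27/4 ℚ.* geometric k ℚ.* fromℕ (4 ℕ.* 4 ℕ.^ k)             ≡⟨ cong (27/4 ℚ.* geometric k ℚ.*_) (fromℕ-* 4 (4 ℕ.^ k)) ⟩
    27/4 ℚ.* geometric k ℚ.* (fromℕ 4 ℚ.* fromℕ (4 ℕ.^ k))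
      ≡⟨ solve 4 (λ a g b f → a :* g :* (b :* f) := a :* b :* (g :* f))
           refl 27/4 (geometric k) (fromℕ 4) (fromℕ (4 ℕ.^ k)) ⟩
    fromℕ 27 ℚ.* (geometric k ℚ.* fromℕ (4 ℕ.^ k))             ≡⟨ cong (fromℕ 27 ℚ.*_) (go k) ⟩
    fromℕ 27 ℚ.* fromℕ (27 ℕ.^ k)                              ≡⟨ fromℕ-* 27 (27 ℕ.^ k) ⟨
    fromℕ (27 ℕ.* 27 ℕ.^ k)                                    ∎

coeff₁-* : ∀ k .{{_ : NonZero k}} → coeff₁ k ℚ.* fromℕ (k ℕ.* 2 ℕ.^ (2 ℕ.* k)) ≡ fromℕ (3 ℕ.^ (3 ℕ.* k ∸ 1))
coeff₁-* k {{k≢0}} = /-*-fromℕ (3 ℕ.^ (3 ℕ.* k ∸ 1)) (k ℕ.* 2 ℕ.^ (2 ℕ.* k))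
  {{ℕ.m*n≢0 k (2 ℕ.^ (2 ℕ.* k)) {{k≢0}} {{ℕ.m^n≢0 2 (2 ℕ.* k)}}}}

-- By absorption N C(N-1, 3k-1) = 3k C(N, 3k), which cancels the k in the denominator and completes
-- 3^(3k-1) to 3^(3k).
N*term₁ : ∀ n i → fromℕ (suc n) ℚ.* term₁ (suc n) (suc i) ≡ geometric (suc i) ℚ.* weight (suc n) (suc i)
N*term₁ n i = begin
  fromℕ N ℚ.* (coeff₁ k ℚ.* fromℕ (n C e) ℚ.* b)
    ≡⟨ solve 4 (λ N c d b → N :* (c :* d :* b) := (N :* d :* c) :* b) refl (fromℕ N) (coeff₁ k) (fromℕ (n C e)) b ⟩
  (fromℕ N ℚ.* fromℕ (n C e) ℚ.* coeff₁ k) ℚ.* b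
    ≡⟨ cong (ℚ._* b) (fromℕ-cancelˡ d {{ℕ.m*n≢0 k (2 ℕ.^ (2 ℕ.* k)) {{_}} {{ℕ.m^n≢0 2 (2 ℕ.* k)}}}} cleared) ⟩
  (geometric k ℚ.* fromℕ (N C (3 ℕ.* k))) ℚ.* b
    ≡⟨ ℚ.*-assoc (geometric k) (fromℕ (N C (3 ℕ.* k))) b ⟩
  geometric k ℚ.* weight N k ∎
  where
  open ≡-Reasoning
  N k e d : ℕ
  N = suc n
  k = suc i
  e = 3 ℕ.* k ∸ 1
  d = k ℕ.* 2 ℕ.^ (2 ℕ.* k)
  b : ℚ
  b = horizontals N k
  absorb : N ℕ.* (n C e) ℕ.* 3 ℕ.^ e ≡ 3 ℕ.^ (3 ℕ.* k) ℕ.* (k ℕ.* (N C (3 ℕ.* k)))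
  absorb = trans (cong (ℕ._* 3 ℕ.^ e) (sym ([1+k]*[1+n]C[1+k]≡[1+n]*nCk n e))) (rearrange k (N C (3 ℕ.* k)) (3 ℕ.^ e))
    where
    rearrange : ∀ k c p → 3 ℕ.* k ℕ.* c ℕ.* p ≡ 3 ℕ.* p ℕ.* (k ℕ.* c)
    rearrange = ℕ-Solver.solve-∀
  cleared : fromℕ d ℚ.* (fromℕ N ℚ.* fromℕ (n C e) ℚ.* coeff₁ k) ≡ fromℕ d ℚ.* (geometric k ℚ.* fromℕ (N C (3 ℕ.* k)))
  cleared = begin
    fromℕ d ℚ.* (fromℕ N ℚ.* fromℕ (n C e) ℚ.* coeff₁ k)
      ≡⟨ solve 4 (λ d N c f → d :* (N :* c :* f) := N :* c :* (f :* d)) refl (fromℕ d) (fromℕ N) (fromℕ (n C e)) (coeff₁ k) ⟩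
    fromℕ N ℚ.* fromℕ (n C e) ℚ.* (coeff₁ k ℚ.* fromℕ d)
      ≡⟨ cong₂ ℚ._*_ (sym (fromℕ-* N (n C e))) (coeff₁-* k) ⟩
    fromℕ (N ℕ.* (n C e)) ℚ.* fromℕ (3 ℕ.^ e)
      ≡⟨ fromℕ-* (N ℕ.* (n C e)) (3 ℕ.^ e) ⟨
    fromℕ (N ℕ.* (n C e) ℕ.* 3 ℕ.^ e)
      ≡⟨ cong fromℕ absorb ⟩
    fromℕ (3 ℕ.^ (3 ℕ.* k) ℕ.* (k ℕ.* (N C (3 ℕ.* k))))
      ≡⟨ trans (fromℕ-* (3 ℕ.^ (3 ℕ.* k)) (k ℕ.* (N C (3 ℕ.* k))))
           (cong (fromℕ (3 ℕ.^ (3 ℕ.* k)) ℚ.*_) (fromℕ-* k (N C (3 ℕ.* k)))) ⟩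
    fromℕ (3 ℕ.^ (3 ℕ.* k)) ℚ.* (fromℕ k ℚ.* fromℕ (N C (3 ℕ.* k)))
      ≡⟨ cong (ℚ._* (fromℕ k ℚ.* fromℕ (N C (3 ℕ.* k)))) (geometric-* k) ⟨
    geometric k ℚ.* fromℕ (2 ℕ.^ (2 ℕ.* k)) ℚ.* (fromℕ k ℚ.* fromℕ (N C (3 ℕ.* k)))
      ≡⟨ solve 4 (λ g t k c → g :* t :* (k :* c) := (k :* t) :* (g :* c)) refl
           (geometric k) (fromℕ (2 ℕ.^ (2 ℕ.* k))) (fromℕ k) (fromℕ (N C (3 ℕ.* k))) ⟩
    (fromℕ k ℚ.* fromℕ (2 ℕ.^ (2 ℕ.* k))) ℚ.* (geometric k ℚ.* fromℕ (N C (3 ℕ.* k)))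
      ≡⟨ cong (ℚ._* (geometric k ℚ.* fromℕ (N C (3 ℕ.* k)))) (fromℕ-* k (2 ℕ.^ (2 ℕ.* k))) ⟨
    fromℕ d ℚ.* (geometric k ℚ.* fromℕ (N C (3 ℕ.* k))) ∎

div<⇒<* : ∀ m n → m div 3 ℕ.≤ n → m ℕ.< 3 ℕ.* suc n
div<⇒<* m n q≤n = begin-strict
  m                                ≡⟨ m≡m%n+[m/n]*n m 3 ⟩
  m ℕ.% 3 ℕ.+ (m div 3) ℕ.* 3      <⟨ ℕ.+-mono-<-≤ (m%n<n m 3) (ℕ.*-monoˡ-≤ 3 q≤n) ⟩
  suc n ℕ.* 3                      ≡⟨ ℕ.*-comm (suc n) 3 ⟩
  3 ℕ.* suc n                      ∎
  where open ℕ.≤-Reasoning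

N*sum₁ : ∀ n → fromℕ (suc n) ℚ.* sum₁ (suc n) ≡ Σ< (suc n) (λ i → geometric (suc i) ℚ.* weight (suc n) (suc i))
N*sum₁ n = begin
  fromℕ (suc n) ℚ.* sum₁ (suc n)
    ≡⟨ cong (fromℕ (suc n) ℚ.*_) (∑-upTo (suc n div 3) (λ i → term₁ (suc n) (suc i))) ⟩
  fromℕ (suc n) ℚ.* Σ< (suc n div 3) (λ i → term₁ (suc n) (suc i))
    ≡⟨ *-Σ< (suc n div 3) (fromℕ (suc n)) (λ i → term₁ (suc n) (suc i)) ⟩
  Σ< (suc n div 3) (λ i → fromℕ (suc n) ℚ.* term₁ (suc n) (suc i))
    ≡⟨ Σ<-cong (suc n div 3) (λ i _ → N*term₁ n i) ⟩
  Σ< (suc n div 3) (λ i → geometric (suc i) ℚ.* weight (suc n) (suc i))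
    ≡⟨ Σ<-extend (λ i → geometric (suc i) ℚ.* weight (suc n) (suc i)) (m/n≤m (suc n) 3) (λ i q≤i →
         trans (cong (geometric (suc i) ℚ.*_) (weight-vanishes (suc i) (div<⇒<* (suc n) i q≤i)))
              (ℚ.*-zeroʳ (geometric (suc i)))) ⟩
  Σ< (suc n) (λ i → geometric (suc i) ℚ.* weight (suc n) (suc i)) ∎
  where open ≡-Reasoning

-- The second sum.

-- Choices of a + b + 1 among n + 1 positions, sorted by the position of the (a + 1)-st chosen one.
-- In the second sum of the formula the index n is therefore the position of the (3k + 1)-st of 3(m
-- + k + 1) vertical steps.
hockey-stick : ∀ a b n → ((λ i → i C a) ℕˢ.⊛ (λ j → j C b)) n ≡ suc n C suc (a ℕ.+ b)
hockey-stick zero    zero    zero    = refl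
hockey-stick zero    (suc b) zero    = refl
hockey-stick (suc a) b       zero    = refl
hockey-stick zero    b       (suc n) = trans
  (cong₂ ℕ._+_ (ℕ.*-identityˡ (suc n C b)) (hockey-stick zero b n)) (nCk+nC[k+1]≡[n+1]C[k+1] (suc n) b)
hockey-stick (suc a) b       (suc n) = begin
  ((λ i → suc i C suc a) ℕˢ.⊛ g) n
    ≡⟨ ℕˢ.⊛-cong {g = g} (λ i → sym (nCk+nC[k+1]≡[n+1]C[k+1] i a)) (λ _ → refl) n ⟩
  ((λ i → (i C a) ℕ.+ (i C suc a)) ℕˢ.⊛ g) n
    ≡⟨ ℕˢ.⊛-distribʳ-⊞ g (_C a) (_C suc a) n ⟩
  ((_C a) ℕˢ.⊛ g) n ℕ.+ ((_C suc a) ℕˢ.⊛ g) n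
    ≡⟨ cong₂ ℕ._+_ (hockey-stick a b n) (hockey-stick (suc a) b n) ⟩
  (suc n C suc (a ℕ.+ b)) ℕ.+ (suc n C suc (suc (a ℕ.+ b)))
    ≡⟨ nCk+nC[k+1]≡[n+1]C[k+1] (suc n) (suc (a ℕ.+ b)) ⟩
  suc (suc n) C suc (suc (a ℕ.+ b)) ∎
  where
  open ≡-Reasoning
  g : ℕ → ℕ
  g j = j C b

nCk*[k!*[n∸k]!]≡n! : ∀ {n k} → k ℕ.≤ n → (n C k) ℕ.* (k ! ℕ.* (n ∸ k) !) ≡ n !
nCk*[k!*[n∸k]!]≡n! {n} {k} k≤n = trans
  (cong (ℕ._* (k ! ℕ.* (n ∸ k) !)) (nCk≡n!/k![n-k]! k≤n))
  (m/n*n≡m {{k ℕ.!* (n ∸ k) !≢0}} (k![n∸k]!∣n! k≤n))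

factorials≢0 : ∀ a b c → NonZero (a ! ℕ.* b ! ℕ.* c !)
factorials≢0 a b c = ℕ.m*n≢0 (a ! ℕ.* b !) (c !) {{ℕ.m*n≢0 (a !) (b !) {{a ℕ.!≢0}} {{b ℕ.!≢0}}}} {{c ℕ.!≢0}}

multinomial-* : ∀ n a b c → multinomial n a b c ℚ.* fromℕ (a ! ℕ.* b ! ℕ.* c !) ≡ fromℕ (n !)
multinomial-* n a b c = /-*-fromℕ (n !) (a ! ℕ.* b ! ℕ.* c !) {{factorials≢0 a b c}}

-- With n = i + 1 the multinomial is C(n, 3k+1) C(3k+1, k). The second binomial is 3k + 1 times the
-- number of ternary trees, and absorbing that factor into the first gives n C(n-1, 3k).
multinomial-ternary : ∀ i k → 3 ℕ.* k ℕ.≤ i →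
  multinomial (suc i) k (2 ℕ.* k ℕ.+ 1) (suc i ∸ (3 ℕ.* k ℕ.+ 1)) ≡
  fromℕ (suc i) ℚ.* (fromℕ (i C (3 ℕ.* k)) ℚ.* fromℕ (ternaryTrees k))
multinomial-ternary i k 3k≤i = fromℕ-cancelˡ f {{factorials≢0 k b c}} (begin
  fromℕ f ℚ.* multinomial (suc i) k b c
    ≡⟨ ℚ.*-comm (fromℕ f) _ ⟩
  multinomial (suc i) k b c ℚ.* fromℕ f
    ≡⟨ multinomial-* (suc i) k b c ⟩
  fromℕ (suc i !)
    ≡⟨ cong fromℕ count ⟩
  fromℕ (f ℕ.* (suc i ℕ.* ((i C (3 ℕ.* k)) ℕ.* ternaryTrees k)))
    ≡⟨ fromℕ-* f (suc i ℕ.* ((i C (3 ℕ.* k)) ℕ.* ternaryTrees k)) ⟩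
  fromℕ f ℚ.* fromℕ (suc i ℕ.* ((i C (3 ℕ.* k)) ℕ.* ternaryTrees k))
    ≡⟨ cong (fromℕ f ℚ.*_) (trans (fromℕ-* (suc i) ((i C (3 ℕ.* k)) ℕ.* ternaryTrees k))
         (cong (fromℕ (suc i) ℚ.*_) (fromℕ-* (i C (3 ℕ.* k)) (ternaryTrees k)))) ⟩
  fromℕ f ℚ.* (fromℕ (suc i) ℚ.* (fromℕ (i C (3 ℕ.* k)) ℚ.* fromℕ (ternaryTrees k))) ∎)
  where
  open ≡-Reasoning
  b c f m : ℕ
  b = 2 ℕ.* k ℕ.+ 1
  c = suc i ∸ (3 ℕ.* k ℕ.+ 1)
  f = k ! ℕ.* b ! ℕ.* c !
  m = 3 ℕ.* k ℕ.+ 1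
  m≡suc : m ≡ suc (3 ℕ.* k)
  m≡suc = ℕ.+-comm (3 ℕ.* k) 1
  m≤1+i : m ℕ.≤ suc i
  m≤1+i = ℕ.≤-trans (ℕ.≤-reflexive m≡suc) (ℕ.s≤s 3k≤i)
  k+b≡m : k ℕ.+ b ≡ m
  k+b≡m = rearrange k
    where
    rearrange : ∀ k → k ℕ.+ (2 ℕ.* k ℕ.+ 1) ≡ 3 ℕ.* k ℕ.+ 1
    rearrange = ℕ-Solver.solve-∀
  m! : (m C k) ℕ.* (k ! ℕ.* b !) ≡ m !
  m! = trans (cong (λ t → (m C k) ℕ.* (k ! ℕ.* t !)) (trans (sym (ℕ.m+n∸m≡n k b)) (cong (_∸ k) k+b≡m)))
    (nCk*[k!*[n∸k]!]≡n! (ℕ.≤-trans (ℕ.m≤m+n k b) (ℕ.≤-reflexive k+b≡m)))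
  absorb : m ℕ.* (suc i C m) ≡ suc i ℕ.* (i C (3 ℕ.* k))
  absorb = trans (cong (λ t → t ℕ.* (suc i C t)) m≡suc) ([1+k]*[1+n]C[1+k]≡[1+n]*nCk i (3 ℕ.* k))
  count : suc i ! ≡ f ℕ.* (suc i ℕ.* ((i C (3 ℕ.* k)) ℕ.* ternaryTrees k))
  count = begin
    suc i !
      ≡⟨ nCk*[k!*[n∸k]!]≡n! m≤1+i ⟨
    (suc i C m) ℕ.* (m ! ℕ.* c !)
      ≡⟨ cong (λ t → (suc i C m) ℕ.* (t ℕ.* c !)) m! ⟨
    (suc i C m) ℕ.* ((m C k) ℕ.* (k ! ℕ.* b !) ℕ.* c !)
      ≡⟨ cong (λ t → (suc i C m) ℕ.* (t ℕ.* (k ! ℕ.* b !) ℕ.* c !)) ([3k+1]*ternary k) ⟨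
    (suc i C m) ℕ.* (m ℕ.* ternaryTrees k ℕ.* (k ! ℕ.* b !) ℕ.* c !)
      ≡⟨ collect (suc i C m) m (ternaryTrees k) (k !) (b !) (c !) ⟩
    f ℕ.* (m ℕ.* (suc i C m) ℕ.* ternaryTrees k)
      ≡⟨ cong (λ t → f ℕ.* (t ℕ.* ternaryTrees k)) absorb ⟩
    f ℕ.* (suc i ℕ.* (i C (3 ℕ.* k)) ℕ.* ternaryTrees k)
      ≡⟨ cong (f ℕ.*_) (ℕ.*-assoc (suc i) (i C (3 ℕ.* k)) (ternaryTrees k)) ⟩
    f ℕ.* (suc i ℕ.* ((i C (3 ℕ.* k)) ℕ.* ternaryTrees k)) ∎
    where
    collect : ∀ x m t a b c → x ℕ.* (m ℕ.* t ℕ.* (a ℕ.* b) ℕ.* c) ≡ a ℕ.* b ℕ.* c ℕ.* (m ℕ.* x ℕ.* t)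
    collect = ℕ-Solver.solve-∀

coeff₂-* : ∀ N n m .{{_ : NonZero N}} .{{_ : NonZero n}} →
  fromℕ N ℚ.* coeff₂ N n m ℚ.* fromℕ n ≡ 9/4 ℚ.* geometric m
coeff₂-* N n m = fromℕ-cancelˡ t {{ℕ.m^n≢0 2 e}} (begin
  fromℕ t ℚ.* (fromℕ N ℚ.* coeff₂ N n m ℚ.* fromℕ n)
    ≡⟨ solve 4 (λ t N c n → t :* (N :* c :* n) := c :* (n :* N :* t)) refl (fromℕ t) (fromℕ N) (coeff₂ N n m) (fromℕ n) ⟩
  coeff₂ N n m ℚ.* (fromℕ n ℚ.* fromℕ N ℚ.* fromℕ t)
    ≡⟨ cong (coeff₂ N n m ℚ.*_) (trans (fromℕ-* (n ℕ.* N) t) (cong (ℚ._* fromℕ t) (fromℕ-* n N))) ⟨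
  coeff₂ N n m ℚ.* fromℕ (n ℕ.* N ℕ.* t)
    ≡⟨ /-*-fromℕ (3 ℕ.^ (3 ℕ.* m ℕ.+ 2)) (n ℕ.* N ℕ.* t) {{ℕ.m*n≢0 (n ℕ.* N) t {{ℕ.m*n≢0 n N}} {{ℕ.m^n≢0 2 e}}}} ⟩
  fromℕ (3 ℕ.^ (3 ℕ.* m ℕ.+ 2))
    ≡⟨ trans (cong fromℕ (ℕ.^-distribˡ-+-* 3 (3 ℕ.* m) 2)) (fromℕ-* (3 ℕ.^ (3 ℕ.* m)) 9) ⟩
  fromℕ (3 ℕ.^ (3 ℕ.* m)) ℚ.* fromℕ 9
    ≡⟨ cong (ℚ._* fromℕ 9) (geometric-* m) ⟨
  geometric m ℚ.* fromℕ (2 ℕ.^ (2 ℕ.* m)) ℚ.* (fromℕ 4 ℚ.* 9/4)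
    ≡⟨ solve 4 (λ g p q r → g :* p :* (q :* r) := p :* q :* (r :* g))
         refl (geometric m) (fromℕ (2 ℕ.^ (2 ℕ.* m))) (fromℕ 4) 9/4 ⟩
  fromℕ (2 ℕ.^ (2 ℕ.* m)) ℚ.* fromℕ 4 ℚ.* (9/4 ℚ.* geometric m)
    ≡⟨ cong (ℚ._* (9/4 ℚ.* geometric m))
         (trans (cong fromℕ (ℕ.^-distribˡ-+-* 2 (2 ℕ.* m) 2)) (fromℕ-* (2 ℕ.^ (2 ℕ.* m)) 4)) ⟨
  fromℕ t ℚ.* (9/4 ℚ.* geometric m) ∎)
  where
  open ≡-Reasoning
  e t : ℕ
  e = 2 ℕ.* m ℕ.+ 2
  t = 2 ℕ.^ e

-- N term₂ N (1 + i) m k, written so that it vanishes outside the range of summation.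
summand : ℕ → ℕ → ℕ → ℕ → ℚ
summand N i m k =
  9/4 ℚ.* geometric m ℚ.* fromℕ (ternaryTrees k) ℚ.* horizontals N (suc (m ℕ.+ k)) ℚ.*
  (fromℕ (i C (3 ℕ.* k)) ℚ.* fromℕ ((N ∸ suc i) C (3 ℕ.* m ℕ.+ 2)))

N*term₂ : ∀ n i m k → 3 ℕ.* k ℕ.+ 1 ℕ.≤ suc i → fromℕ (suc n) ℚ.* term₂ (suc n) (suc i) m k ≡ summand (suc n) i m k
N*term₂ n i m k 3k+1≤1+i = begin
  fromℕ N ℚ.* (coeff₂ N (suc i) m ℚ.* multinomial (suc i) k (2 ℕ.* k ℕ.+ 1) (suc i ∸ (3 ℕ.* k ℕ.+ 1)) ℚ.* C′ ℚ.* E)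
    ≡⟨ cong (λ t → fromℕ N ℚ.* (coeff₂ N (suc i) m ℚ.* t ℚ.* C′ ℚ.* E))
         (multinomial-ternary i k (ℕ.s≤s⁻¹ (ℕ.≤-trans (ℕ.≤-reflexive (ℕ.+-comm 1 (3 ℕ.* k))) 3k+1≤1+i))) ⟩
  fromℕ N ℚ.* (coeff₂ N (suc i) m ℚ.* (fromℕ (suc i) ℚ.* (c ℚ.* F)) ℚ.* C′ ℚ.* E)
    ≡⟨ solve 7 (λ N z i c F d e → N :* (z :* (i :* (c :* F)) :* d :* e) := N :* z :* i :* F :* e :* (c :* d)) refl
         (fromℕ N) (coeff₂ N (suc i) m) (fromℕ (suc i)) c F C′ E ⟩
  fromℕ N ℚ.* coeff₂ N (suc i) m ℚ.* fromℕ (suc i) ℚ.* F ℚ.* E ℚ.* (c ℚ.* C′)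
    ≡⟨ cong₂ (λ s t → s ℚ.* F ℚ.* t ℚ.* (c ℚ.* C′)) (coeff₂-* N (suc i) m) ends ⟩
  summand N i m k ∎
  where
  open ≡-Reasoning
  N : ℕ
  N = suc n
  c F C′ E : ℚ
  c  = fromℕ (i C (3 ℕ.* k))
  F  = fromℕ (ternaryTrees k)
  C′ = fromℕ ((N ∸ suc i) C (3 ℕ.* m ℕ.+ 2))
  E  = fromℕ ((N ∸ (3 ℕ.* m ℕ.+ 3 ℕ.* k ℕ.+ 3)) C½ (N ⊖ (3 ℕ.* m ℕ.+ 3 ℕ.* k ℕ.+ 4)))
  ends : E ≡ horizontals N (suc (m ℕ.+ k))
  ends = cong₂ (λ s t → fromℕ ((N ∸ s) C½ (N ⊖ t))) (shift m k) (shift′ m k)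
    where
    shift : ∀ m k → 3 ℕ.* m ℕ.+ 3 ℕ.* k ℕ.+ 3 ≡ 3 ℕ.* suc (m ℕ.+ k)
    shift = ℕ-Solver.solve-∀
    shift′ : ∀ m k → 3 ℕ.* m ℕ.+ 3 ℕ.* k ℕ.+ 4 ≡ 3 ℕ.* suc (m ℕ.+ k) ℕ.+ 1
    shift′ = ℕ-Solver.solve-∀

*-zero-factorʳ : ∀ p q {r} → r ≡ 0ℚ → p ℚ.* (q ℚ.* r) ≡ 0ℚ
*-zero-factorʳ p q refl = trans (cong (p ℚ.*_) (ℚ.*-zeroʳ q)) (ℚ.*-zeroʳ p)

*-zero-factorˡ : ∀ p {q} r → q ≡ 0ℚ → p ℚ.* (q ℚ.* r) ≡ 0ℚ
*-zero-factorˡ p r refl = trans (cong (p ℚ.*_) (ℚ.*-zeroˡ r)) (ℚ.*-zeroʳ p)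

summand-vanishes-k : ∀ N i m k → i ℕ.< 3 ℕ.* k → summand N i m k ≡ 0ℚ
summand-vanishes-k N i m k i<3k = *-zero-factorˡ
  (9/4 ℚ.* geometric m ℚ.* fromℕ (ternaryTrees k) ℚ.* horizontals N (suc (m ℕ.+ k))) (fromℕ ((N ∸ suc i) C (3 ℕ.* m ℕ.+ 2)))
  (cong fromℕ (k>n⇒nCk≡0 i<3k))

summand-vanishes-m : ∀ N i m k → N ℕ.< suc i ℕ.+ 3 ℕ.* m ℕ.+ 2 → summand N i m k ≡ 0ℚ
summand-vanishes-m N i m k N<n+3m+2 = *-zero-factorʳ
  (9/4 ℚ.* geometric m ℚ.* fromℕ (ternaryTrees k) ℚ.* horizontals N (suc (m ℕ.+ k))) (fromℕ (i C (3 ℕ.* k)))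
  (cong fromℕ (k>n⇒nCk≡0 (ℕ.m<n+o⇒m∸n<o N (suc i) {{subst NonZero (ℕ.+-comm 2 (3 ℕ.* m)) _}}
    (ℕ.<-≤-trans N<n+3m+2 (ℕ.≤-reflexive (ℕ.+-assoc (suc i) (3 ℕ.* m) 2))))))

N*kSum : ∀ n i m → i ℕ.< suc n →
  fromℕ (suc n) ℚ.* (∑[ k ∈ kRange (suc i) ] term₂ (suc n) (suc i) m k) ≡ Σ< (suc n) (summand (suc n) i m)
N*kSum n i m i<N = begin
  fromℕ N ℚ.* ∑ (kRange (suc i)) (λ k → term₂ N (suc i) m k)
    ≡⟨ *-∑ (fromℕ N) (kRange (suc i)) (λ k → term₂ N (suc i) m k) ⟩
  ∑ (kRange (suc i)) (λ k → fromℕ N ℚ.* term₂ N (suc i) m k)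
    ≡⟨ ∑-filter (λ k → 3 ℕ.* k ℕ.+ 1 ℕ.≤? suc i) (λ k → N*term₂ n i m k)
         (λ k ≰ → summand-vanishes-k N i m k (beyond k ≰)) (upTo (suc i)) ⟩
  ∑ (upTo (suc i)) (summand N i m)
    ≡⟨ ∑-upTo (suc i) (summand N i m) ⟩
  Σ< (suc i) (summand N i m)
    ≡⟨ Σ<-extend (summand N i m) i<N (λ k i<k → summand-vanishes-k N i m k (ℕ.<-≤-trans i<k (ℕ.m≤n*m k 3))) ⟩
  Σ< N (summand N i m) ∎
  where
  open ≡-Reasoning
  N : ℕ
  N = suc n
  beyond : ∀ k → ¬ (3 ℕ.* k ℕ.+ 1 ℕ.≤ suc i) → i ℕ.< 3 ℕ.* k
  beyond k ≰ = ℕ.s≤s⁻¹ (ℕ.≤-trans (ℕ.≰⇒> ≰) (ℕ.≤-reflexive (ℕ.+-comm (3 ℕ.* k) 1)))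

N*mSum : ∀ n i → i ℕ.< suc n →
  fromℕ (suc n) ℚ.* (∑[ m ∈ mRange (suc n) (suc i) ] ∑[ k ∈ kRange (suc i) ] term₂ (suc n) (suc i) m k) ≡
  Σ< (suc n) (λ m → Σ< (suc n) (summand (suc n) i m))
N*mSum n i i<N = begin
  fromℕ N ℚ.* ∑ (mRange N (suc i)) (λ m → ∑ (kRange (suc i)) (λ k → term₂ N (suc i) m k))
    ≡⟨ *-∑ (fromℕ N) (mRange N (suc i)) (λ m → ∑ (kRange (suc i)) (λ k → term₂ N (suc i) m k)) ⟩
  ∑ (mRange N (suc i)) (λ m → fromℕ N ℚ.* ∑ (kRange (suc i)) (λ k → term₂ N (suc i) m k))
    ≡⟨ ∑-filter (λ m → suc i ℕ.+ 3 ℕ.* m ℕ.+ 2 ℕ.≤? N) (λ m _ → N*kSum n i m i<N)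
         (λ m ≰ → Σ<-zero N λ k _ → summand-vanishes-m N i m k (ℕ.≰⇒> ≰)) (upTo N) ⟩
  ∑ (upTo N) (λ m → Σ< N (summand N i m))
    ≡⟨ ∑-upTo N (λ m → Σ< N (summand N i m)) ⟩
  Σ< N (λ m → Σ< N (summand N i m)) ∎
  where
  open ≡-Reasoning
  N : ℕ
  N = suc n

-- Only the two binomial coefficients depend on `i`, and `hockey-stick` merges them into C(N,
-- 3(m+k+1)).
Σ<-summand : ∀ n m k → Σ< (suc n) (λ i → summand (suc n) i m k) ≡
  (9/4 ℚ.* geometric m) ℚ.* fromℕ (ternaryTrees k) ℚ.* weight (suc n) (suc (m ℕ.+ k))
Σ<-summand n m k = begin
  Σ< N (λ i → p ℚ.* E ℚ.* (fromℕ (i C a) ℚ.* fromℕ ((N ∸ suc i) C b)))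
    ≡⟨ *-Σ< N (p ℚ.* E) (λ i → fromℕ (i C a) ℚ.* fromℕ ((N ∸ suc i) C b)) ⟨
  p ℚ.* E ℚ.* Σ< N (λ i → fromℕ (i C a) ℚ.* fromℕ ((n ∸ i) C b))
    ≡⟨ cong (p ℚ.* E ℚ.*_) (⊛-as-Σ< (fromℕ ∘ (_C a)) (fromℕ ∘ (_C b)) n) ⟨
  p ℚ.* E ℚ.* ((fromℕ ∘ (_C a)) ⊛ (fromℕ ∘ (_C b))) n
    ≡⟨ cong (p ℚ.* E ℚ.*_) (trans (sym (fromℕ-⊛ (_C a) (_C b) n)) (cong fromℕ (hockey-stick a b n))) ⟩
  p ℚ.* E ℚ.* fromℕ (N C suc (a ℕ.+ b))
    ≡⟨ cong (λ t → p ℚ.* E ℚ.* fromℕ (N C t)) (shift m k) ⟩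
  p ℚ.* E ℚ.* fromℕ (N C (3 ℕ.* suc (m ℕ.+ k)))
    ≡⟨ solve 3 (λ p e c → p :* e :* c := p :* (c :* e)) refl p E (fromℕ (N C (3 ℕ.* suc (m ℕ.+ k)))) ⟩
  p ℚ.* weight N (suc (m ℕ.+ k)) ∎
  where
  open ≡-Reasoning
  N a b : ℕ
  N = suc n
  a = 3 ℕ.* k
  b = 3 ℕ.* m ℕ.+ 2
  p E : ℚ
  p = 9/4 ℚ.* geometric m ℚ.* fromℕ (ternaryTrees k)
  E = horizontals N (suc (m ℕ.+ k))
  shift : ∀ m k → suc (3 ℕ.* k ℕ.+ (3 ℕ.* m ℕ.+ 2)) ≡ 3 ℕ.* suc (m ℕ.+ k)
  shift = ℕ-Solver.solve-∀

-- Once `i` is summed out, the weight depends on m + k alone, so the sums over m and k form the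
-- Cauchy product of (9/4)/(1 - 27z/4) and T.
N*sum₂ : ∀ n → fromℕ (suc n) ℚ.* sum₂ (suc n) ≡
  Σ< (suc n) (λ i → 9/4 ℚ.* (geometric ⊛ (fromℕ ∘ ternaryTrees)) i ℚ.* weight (suc n) (suc i))
N*sum₂ n = begin
  fromℕ N ℚ.* sum₂ N
    ≡⟨ cong (fromℕ N ℚ.*_) (∑-upTo N f) ⟩
  fromℕ N ℚ.* Σ< N f
    ≡⟨ *-Σ< N (fromℕ N) f ⟩
  Σ< N (λ i → fromℕ N ℚ.* f i)
    ≡⟨ Σ<-cong N (N*mSum n) ⟩
  Σ< N (λ i → Σ< N (λ m → Σ< N (summand N i m)))
    ≡⟨ Σ<-swap N N (λ i m → Σ< N (summand N i m)) ⟩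
  Σ< N (λ m → Σ< N (λ i → Σ< N (summand N i m)))
    ≡⟨ Σ<-cong N (λ m _ → trans (Σ<-swap N N (λ i → summand N i m)) (Σ<-cong N λ k _ → Σ<-summand n m k)) ⟩
  Σ< N (λ m → Σ< N (λ k → (9/4 ℚ.* geometric m) ℚ.* fromℕ (ternaryTrees k) ℚ.* weight N (suc (m ℕ.+ k))))
    ≡⟨ Σ<-⊛ N (λ m → 9/4 ℚ.* geometric m) (fromℕ ∘ ternaryTrees) (λ i → weight N (suc i))
         (λ i N≤i → weight-vanishes (suc i) (ℕ.≤-<-trans N≤i (i<3*[1+i] i))) ⟨
  Σ< N (λ i → ((λ m → 9/4 ℚ.* geometric m) ⊛ (fromℕ ∘ ternaryTrees)) i ℚ.* weight N (suc i))
    ≡⟨ Σ<-cong N (λ i _ → cong (ℚ._* weight N (suc i)) (ℚˢ.∙-⊛ 9/4 geometric (fromℕ ∘ ternaryTrees) i)) ⟩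
  Σ< N (λ i → 9/4 ℚ.* (geometric ⊛ (fromℕ ∘ ternaryTrees)) i ℚ.* weight N (suc i)) ∎
  where
  open ≡-Reasoning
  N : ℕ
  N = suc n
  f : ℕ → ℚ
  f i = ∑[ m ∈ mRange N (suc i) ] ∑[ k ∈ kRange (suc i) ] term₂ N (suc i) m k

open import Data.Rational.Base using (_+_; _*_)

mainTheorem7 : (N : ℕ) .{{_ : NonZero N}} →
    fromℕ (a[ (+ 1 , + 0) ] N) ≡ (+ 1 / N) * fromℕ (N C½ (N ⊖ 1)) + sum₁ N + sum₂ N
mainTheorem7 (suc n) = fromℕ-cancelˡ N (begin
  fromℕ N * fromℕ (a[ (+ 1 , + 0) ] N)
    ≡⟨ slitWalks-by-levels n ⟩
  c + Σ< N (λ i → levels (suc i) * weight N (suc i))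
    -- Here the numerator 1 + (9/4) z T of R is split. The isolated term `c` belongs to the constant
    -- coefficient 1 of R and receives its factor 1/N when N is cancelled.
    ≡⟨ cong (c ℚ.+_) (trans (Σ<-cong N λ i _ → trans (cong (ℚ._* weight N (suc i)) (levels-suc i))
         (ℚ.*-distribʳ-+ (weight N (suc i)) (9/4 * (geometric ⊛ (fromℕ ∘ ternaryTrees)) i) (geometric (suc i))))
         (Σ<-+ N (λ i → 9/4 * (geometric ⊛ (fromℕ ∘ ternaryTrees)) i * weight N (suc i))
                 (λ i → geometric (suc i) * weight N (suc i)))) ⟩
  c + (Σ< N (λ i → 9/4 * (geometric ⊛ (fromℕ ∘ ternaryTrees)) i * weight N (suc i)) +
       Σ< N (λ i → geometric (suc i) * weight N (suc i)))
    ≡⟨ cong₂ (λ s t → c + (s + t)) (N*sum₂ n) (N*sum₁ n) ⟨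
  c + (fromℕ N * sum₂ N + fromℕ N * sum₁ N)
    ≡⟨ cong (ℚ._+ (fromℕ N * sum₂ N + fromℕ N * sum₁ N)) N*1/N*c ⟨
  fromℕ N * ((+ 1 / N) * c) + (fromℕ N * sum₂ N + fromℕ N * sum₁ N)
    ≡⟨ solve 4 (λ N x s t → N :* x :+ (N :* t :+ N :* s) := N :* (x :+ s :+ t)) refl
         (fromℕ N) ((+ 1 / N) * c) (sum₁ N) (sum₂ N) ⟩
  fromℕ N * ((+ 1 / N) * c + sum₁ N + sum₂ N) ∎)
  where
  open ≡-Reasoning
  N : ℕ
  N = suc n
  c : ℚ
  c = fromℕ (N C½ (N ⊖ 1))
  N*1/N*c : fromℕ N * ((+ 1 / N) * c) ≡ c
  N*1/N*c = trans (sym (ℚ.*-assoc (fromℕ N) (+ 1 / N) c))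
    (trans (cong (ℚ._* c) (trans (ℚ.*-comm (fromℕ N) (+ 1 / N)) (/-*-fromℕ 1 N))) (ℚ.*-identityˡ c))
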